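{- There exists an absolute constant $C>0$ such that for all integers $b\ge 2$ and $\Delta\ge 2$, every $\Delta$-regular finite simple graph $G$ with at least $C\cdot\Delta^3\cdot\exp\!\big(\frac{\Delta-1}{b-1}\big)$ vertices satisfies $$\chi'_g(G,b)=2\Delta(G)-1.$$
   Context: For a finite simple graph $G$, $\Delta(G)$ denotes its maximum degree. The biased edge coloring game on $G$ with $k$ colors and bias $b$: Maker and Breaker alternate turns, Maker moving first; in each of his turns Maker chooses one previously uncolored edge and assigns it a color from $\{1,\dots,k\}$, while in each of his turns Breaker colors any number of previously uncolored edges that is at most $b$, each with a color from $\{1,\dots,k\}$; throughout, the partial coloring must stay proper (no two edges sharing an endpoint get the same color). Maker wins if at the end all edges are colored; Breaker wins if at some point there is an uncolored edge for which every color in $\{1,\dots,k\}$ already appears on an adjacent edge. $\chi'_g(G,b)$ denotes the smallest $k$ for which Maker has a winning strategy. -}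

module Defs where

open import Data.Nat as ℕ using (ℕ; zero; suc; _∸_; _≤_; _<_)
open import Data.Integer using (+_)
open import Data.Rational as ℚ using (ℚ; 0ℚ; 1ℚ; _/_)
open import Data.Fin using (Fin; _≟_)
open import Data.Bool using (Bool; true; false; _∧_; _∨_; if_then_else_)
import Data.Bool
open import Data.Maybe using (Maybe; just; nothing)
open import Data.List using (List; filter; length)
open import Data.List using () renaming (allFin to allFinL)
open import Data.Product using (Σ; ∃; _×_)
open import Data.Sum using (_⊎_)
open import Relation.Nullary using (¬_)
open import Relation.Nullary.Decidable using (⌊_⌋)
open import Relation.Binary.PropositionalEquality using (_≡_; _≢_)

record SimpleGraph (n : ℕ) : Set where
  field
    Adj    : Fin n → Fin n → Bool
    sym    : ∀ u v → Adj u v ≡ Adj v u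
    irrefl : ∀ u → Adj u u ≡ false
open SimpleGraph public

degree : ∀ {n} → SimpleGraph n → Fin n → ℕ
degree G u = length (filter (λ v → Data.Bool._≟_ (Adj G u v) true) (allFinL _))

Regular : ∀ {n} → SimpleGraph n → ℕ → Set
Regular G Δ = ∀ u → degree G u ≡ Δ

-- Partial edge colourings with colours Fin k.
-- c u v = colour of edge uv (nothing = uncoloured); kept symmetric.

Colouring : ℕ → ℕ → Set
Colouring n k = Fin n → Fin n → Maybe (Fin k)

empty : ∀ {n k} → Colouring n k
empty _ _ = nothing

set : ∀ {n k} → Colouring n k → Fin n → Fin n → Fin k → Colouring n k
set c u v α x y =
  if (⌊ x ≟ u ⌋ ∧ ⌊ y ≟ v ⌋) ∨ (⌊ x ≟ v ⌋ ∧ ⌊ y ≟ u ⌋) then just α else c x y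

Seen : ∀ {n k} → Colouring n k → Fin n → Fin k → Set
Seen c u α = ∃ λ w → c u w ≡ just α

Legal : ∀ {n k} → SimpleGraph n → Colouring n k → Fin n → Fin n → Fin k → Set
Legal G c u v α = Adj G u v ≡ true × c u v ≡ nothing × ¬ Seen c u α × ¬ Seen c v α

Blocked : ∀ {n k} → SimpleGraph n → Colouring n k → Set
Blocked G c = ∃ λ u → ∃ λ v → Adj G u v ≡ true × c u v ≡ nothing ×
  (∀ α → Seen c u α ⊎ Seen c v α)

AllColoured : ∀ {n k} → SimpleGraph n → Colouring n k → Set
AllColoured G c = ∀ u v → Adj G u v ≡ true → c u v ≢ nothing

data Steps {n k} (G : SimpleGraph n) : Colouring n k → ℕ → Colouring n k → Set where
  none : ∀ {c} → Steps G c 0 c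
  step : ∀ {c m c'} u v α → Legal G c u v α → Steps G (set c u v α) m c' →
         Steps G c (suc m) c'

-- MakerWins G b c : in position c with Maker to move, Maker has a strategy
-- guaranteeing that all edges get coloured (Breaker colours ≤ b edges per turn).
-- (Once Blocked, a position stays blocked, and MakerWins c implies ¬ Blocked c,
--  so checking at Maker's turns suffices.)
data MakerWins {n k} (G : SimpleGraph n) (b : ℕ) (c : Colouring n k) : Set where
  finished : AllColoured G c → MakerWins G b c
  play     : ∀ u v α → Legal G c u v α →
             (∀ m c' → m ≤ b → Steps G (set c u v α) m c' → MakerWins G b c') →
             MakerWins G b c

MakerWinsGame : ∀ {n} → SimpleGraph n → (b k : ℕ) → Set
MakerWinsGame {n} G b k = MakerWins {n} {k} G b empty

GameChromaticIndexIs : ∀ {n} → SimpleGraph n → ℕ → ℕ → Set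
GameChromaticIndexIs G b m = MakerWinsGame G b m × (∀ k → k < m → ¬ MakerWinsGame G b k)

-- The exponential as the supremum of its Taylor partial sums.

fromℕ : ℕ → ℚ
fromℕ n = + n / 1

-- a / d as a rational (0 if d = 0; only used with d ≥ 1)
frac : ℕ → ℕ → ℚ
frac a zero    = 0ℚ
frac a (suc d) = + a / suc d

term : ℚ → ℕ → ℚ
term x zero    = 1ℚ
term x (suc j) = term x j ℚ.* x ℚ.* frac 1 (suc j)

expPartial : ℚ → ℕ → ℚ
expPartial x zero    = 0ℚ
expPartial x (suc N) = expPartial x N ℚ.+ term x N

-- y ≥ exp x  (x ≥ 0), since exp x = sup_N expPartial x N
ExpBelow : ℚ → ℚ → Set
ExpBelow x y = ∀ N → expPartial x N ℚ.≤ y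

BigEnough : ℚ → ℕ → ℕ → ℕ → Set
BigEnough C b Δ n =
  ∀ N → C ℚ.* fromℕ (Δ ℕ.* Δ ℕ.* Δ) ℚ.* expPartial (frac (Δ ∸ 1) (b ∸ 1)) N ℚ.≤ fromℕ n

{-# OPTIONS --safe #-}
module Submission where

-- Greedy colouring shows that 2Δ − 1 colours suffice.  With fewer colours Breaker prepares many far
-- apart gadgets, each a vertex u with a large set of candidate neighbours.  He first colours the
-- edges at u, avoiding damage by Maker: a colour that Maker uses near u is repeated at u, and a
-- neighbour of u touched by Maker is joined to u by one of the next coloured edges.  When a single
-- edge uv is left and v is still untouched, Breaker colours the edges at v with colours missing at u;
-- after Δ − 1 of them uv sees 2Δ − 2 colours.  Breaker always advances a least advanced gadget.
-- Give a gadget with t steps to go a weight that shrinks by the factor (b − 1)/b per step in the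
-- second phase, where one move of Maker can destroy a gadget; in most of the first phase a gadget
-- survives about √Δ moves of Maker, and its weight shrinks by a factor 1 − O(1/(b √Δ)) only.  The b
-- steps of a turn of Breaker then make up for the loss in a turn of Maker, so the total weight does
-- not decrease, and some gadget gets through.  This needs (b/(b−1))^(Δ−1) exp (O(√Δ/b)) gadgets,
-- up to a constant, and since 1 + x + x²/2 ≥ (1 + x)(1 + x²/4) this is O(exp ((Δ−1)/(b−1))).
-- For b = 2 and b = 3 that estimate has exponential room to spare, and cruder parameters are used.

-- The order Δ³ comes from packing. A move of Maker can harm a gadget only within a region of O(Δ²)
-- vertices, and O(Δ³) vertices have a neighbour in it. Keeping a new centre and all its neighbours
-- away from these would cost another factor Δ. Instead a gadget does without up to Δ / 32 of its
-- neighbours as candidates, and double counting of edges finds a centre for which that is enough.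
-- The order √Δ balances two losses. Where one move of Maker can destroy a gadget in the first
-- phase, the weight shrinks by the factor (b - 2)/b per step; if these are the last l steps of the
-- phase, they cost exp (O(l / b)) for b ≥ 4. Earlier a gadget tolerates on the order of l moves,
-- and the Δ steps cost exp (O(Δ / (b l))). For b = 2 the factor (b - 2)/b is 0. There the regions
-- are one layer wider, and an edge with a single end in a region is harmless. This improves the
-- factor to (b - 1)/b, but packing takes O(Δ⁵) vertices per gadget; the exponential room pays for
-- that.

-- Lower bounds for exp by powers of quadratic Taylor polynomials.

module Exponential where

  open import Defs using (fromℕ; frac; term; expPartial)
  import Data.Nat as ℕ
  open ℕ using (ℕ; zero; suc)
  import Data.Nat.Properties as ℕ
  import Data.Integer as ℤ
  import Data.Integer.Properties as ℤ
  open import Data.Rational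
  open import Data.Rational.Properties
  import Data.Rational.Unnormalised as ℚᵘ
  import Data.Rational.Unnormalised.Properties as ℚᵘ
  open import Data.Rational.Solver
  open import Relation.Binary.PropositionalEquality
  open +-*-Solver

  toℚᵘ-fromℕ : ∀ n → toℚᵘ (fromℕ n) ℚᵘ.≃ ℚᵘ.mkℚᵘ (ℤ.+ n) 0
  toℚᵘ-fromℕ n = toℚᵘ-fromℚᵘ (ℚᵘ.mkℚᵘ (ℤ.+ n) 0)

  fromℕ-+ : ∀ m n → fromℕ (m ℕ.+ n) ≡ fromℕ m + fromℕ n
  fromℕ-+ m n = toℚᵘ-injective (ℚᵘ.≃-trans (toℚᵘ-fromℕ (m ℕ.+ n)) (ℚᵘ.≃-sym
    (ℚᵘ.≃-trans (toℚᵘ-homo-+ (fromℕ m) (fromℕ n))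
      (ℚᵘ.≃-trans (ℚᵘ.+-cong (toℚᵘ-fromℕ m) (toℚᵘ-fromℕ n))
        (ℚᵘ.*≡* (cong (ℤ._* ℤ.1ℤ) (cong₂ ℤ._+_ (ℤ.*-identityʳ (ℤ.+ m)) (ℤ.*-identityʳ (ℤ.+ n)))))))))

  fromℕ-* : ∀ m n → fromℕ (m ℕ.* n) ≡ fromℕ m * fromℕ n
  fromℕ-* m n = toℚᵘ-injective (ℚᵘ.≃-trans (toℚᵘ-fromℕ (m ℕ.* n)) (ℚᵘ.≃-sym
    (ℚᵘ.≃-trans (toℚᵘ-homo-* (fromℕ m) (fromℕ n))
      (ℚᵘ.≃-trans (ℚᵘ.*-cong (toℚᵘ-fromℕ m) (toℚᵘ-fromℕ n))
        (ℚᵘ.*≡* (cong (ℤ._* ℤ.1ℤ) (sym (ℤ.pos-* m n))))))))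

  fromℕ-cancel-≤ : ∀ {m n} → fromℕ m ≤ fromℕ n → m ℕ.≤ n
  fromℕ-cancel-≤ {m} {n} le with ℚᵘ.≤-respˡ-≃ (toℚᵘ-fromℕ m) (ℚᵘ.≤-respʳ-≃ (toℚᵘ-fromℕ n) (toℚᵘ-mono-≤ le))
  ... | ℚᵘ.*≤* z = ℤ.drop‿+≤+ (subst₂ ℤ._≤_ (ℤ.*-identityʳ (ℤ.+ m)) (ℤ.*-identityʳ (ℤ.+ n)) z)

  fromℕ-nonNeg : ∀ n → NonNegative (fromℕ n)
  fromℕ-nonNeg n = normalize-nonNeg n 1

  fromℕ-pos : ∀ n → .{{ℕ.NonZero n}} → Positive (fromℕ n)
  fromℕ-pos n = normalize-pos n 1

  frac-nonNeg : ∀ a d → NonNegative (frac a (suc d))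
  frac-nonNeg a d = normalize-nonNeg a (suc d)

  frac-* : ∀ a d → fromℕ (suc d) * frac a (suc d) ≡ fromℕ a
  frac-* a d = toℚᵘ-injective (ℚᵘ.≃-trans (toℚᵘ-homo-* (fromℕ (suc d)) (frac a (suc d)))
    (ℚᵘ.≃-trans (ℚᵘ.*-cong (toℚᵘ-fromℕ (suc d)) (toℚᵘ-fromℚᵘ (ℚᵘ.mkℚᵘ (ℤ.+ a) d)))
      (ℚᵘ.≃-trans (ℚᵘ.*≡* eq) (ℚᵘ.≃-sym (toℚᵘ-fromℕ a)))))
    where
    eq : ((ℤ.+ suc d) ℤ.* (ℤ.+ a)) ℤ.* ℤ.1ℤ ≡ (ℤ.+ a) ℤ.* (ℤ.+ (1 ℕ.* suc d))
    eq = trans (ℤ.*-identityʳ _) (trans (ℤ.*-comm (ℤ.+ suc d) (ℤ.+ a)) (cong (λ z → (ℤ.+ a) ℤ.* (ℤ.+ z)) (sym (ℕ.*-identityˡ (suc d)))))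

  term-rec : ∀ s j → s * term s j ≡ fromℕ (suc j) * term s (suc j)
  term-rec s j = begin
    s * t                   ≡⟨ sym (*-identityˡ (s * t)) ⟩
    1ℚ * (s * t)            ≡⟨ cong (_* (s * t)) (sym (frac-* 1 j)) ⟩
    N * i * (s * t)         ≡⟨ solve 4 (λ N i s t → N :* i :* (s :* t) := N :* (t :* s :* i)) refl N i s t ⟩
    N * (t * s * i)         ∎
    where
    open ≡-Reasoning
    t = term s j
    N = fromℕ (suc j)
    i = frac 1 (suc j)

  term-1 : ∀ x → term x 1 ≡ x
  term-1 x = trans (sym (*-identityˡ (term x 1))) (trans (sym (term-rec x 0)) (*-identityʳ x))

  term-nonNeg : ∀ s .{{_ : NonNegative s}} j → NonNegative (term s j)
  term-nonNeg s zero = _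
  term-nonNeg s (suc j) = nonNeg*nonNeg⇒nonNeg (term s j * s)
    {{nonNeg*nonNeg⇒nonNeg (term s j) {{term-nonNeg s j}} s}} (frac 1 (suc j)) {{frac-nonNeg 1 j}}

  fromℕ-suc : ∀ n → fromℕ (suc n) ≡ 1ℚ + fromℕ n
  fromℕ-suc n = fromℕ-+ 1 n

  p≤p+nonNeg : ∀ p q → .{{NonNegative q}} → p ≤ p + q
  p≤p+nonNeg p q = ≤-trans (≤-reflexive (sym (+-identityʳ p))) (+-mono-≤ (≤-refl {p}) (nonNegative⁻¹ q))

  module _ (s h q : ℚ) .{{_ : NonNegative s}} .{{_ : NonNegative h}} .{{_ : NonNegative q}} (hh : h * h ≡ q + q) where

    private
      t T : ℕ → ℚ
      t = term s
      T = term (s + h)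

    -- The terms of degree at most two in h of the binomial expansion of (s + h)^(j+2) / (j+2)!.
    term-shift : ∀ j → t (2 ℕ.+ j) + h * t (suc j) + q * t j ≤ T (2 ℕ.+ j)
    term-shift zero = *-cancelˡ-≤-pos (fromℕ 2) {{fromℕ-pos 2}} (≤-reflexive (begin
      fromℕ 2 * (t 2 + h * t 1 + q * 1ℚ)
        ≡⟨ cong (_* (t 2 + h * t 1 + q * 1ℚ)) (fromℕ-suc 1) ⟩
      (1ℚ + 1ℚ) * (t 2 + h * t 1 + q * 1ℚ)
        ≡⟨ solve 4 (λ h q t₁ t₂ → (con 1ℚ :+ con 1ℚ) :* (t₂ :+ h :* t₁ :+ q :* con 1ℚ)
                      := (con 1ℚ :+ con 1ℚ) :* t₂ :+ (h :* t₁ :+ h :* t₁) :+ (q :+ q)) refl h q (t 1) (t 2) ⟩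
      (1ℚ + 1ℚ) * t 2 + (h * t 1 + h * t 1) + (q + q)
        ≡⟨ cong₂ (λ x y → x + (h * t 1 + h * t 1) + y) (trans (cong (_* t 2) (sym (fromℕ-suc 1))) (sym (term-rec s 1))) (sym hh) ⟩
      s * t 1 + (h * t 1 + h * t 1) + h * h
        ≡⟨ cong (λ x → s * x + (h * x + h * x) + h * h) (term-1 s) ⟩
      s * s + (h * s + h * s) + h * h
        ≡⟨ solve 2 (λ s h → s :* s :+ (h :* s :+ h :* s) :+ h :* h := (s :+ h) :* (s :+ h)) refl s h ⟩
      (s + h) * (s + h)
        ≡⟨ cong ((s + h) *_) (sym (term-1 (s + h))) ⟩
      (s + h) * T 1
        ≡⟨ term-rec (s + h) 1 ⟩
      fromℕ 2 * T 2 ∎))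
      where
      open ≡-Reasoning
    term-shift (suc j) = *-cancelˡ-≤-pos (fromℕ (3 ℕ.+ j)) {{fromℕ-pos (3 ℕ.+ j)}} (begin
      fromℕ (3 ℕ.+ j) * (t3 + h * t2 + q * t1)        ≤⟨ p≤p+nonNeg _ (h * q * t0) {{nn}} ⟩
      fromℕ (3 ℕ.+ j) * (t3 + h * t2 + q * t1) + h * q * t0 ≡⟨ sym expand ⟩
      (s + h) * (t2 + h * t1 + q * t0)                 ≤⟨ *-monoˡ-≤-nonNeg (s + h) {{nonNeg+nonNeg⇒nonNeg s h}} (term-shift j) ⟩
      (s + h) * T (2 ℕ.+ j)                            ≡⟨ term-rec (s + h) (2 ℕ.+ j) ⟩
      fromℕ (3 ℕ.+ j) * T (3 ℕ.+ j)                    ∎)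
      where
      open ≤-Reasoning
      t0 = t j
      t1 = t (1 ℕ.+ j)
      t2 = t (2 ℕ.+ j)
      t3 = t (3 ℕ.+ j)
      N = fromℕ (1 ℕ.+ j)
      nn : NonNegative (h * q * t0)
      nn = nonNeg*nonNeg⇒nonNeg (h * q) {{nonNeg*nonNeg⇒nonNeg h q}} t0 {{term-nonNeg s j}}
      N2 : fromℕ (2 ℕ.+ j) ≡ 1ℚ + N
      N2 = fromℕ-suc (1 ℕ.+ j)
      N3 : fromℕ (3 ℕ.+ j) ≡ 1ℚ + (1ℚ + N)
      N3 = trans (fromℕ-suc (2 ℕ.+ j)) (cong (1ℚ +_) N2)
      expand : (s + h) * (t2 + h * t1 + q * t0) ≡ fromℕ (3 ℕ.+ j) * (t3 + h * t2 + q * t1) + h * q * t0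
      expand = ≡.begin
        (s + h) * (t2 + h * t1 + q * t0)
          ≡.≡⟨ solve 6 (λ s h q t0 t1 t2 → (s :+ h) :* (t2 :+ h :* t1 :+ q :* t0)
               := s :* t2 :+ h :* (s :* t1) :+ q :* (s :* t0) :+ h :* t2 :+ (h :* h) :* t1 :+ h :* q :* t0) refl s h q t0 t1 t2 ⟩
        s * t2 + h * (s * t1) + q * (s * t0) + h * t2 + (h * h) * t1 + h * q * t0
          ≡.≡⟨ cong (λ x → s * t2 + h * (s * t1) + q * (s * t0) + h * t2 + x * t1 + h * q * t0) hh ⟩
        s * t2 + h * (s * t1) + q * (s * t0) + h * t2 + (q + q) * t1 + h * q * t0
          ≡.≡⟨ cong (λ x → x + h * (s * t1) + q * (s * t0) + h * t2 + (q + q) * t1 + h * q * t0)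
                 (trans (term-rec s (2 ℕ.+ j)) (cong (_* t3) N3)) ⟩
        (1ℚ + (1ℚ + N)) * t3 + h * (s * t1) + q * (s * t0) + h * t2 + (q + q) * t1 + h * q * t0
          ≡.≡⟨ cong₂ (λ x y → (1ℚ + (1ℚ + N)) * t3 + h * x + q * y + h * t2 + (q + q) * t1 + h * q * t0)
                 (trans (term-rec s (1 ℕ.+ j)) (cong (_* t2) N2)) (term-rec s j) ⟩
        (1ℚ + (1ℚ + N)) * t3 + h * ((1ℚ + N) * t2) + q * (N * t1) + h * t2 + (q + q) * t1 + h * q * t0
          ≡.≡⟨ solve 7 (λ h q N t0 t1 t2 t3 →
                 (con 1ℚ :+ (con 1ℚ :+ N)) :* t3 :+ h :* ((con 1ℚ :+ N) :* t2) :+ q :* (N :* t1) :+ h :* t2 :+ (q :+ q) :* t1 :+ h :* q :* t0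
                 := (con 1ℚ :+ (con 1ℚ :+ N)) :* (t3 :+ h :* t2 :+ q :* t1) :+ h :* q :* t0) refl h q N t0 t1 t2 t3 ⟩
        (1ℚ + (1ℚ + N)) * (t3 + h * t2 + q * t1) + h * q * t0
          ≡.≡⟨ cong (λ x → x * (t3 + h * t2 + q * t1) + h * q * t0) (sym N3) ⟩
        fromℕ (3 ℕ.+ j) * (t3 + h * t2 + q * t1) + h * q * t0 ≡.∎
        where module ≡ = ≡-Reasoning

    E-shift : ∀ N → expPartial s (2 ℕ.+ N) + h * expPartial s (suc N) + q * expPartial s N ≤ expPartial (s + h) (2 ℕ.+ N)
    E-shift zero = ≤-reflexive (begin
      0ℚ + 1ℚ + t 1 + h * (0ℚ + 1ℚ) + q * 0ℚ
        ≡⟨ solve 3 (λ t h q → con 0ℚ :+ con 1ℚ :+ t :+ h :* (con 0ℚ :+ con 1ℚ) :+ q :* con 0ℚ := con 0ℚ :+ con 1ℚ :+ (t :+ h)) refl (t 1) h q ⟩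
      0ℚ + 1ℚ + (t 1 + h)  ≡⟨ cong (λ x → 0ℚ + 1ℚ + x) (trans (cong (_+ h) (term-1 s)) (sym (term-1 (s + h)))) ⟩
      0ℚ + 1ℚ + T 1        ∎)
      where
      open ≡-Reasoning
    E-shift (suc N) = begin
      e2 + t2 + h * (e1 + t1) + q * (e0 + t0)
        ≡⟨ solve 8 (λ h q e0 e1 e2 t0 t1 t2 → e2 :+ t2 :+ h :* (e1 :+ t1) :+ q :* (e0 :+ t0)
             := (e2 :+ h :* e1 :+ q :* e0) :+ (t2 :+ h :* t1 :+ q :* t0)) refl h q e0 e1 e2 t0 t1 t2 ⟩
      (e2 + h * e1 + q * e0) + (t2 + h * t1 + q * t0) ≤⟨ +-mono-≤ (E-shift N) (term-shift N) ⟩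
      expPartial (s + h) (2 ℕ.+ N) + T (2 ℕ.+ N) ∎
      where
      open ≤-Reasoning
      e0 = expPartial s N
      e1 = expPartial s (1 ℕ.+ N)
      e2 = expPartial s (2 ℕ.+ N)
      t0 = t N
      t1 = t (1 ℕ.+ N)
      t2 = t (2 ℕ.+ N)

    E-mono : ∀ N → expPartial s N ≤ expPartial s (suc N)
    E-mono N = p≤p+nonNeg (expPartial s N) (t N) {{term-nonNeg s N}}

    -- By `hh`, `q` is h²/2, so the factor is the quadratic Taylor polynomial of exp at `h`. Two
    -- further terms of the series at `s + h` make room for it.
    exp-step : ∀ N → (1ℚ + h + q) * expPartial s N ≤ expPartial (s + h) (2 ℕ.+ N)
    exp-step N = begin
      (1ℚ + h + q) * e0        ≡⟨ solve 3 (λ h q e → (con 1ℚ :+ h :+ q) :* e := e :+ h :* e :+ q :* e) refl h q e0 ⟩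
      e0 + h * e0 + q * e0     ≤⟨ +-mono-≤ (+-mono-≤ (≤-trans (E-mono N) (E-mono (suc N)))
                                    (*-monoˡ-≤-nonNeg h (E-mono N))) (≤-refl {q * e0}) ⟩
      expPartial s (2 ℕ.+ N) + h * expPartial s (suc N) + q * e0 ≤⟨ E-shift N ⟩
      expPartial (s + h) (2 ℕ.+ N) ∎
      where
      open ≤-Reasoning
      e0 = expPartial s N

  powQ : ℚ → ℕ → ℚ
  powQ u zero    = 1ℚ
  powQ u (suc M) = u * powQ u M

  module _ (h q : ℚ) .{{_ : NonNegative h}} .{{_ : NonNegative q}} (hh : h * h ≡ q + q) where

    private u = 1ℚ + h + q

    pow≤exp : ∀ M → powQ u M ≤ expPartial (fromℕ M * h) (suc (M ℕ.* 2))
    pow≤exp zero = ≤-refl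
    pow≤exp (suc M) = begin
      u * powQ u M                     ≤⟨ *-monoˡ-≤-nonNeg u {{nu}} (pow≤exp M) ⟩
      u * expPartial (fromℕ M * h) N   ≤⟨ exp-step (fromℕ M * h) h q {{nonNeg*nonNeg⇒nonNeg (fromℕ M) {{fromℕ-nonNeg M}} h}} hh N ⟩
      expPartial (fromℕ M * h + h) (2 ℕ.+ N) ≡⟨ cong (λ x → expPartial x (2 ℕ.+ N)) (sym shift) ⟩
      expPartial (fromℕ (suc M) * h) (2 ℕ.+ N) ∎
      where
      open ≤-Reasoning
      N = suc (M ℕ.* 2)
      nu : NonNegative u
      nu = nonNeg+nonNeg⇒nonNeg (1ℚ + h) {{nonNeg+nonNeg⇒nonNeg 1ℚ h}} q
      shift : fromℕ (suc M) * h ≡ fromℕ M * h + h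
      shift = trans (cong (_* h) (fromℕ-suc M)) (solve 2 (λ m h → (con 1ℚ :+ m) :* h := m :* h :+ h) refl (fromℕ M) h)

  fromℕ-pow : ∀ a c u M → fromℕ a * u ≡ fromℕ c → fromℕ (a ℕ.^ M) * powQ u M ≡ fromℕ (c ℕ.^ M)
  fromℕ-pow a c u zero eq = refl
  fromℕ-pow a c u (suc M) eq = begin
    fromℕ (a ℕ.* a ℕ.^ M) * (u * powQ u M)         ≡⟨ cong (_* (u * powQ u M)) (fromℕ-* a (a ℕ.^ M)) ⟩
    fromℕ a * fromℕ (a ℕ.^ M) * (u * powQ u M)     ≡⟨ solve 4 (λ a b u v → a :* b :* (u :* v) := (a :* u) :* (b :* v)) refl (fromℕ a) (fromℕ (a ℕ.^ M)) u (powQ u M) ⟩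
    (fromℕ a * u) * (fromℕ (a ℕ.^ M) * powQ u M)   ≡⟨ cong₂ _*_ eq (fromℕ-pow a c u M eq) ⟩
    fromℕ c * fromℕ (c ℕ.^ M)                      ≡⟨ sym (fromℕ-* c (c ℕ.^ M)) ⟩
    fromℕ (c ℕ.* c ℕ.^ M)                          ∎
    where open ≡-Reasoning

  -- The bound (1 + 1/m + 1/(2m²))^M ≤ exp (M/m), cleared of denominators.
  exp-ℕ : ∀ c K n m M x → x ≡ fromℕ M * frac 1 (suc m) →
    (∀ N → fromℕ c * fromℕ K * expPartial x N ≤ fromℕ n) →
    c ℕ.* K ℕ.* (2 ℕ.* (suc m ℕ.* suc m) ℕ.+ 2 ℕ.* suc m ℕ.+ 1) ℕ.^ M ℕ.≤ n ℕ.* (2 ℕ.* (suc m ℕ.* suc m)) ℕ.^ M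
  exp-ℕ c K n m M x x≡ big = fromℕ-cancel-≤ (begin
    fromℕ (c ℕ.* K ℕ.* C ℕ.^ M)                ≡⟨ fromℕ-* (c ℕ.* K) (C ℕ.^ M) ⟩
    fromℕ (c ℕ.* K) * fromℕ (C ℕ.^ M)          ≡⟨ cong₂ _*_ (fromℕ-* c K) (sym (fromℕ-pow A C u M Au)) ⟩
    fromℕ c * fromℕ K * (fromℕ (A ℕ.^ M) * powQ u M) ≤⟨ *-monoˡ-≤-nonNeg (fromℕ c * fromℕ K) {{ck}}
         (*-monoˡ-≤-nonNeg (fromℕ (A ℕ.^ M)) {{fromℕ-nonNeg (A ℕ.^ M)}} (pow≤exp h q {{frac-nonNeg 1 m}} {{qn}} hh M)) ⟩
    fromℕ c * fromℕ K * (fromℕ (A ℕ.^ M) * E)  ≡⟨ solve 4 (λ c k a e → c :* k :* (a :* e) := (c :* k :* e) :* a) refl (fromℕ c) (fromℕ K) (fromℕ (A ℕ.^ M)) E ⟩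
    (fromℕ c * fromℕ K * E) * fromℕ (A ℕ.^ M)  ≤⟨ *-monoʳ-≤-nonNeg (fromℕ (A ℕ.^ M)) {{fromℕ-nonNeg (A ℕ.^ M)}}
         (subst (λ y → fromℕ c * fromℕ K * expPartial y (suc (M ℕ.* 2)) ≤ fromℕ n) x≡ (big (suc (M ℕ.* 2)))) ⟩
    fromℕ n * fromℕ (A ℕ.^ M)                  ≡⟨ sym (fromℕ-* n (A ℕ.^ M)) ⟩
    fromℕ (n ℕ.* A ℕ.^ M)                      ∎)
    where
    open ≤-Reasoning
    h = frac 1 (suc m)
    q = h * h * ½
    qn : NonNegative q
    qn = nonNeg*nonNeg⇒nonNeg (h * h) {{nonNeg*nonNeg⇒nonNeg h {{frac-nonNeg 1 m}} h {{frac-nonNeg 1 m}}}} ½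
    hh : h * h ≡ q + q
    hh = trans (sym (*-identityʳ (h * h))) (*-distribˡ-+ (h * h) ½ ½)
    u = 1ℚ + h + q
    A = 2 ℕ.* (suc m ℕ.* suc m)
    C = 2 ℕ.* (suc m ℕ.* suc m) ℕ.+ 2 ℕ.* suc m ℕ.+ 1
    E = expPartial (fromℕ M * h) (suc (M ℕ.* 2))
    ck : NonNegative (fromℕ c * fromℕ K)
    ck = nonNeg*nonNeg⇒nonNeg (fromℕ c) {{fromℕ-nonNeg c}} (fromℕ K) {{fromℕ-nonNeg K}}
    Au : fromℕ A * u ≡ fromℕ C
    Au = trans (cong (_* u) A≡) (trans
      (solve 3 (λ m h q → (con 1ℚ :+ con 1ℚ) :* (m :* m) :* (con 1ℚ :+ h :+ q)
         := (con 1ℚ :+ con 1ℚ) :* (m :* m) :+ (con 1ℚ :+ con 1ℚ) :* m :* (m :* h) :+ m :* m :* (q :+ q)) refl m̂ h q)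
      (trans (cong₂ (λ x y → (1ℚ + 1ℚ) * (m̂ * m̂) + (1ℚ + 1ℚ) * m̂ * x + m̂ * m̂ * y) (frac-* 1 m) (sym hh))
      (trans (solve 2 (λ m h → (con 1ℚ :+ con 1ℚ) :* (m :* m) :+ (con 1ℚ :+ con 1ℚ) :* m :* con 1ℚ :+ m :* m :* (h :* h)
         := (con 1ℚ :+ con 1ℚ) :* (m :* m) :+ (con 1ℚ :+ con 1ℚ) :* m :+ (m :* h) :* (m :* h)) refl m̂ h)
      (trans (cong (λ x → (1ℚ + 1ℚ) * (m̂ * m̂) + (1ℚ + 1ℚ) * m̂ + x * x) (frac-* 1 m))
      (sym C≡)))))
      where
      m̂ = fromℕ (suc m)
      A≡ : fromℕ A ≡ (1ℚ + 1ℚ) * (m̂ * m̂)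
      A≡ = trans (fromℕ-* 2 (suc m ℕ.* suc m)) (cong₂ _*_ (fromℕ-suc 1) (fromℕ-* (suc m) (suc m)))
      C≡ : fromℕ C ≡ (1ℚ + 1ℚ) * (m̂ * m̂) + (1ℚ + 1ℚ) * m̂ + 1ℚ * 1ℚ
      C≡ = trans (fromℕ-+ (A ℕ.+ 2 ℕ.* suc m) 1) (cong (_+ 1ℚ) (trans (fromℕ-+ A (2 ℕ.* suc m))
             (cong₂ _+_ A≡ (trans (fromℕ-* 2 (suc m)) (cong (_* m̂) (fromℕ-suc 1))))))

  frac-unit : ∀ a d → frac a (suc d) ≡ fromℕ a * frac 1 (suc d)
  frac-unit a d = begin
    frac a (suc d)                                      ≡⟨ *-identityˡ (frac a (suc d)) ⟨
    1ℚ * frac a (suc d)                             ≡⟨ cong (_* frac a (suc d)) (sym (trans (*-comm _ (fromℕ (suc d))) (frac-* 1 d))) ⟩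
    (frac 1 (suc d) * fromℕ (suc d)) * frac a (suc d) ≡⟨ *-assoc (frac 1 (suc d)) (fromℕ (suc d)) (frac a (suc d)) ⟩
    frac 1 (suc d) * (fromℕ (suc d) * frac a (suc d)) ≡⟨ cong (frac 1 (suc d) *_) (frac-* a d) ⟩
    frac 1 (suc d) * fromℕ a                          ≡⟨ *-comm (frac 1 (suc d)) (fromℕ a) ⟩
    fromℕ a * frac 1 (suc d)                          ∎
    where open ≡-Reasoning

  -- For b = 2 the exponent D is cut into 2 D steps of one half: the quadratic bound with steps of
  -- length 1 would give (5/2)^D, with halves it gives (169/64)^D, and the estimate needs more than
  -- 2^(11 D / 8).
  frac-halves : ∀ a → frac a 1 ≡ fromℕ (a ℕ.* 2) * frac 1 2
  frac-halves a = begin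
    fromℕ a                                   ≡⟨ *-identityʳ (fromℕ a) ⟨
    fromℕ a * 1ℚ                          ≡⟨ cong (fromℕ a *_) (sym (frac-* 1 1)) ⟩
    fromℕ a * (fromℕ 2 * frac 1 2)        ≡⟨ *-assoc (fromℕ a) (fromℕ 2) (frac 1 2) ⟨
    fromℕ a * fromℕ 2 * frac 1 2          ≡⟨ cong (_* frac 1 2) (sym (fromℕ-* a 2)) ⟩
    fromℕ (a ℕ.* 2) * frac 1 2                ∎
    where open ≡-Reasoning

open import Defs renaming (sym to Adj-sym)
open import Data.Nat
open import Data.Nat.Properties
open import Data.Nat.DivMod using (_/_; _%_; m≡m%n+[m/n]*n; m%n<n; m/n*n≤m)
open import Data.Nat.Induction using (<-wellFounded)
open import Data.Nat.Tactic.RingSolver using (solve-∀)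
open import Data.Rational using (ℚ; Positive)
open import Data.Bool using (Bool; true; false)
import Data.Bool as Bool
open import Data.Fin using (Fin; zero; suc)
import Data.Fin as F
import Data.Fin.Properties as F
open import Data.List using (List; []; _∷_; map; length; filter; tabulate)
open import Data.List.Relation.Unary.All using (All; []; _∷_)
import Data.List.Relation.Unary.All as All
open import Data.Maybe using (Maybe; just; nothing)
import Data.Maybe.Properties as Maybe
open import Data.Product using (Σ; ∃; _×_; _,_; proj₁; proj₂)
open import Data.Sum using (_⊎_; inj₁; inj₂)
import Data.Sum as Sum
open import Data.Empty using (⊥; ⊥-elim)
open import Data.Unit using (⊤; tt)
open import Function using (_∘_; id)
open import Induction.WellFounded using (Acc; acc)
open import Relation.Nullary
open import Relation.Nullary.Decidable using (_×-dec_; _⊎-dec_; ¬?)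
open import Relation.Binary.Definitions using (tri<; tri≈; tri>)
open import Relation.Binary.PropositionalEquality
open ≤-Reasoning

-- Counting in Fin n

ind : ∀ {A : Set} → Dec A → ℕ
ind (yes _) = 1
ind (no _)  = 0

ind-mono : ∀ {A B : Set} (a : Dec A) (b : Dec B) → (A → B) → ind a ≤ ind b
ind-mono (yes a) (yes b) f = ≤-refl
ind-mono (yes a) (no ¬b) f = ⊥-elim (¬b (f a))
ind-mono (no _)  b       f = z≤n

ind-yes : ∀ {A : Set} (a : Dec A) → A → ind a ≡ 1
ind-yes (yes _) _ = refl
ind-yes (no ¬a) a = ⊥-elim (¬a a)

ind-no : ∀ {A : Set} (a : Dec A) → ¬ A → ind a ≡ 0
ind-no (yes a) ¬a = ⊥-elim (¬a a)
ind-no (no _) _ = refl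

sumF : ∀ {n} → (Fin n → ℕ) → ℕ
sumF {zero}  f = 0
sumF {suc n} f = f zero + sumF (f ∘ suc)

cnt : ∀ {n} {P : Fin n → Set} → (∀ x → Dec (P x)) → ℕ
cnt P? = sumF (λ x → ind (P? x))

sumF-mono : ∀ {n} {f g : Fin n → ℕ} → (∀ x → f x ≤ g x) → sumF f ≤ sumF g
sumF-mono {zero}  h = z≤n
sumF-mono {suc n} h = +-mono-≤ (h zero) (sumF-mono (h ∘ suc))

sumF-cong : ∀ {n} {f g : Fin n → ℕ} → (∀ x → f x ≡ g x) → sumF f ≡ sumF g
sumF-cong {zero}  h = refl
sumF-cong {suc n} h = cong₂ _+_ (h zero) (sumF-cong (h ∘ suc))

sumF-const : ∀ {n} c → sumF {n} (λ _ → c) ≡ n * c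
sumF-const {zero}  c = refl
sumF-const {suc n} c = cong (c +_) (sumF-const {n} c)

sumF-+ : ∀ {n} (f g : Fin n → ℕ) → sumF (λ x → f x + g x) ≡ sumF f + sumF g
sumF-+ {zero}  f g = refl
sumF-+ {suc n} f g rewrite sumF-+ (f ∘ suc) (g ∘ suc) = exch (f zero) (g zero) (sumF (f ∘ suc)) (sumF (g ∘ suc))
  where
  exch : ∀ a b c d → a + b + (c + d) ≡ a + c + (b + d)
  exch = solve-∀

sumF-*ʳ : ∀ {n} (f : Fin n → ℕ) c → sumF (λ x → f x * c) ≡ sumF f * c
sumF-*ʳ {zero}  f c = refl
sumF-*ʳ {suc n} f c = trans (cong (f zero * c +_) (sumF-*ʳ (f ∘ suc) c)) (sym (*-distribʳ-+ c (f zero) _))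

sumF-swap : ∀ {m n} (f : Fin m → Fin n → ℕ) →
  sumF (λ x → sumF (λ y → f x y)) ≡ sumF (λ y → sumF (λ x → f x y))
sumF-swap {zero}  {n} f = sym (trans (sumF-const {n} 0) (*-zeroʳ n))
sumF-swap {suc m} {n} f = trans (cong (sumF (f zero) +_) (sumF-swap (f ∘ suc)))
                                (sym (sumF-+ (f zero) (λ y → sumF (λ x → f (suc x) y))))

term≤sumF : ∀ {n} (f : Fin n → ℕ) x → f x ≤ sumF f
term≤sumF f zero    = m≤m+n _ _
term≤sumF f (suc x) = ≤-trans (term≤sumF (f ∘ suc) x) (m≤n+m _ _)

module _ {n} {P : Fin n → Set} (P? : ∀ x → Dec (P x)) where

  cnt-mono : ∀ {Q : Fin n → Set} (Q? : ∀ x → Dec (Q x)) → (∀ x → P x → Q x) → cnt P? ≤ cnt Q?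
  cnt-mono Q? h = sumF-mono (λ x → ind-mono (P? x) (Q? x) (h x))

  cnt-cong : ∀ {Q : Fin n → Set} (Q? : ∀ x → Dec (Q x)) → (∀ x → P x → Q x) → (∀ x → Q x → P x) → cnt P? ≡ cnt Q?
  cnt-cong Q? h h′ = sumF-cong (λ x → ≤-antisym (ind-mono (P? x) (Q? x) (h x)) (ind-mono (Q? x) (P? x) (h′ x)))

  cnt-witness : ∀ x → P x → 1 ≤ cnt P?
  cnt-witness x p = ≤-trans (≤-reflexive (sym (ind-yes (P? x) p))) (term≤sumF (λ y → ind (P? y)) x)

  cnt≤n : cnt P? ≤ n
  cnt≤n = ≤-trans (sumF-mono (λ x → ind≤1 (P? x))) (≤-reflexive (trans (sumF-const {n} 1) (*-identityʳ n)))
    where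
    ind≤1 : ∀ {A : Set} (a : Dec A) → ind a ≤ 1
    ind≤1 (yes _) = ≤-refl
    ind≤1 (no _)  = z≤n

cnt-zero : ∀ {n} {P : Fin n → Set} (P? : ∀ x → Dec (P x)) → (∀ x → ¬ P x) → cnt P? ≡ 0
cnt-zero {n} P? h = trans (sumF-cong (λ x → ind-no (P? x) (h x))) (trans (sumF-const {n} 0) (*-zeroʳ n))

cnt-find : ∀ {n} {P : Fin n → Set} (P? : ∀ x → Dec (P x)) → 1 ≤ cnt P? → ∃ P
cnt-find P? h with F.any? P?
... | yes w = w
... | no ¬w with () ← subst (1 ≤_) (cnt-zero P? (λ x p → ¬w (x , p))) h

_≠?_ : ∀ {n} (x y : Fin n) → Dec (x ≢ y)
x ≠? y = ¬? (x F.≟ y)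

cnt-point : ∀ {n} (x : Fin n) → cnt (λ y → y F.≟ x) ≡ 1
cnt-point {suc n} zero    = cong suc (cnt-zero {n} (λ y → suc y F.≟ zero) (λ y ()))
cnt-point {suc n} (suc x) = trans (cnt-cong (λ y → suc y F.≟ suc x) (λ y → y F.≟ x) (λ y → F.suc-injective) (λ y → cong suc)) (cnt-point x)

cnt-add : ∀ {n} {P Q : Fin n → Set} (P? : ∀ x → Dec (P x)) (Q? : ∀ x → Dec (Q x)) a →
  (∀ x → x ≢ a → P x → Q x) → cnt P? ≤ suc (cnt Q?)
cnt-add P? Q? a h = begin
  cnt P?                              ≤⟨ sumF-mono pt ⟩
  sumF (λ x → ind (x F.≟ a) + ind (Q? x)) ≡⟨ sumF-+ (λ x → ind (x F.≟ a)) (λ x → ind (Q? x)) ⟩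
  cnt (λ x → x F.≟ a) + cnt Q?          ≡⟨ cong (_+ cnt Q?) (cnt-point a) ⟩
  suc (cnt Q?)                        ∎
  where
  pt : ∀ x → ind (P? x) ≤ ind (x F.≟ a) + ind (Q? x)
  pt x with x F.≟ a
  ... | no x≢a = ind-mono (P? x) (Q? x) (h x x≢a)
  ... | yes _ with P? x
  ...   | yes _ = s≤s z≤n
  ...   | no _  = z≤n

cnt-drop : ∀ {n} {P Q : Fin n → Set} (P? : ∀ x → Dec (P x)) (Q? : ∀ x → Dec (Q x)) a →
  P a → ¬ Q a → (∀ x → Q x → P x) → suc (cnt Q?) ≤ cnt P?
cnt-drop P? Q? a pa ¬qa h = begin
  suc (cnt Q?)                        ≡⟨ cong (_+ cnt Q?) (sym (cnt-point a)) ⟩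
  cnt (λ x → x F.≟ a) + cnt Q?          ≡⟨ sym (sumF-+ (λ x → ind (x F.≟ a)) (λ x → ind (Q? x))) ⟩
  sumF (λ x → ind (x F.≟ a) + ind (Q? x)) ≤⟨ sumF-mono pt ⟩
  cnt P?                              ∎
  where
  pt : ∀ x → ind (x F.≟ a) + ind (Q? x) ≤ ind (P? x)
  pt x with x F.≟ a
  ... | no x≢a = ind-mono (Q? x) (P? x) (h x)
  ... | yes refl rewrite ind-no (Q? a) ¬qa | ind-yes (P? a) pa = ≤-refl

cnt-find≢ : ∀ {n} {P : Fin n → Set} (P? : ∀ x → Dec (P x)) a → 2 ≤ cnt P? → ∃ λ x → P x × x ≢ a
cnt-find≢ P? a h = cnt-find P≠? (≤-pred (≤-trans h (cnt-add P? P≠? a (λ x x≢a p → p , x≢a))))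
  where P≠? = λ x → P? x ×-dec (x ≠? a)

cnt-∪ : ∀ {n} {P Q R : Fin n → Set} (P? : ∀ x → Dec (P x)) (Q? : ∀ x → Dec (Q x)) (R? : ∀ x → Dec (R x)) →
  (∀ x → P x → R x) → (∀ x → Q x → R x) → (∀ x → P x → ¬ Q x) → cnt P? + cnt Q? ≤ cnt R?
cnt-∪ P? Q? R? pr qr pq = ≤-trans (≤-reflexive (sym (sumF-+ (λ x → ind (P? x)) (λ x → ind (Q? x))))) (sumF-mono pt)
  where
  pt : ∀ x → ind (P? x) + ind (Q? x) ≤ ind (R? x)
  pt x with P? x
  ... | no _ = ind-mono (Q? x) (R? x) (qr x)
  ... | yes p rewrite ind-no (Q? x) (pq x p) | ind-yes (R? x) (pr x p) = ≤-refl

cnt-∪≤ : ∀ {n} {P Q R : Fin n → Set} (P? : ∀ x → Dec (P x)) (Q? : ∀ x → Dec (Q x)) (R? : ∀ x → Dec (R x)) →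
  (∀ x → R x → P x ⊎ Q x) → cnt R? ≤ cnt P? + cnt Q?
cnt-∪≤ P? Q? R? h = ≤-trans (sumF-mono pt) (≤-reflexive (sumF-+ (λ x → ind (P? x)) (λ x → ind (Q? x))))
  where
  pt : ∀ x → ind (R? x) ≤ ind (P? x) + ind (Q? x)
  pt x with R? x
  ... | no _ = z≤n
  ... | yes r with h x r
  ...   | inj₁ p rewrite ind-yes (P? x) p = s≤s z≤n
  ...   | inj₂ q rewrite ind-yes (Q? x) q = m≤n+m 1 _

cnt-inj : ∀ {m n} {P : Fin m → Set} {Q : Fin n → Set} (P? : ∀ x → Dec (P x)) (Q? : ∀ x → Dec (Q x))
  (f : ∀ x → P x → Fin n) → (∀ x p → Q (f x p)) → (∀ x y p q → f x p ≡ f y q → x ≡ y) → cnt P? ≤ cnt Q?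
cnt-inj {zero}  P? Q? f fq inj = z≤n
cnt-inj {suc m} P? Q? f fq inj with P? zero
... | no _ = cnt-inj (P? ∘ suc) Q? (f ∘ suc) (λ x → fq (suc x)) (λ x y p q e → F.suc-injective (inj (suc x) (suc y) p q e))
... | yes p₀ = ≤-trans
  (s≤s (cnt-inj (P? ∘ suc) Q≠? (f ∘ suc)
    (λ x p → fq (suc x) p , λ e → case-0 (inj (suc x) zero p p₀ e))
    (λ x y p q e → F.suc-injective (inj (suc x) (suc y) p q e))))
  (cnt-drop Q? Q≠? a (fq zero p₀) (λ q → proj₂ q refl) (λ x → proj₁))
  where
  a = f zero p₀
  Q≠? = λ x → Q? x ×-dec (x ≠? a)
  case-0 : ∀ {x : Fin m} → suc x ≡ zero → ⊥
  case-0 ()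

cnt-full : ∀ {n} {P : Fin n → Set} (P? : ∀ x → Dec (P x)) → n ≤ cnt P? → ∀ x → P x
cnt-full {n} P? h x with P? x
... | yes p = p
... | no ¬p = ⊥-elim (<-irrefl refl (≤-trans (≤-trans (s≤s h) (cnt-drop (λ y → true? y) P? x _ ¬p (λ _ _ → _))) (cnt≤n (λ y → true? y))))
  where
  true? : Fin n → Dec ⊤
  true? _ = yes tt

cnt-∃ : ∀ {m n} {A : Fin n → Fin m → Set} (A? : ∀ y x → Dec (A y x)) (E? : ∀ x → Dec (∃ λ y → A y x)) →
  cnt E? ≤ sumF (λ y → cnt (A? y))
cnt-∃ A? E? = ≤-trans (sumF-mono pt) (≤-reflexive (sumF-swap (λ x y → ind (A? y x))))
  where
  pt : ∀ x → ind (E? x) ≤ sumF (λ y → ind (A? y x))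
  pt x with E? x
  ... | no _ = z≤n
  ... | yes (y , a) = cnt-witness (λ y → A? y x) y a

-- Colourings and the upper bound

_≟M_ : ∀ {k} (a b : Maybe (Fin k)) → Dec (a ≡ b)
_≟M_ = Maybe.≡-dec F._≟_

seen? : ∀ {n k} (c : Colouring n k) u α → Dec (Seen c u α)
seen? c u α = F.any? (λ w → c u w ≟M just α)

adj? : ∀ {n} (G : SimpleGraph n) x y → Dec (Adj G x y ≡ true)
adj? G x y = Adj G x y Bool.≟ true

length-filter-tabulate : ∀ {n m} (P : Fin m → Bool) (f : Fin n → Fin m) →
  length (filter (λ v → P v Bool.≟ true) (tabulate f)) ≡ cnt (λ v → P (f v) Bool.≟ true)
length-filter-tabulate {zero}  P f = refl
length-filter-tabulate {suc n} P f with P (f zero) Bool.≟ true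
... | yes _ = cong suc (length-filter-tabulate P (f ∘ suc))
... | no _  = length-filter-tabulate P (f ∘ suc)

degree-cnt : ∀ {n} (G : SimpleGraph n) u → degree G u ≡ cnt (adj? G u)
degree-cnt G u = length-filter-tabulate (Adj G u) id

SamePair : ∀ {n} → Fin n → Fin n → Fin n → Fin n → Set
SamePair x y z w = (z ≡ x × w ≡ y) ⊎ (z ≡ y × w ≡ x)

module _ {n k : ℕ} (c : Colouring n k) (x y : Fin n) (α : Fin k) where

  private c′ = set c x y α

  set-cases : ∀ z w → (SamePair x y z w × c′ z w ≡ just α) ⊎ (¬ SamePair x y z w × c′ z w ≡ c z w)
  set-cases z w with z F.≟ x | w F.≟ y | z F.≟ y | w F.≟ x
  ... | yes p | yes q | _     | _     = inj₁ (inj₁ (p , q) , refl)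
  ... | yes p | no ¬q | yes r | yes s = inj₁ (inj₂ (r , s) , refl)
  ... | yes p | no ¬q | yes r | no ¬s = inj₂ ((λ { (inj₁ (_ , q)) → ¬q q ; (inj₂ (_ , s)) → ¬s s }) , refl)
  ... | yes p | no ¬q | no ¬r | _     = inj₂ ((λ { (inj₁ (_ , q)) → ¬q q ; (inj₂ (r , _)) → ¬r r }) , refl)
  ... | no ¬p | _     | yes r | yes s = inj₁ (inj₂ (r , s) , refl)
  ... | no ¬p | _     | yes r | no ¬s = inj₂ ((λ { (inj₁ (p , _)) → ¬p p ; (inj₂ (_ , s)) → ¬s s }) , refl)
  ... | no ¬p | _     | no ¬r | _     = inj₂ ((λ { (inj₁ (p , _)) → ¬p p ; (inj₂ (r , _)) → ¬r r }) , refl)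

  set-hit : ∀ {z w} → SamePair x y z w → c′ z w ≡ just α
  set-hit {z} {w} p with set-cases z w
  ... | inj₁ (_ , e) = e
  ... | inj₂ (¬p , _) = ⊥-elim (¬p p)

  set-miss : ∀ {z w} → ¬ SamePair x y z w → c′ z w ≡ c z w
  set-miss {z} {w} ¬p with set-cases z w
  ... | inj₁ (p , _) = ⊥-elim (¬p p)
  ... | inj₂ (_ , e) = e

  set-row : ∀ {z} w → z ≢ x → z ≢ y → c′ z w ≡ c z w
  set-row w z≢x z≢y = set-miss (λ { (inj₁ (p , _)) → z≢x p ; (inj₂ (p , _)) → z≢y p })

  set-nothing : ∀ {z w} → c′ z w ≡ nothing → c z w ≡ nothing
  set-nothing {z} {w} e with set-cases z w
  ... | inj₁ (_ , e′) with () ← trans (sym e) e′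
  ... | inj₂ (_ , e′) = trans (sym e′) e

  seen-old : ∀ {z β} → Seen c′ z β → Seen c z β ⊎ (β ≡ α × (z ≡ x ⊎ z ≡ y))
  seen-old {z} {β} (w , e) with set-cases z w
  ... | inj₂ (_ , e′) = inj₁ (w , trans (sym e′) e)
  ... | inj₁ (p , e′) = inj₂ (Maybe.just-injective (trans (sym e) e′) , ends p)
    where
    ends : SamePair x y z w → z ≡ x ⊎ z ≡ y
    ends (inj₁ (p , _)) = inj₁ p
    ends (inj₂ (p , _)) = inj₂ p

  seen-ends : Seen c′ x α × Seen c′ y α
  seen-ends = (y , set-hit (inj₁ (refl , refl))) , (x , set-hit (inj₂ (refl , refl)))

-- A `Colouring` is a bare function; these are the invariants of the positions that legal moves can
-- reach.
record WF {n k} (G : SimpleGraph n) (c : Colouring n k) : Set where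
  field
    csym   : ∀ x y → c x y ≡ c y x
    proper : ∀ {x y z α} → c x y ≡ just α → c x z ≡ just α → y ≡ z
    onEdge : ∀ {x y α} → c x y ≡ just α → Adj G x y ≡ true

open WF public

WF-empty : ∀ {n k} (G : SimpleGraph n) → WF {n} {k} G empty
WF-empty G = record { csym = λ _ _ → refl ; proper = λ () ; onEdge = λ () }

SamePair-swap : ∀ {n} {x y z w : Fin n} → SamePair x y z w → SamePair x y w z
SamePair-swap (inj₁ (p , q)) = inj₂ (q , p)
SamePair-swap (inj₂ (p , q)) = inj₁ (q , p)

module _ {n k : ℕ} {G : SimpleGraph n} {c : Colouring n k} (wf : WF G c) {x y : Fin n} {α : Fin k}
         (leg : Legal G c x y α) where

  private
    c′ = set c x y α
    adj-xy = proj₁ leg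
    uncol = proj₁ (proj₂ leg)
    unseen : ∀ {z w} → SamePair x y z w → ¬ Seen c z α
    unseen (inj₁ (refl , _)) = proj₁ (proj₂ (proj₂ leg))
    unseen (inj₂ (refl , _)) = proj₂ (proj₂ (proj₂ leg))
    pair-uncol : ∀ {z w} → SamePair x y z w → c z w ≡ nothing
    pair-uncol (inj₁ (refl , refl)) = uncol
    pair-uncol (inj₂ (refl , refl)) = trans (csym wf y x) uncol
    pair-adj : ∀ {z w} → SamePair x y z w → Adj G z w ≡ true
    pair-adj (inj₁ (refl , refl)) = adj-xy
    pair-adj (inj₂ (refl , refl)) = trans (Adj-sym G y x) adj-xy
    pair-fun : ∀ {z w w′} → SamePair x y z w → SamePair x y z w′ → w ≡ w′
    pair-fun (inj₁ (refl , refl)) (inj₁ (_ , refl)) = refl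
    pair-fun (inj₁ (refl , refl)) (inj₂ (refl , refl)) = refl
    pair-fun (inj₂ (refl , refl)) (inj₁ (refl , refl)) = refl
    pair-fun (inj₂ (refl , refl)) (inj₂ (_ , refl)) = refl

  set-keeps : ∀ {z w β} → c z w ≡ just β → c′ z w ≡ just β
  set-keeps {z} {w} e with set-cases c x y α z w
  ... | inj₂ (_ , e′) = trans e′ e
  ... | inj₁ (p , _) with () ← trans (sym e) (pair-uncol p)

  seen-keeps : ∀ {z β} → Seen c z β → Seen c′ z β
  seen-keeps (w , e) = w , set-keeps e

  WF-set : WF G c′
  WF-set = record { csym = cs ; proper = λ {z} {v} {w} → pr z v w ; onEdge = λ {z} {w} → oe z w }
    where
    cs : ∀ z w → c′ z w ≡ c′ w z
    cs z w with set-cases c x y α z w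
    ... | inj₁ (p , e) = trans e (sym (set-hit c x y α (SamePair-swap p)))
    ... | inj₂ (¬p , e) = trans e (trans (csym wf z w) (sym (set-miss c x y α (¬p ∘ SamePair-swap))))
    pr : ∀ z v w {β} → c′ z v ≡ just β → c′ z w ≡ just β → v ≡ w
    pr z v w ev ew with set-cases c x y α z v | set-cases c x y α z w
    ... | inj₁ (p , _) | inj₁ (q , _) = pair-fun p q
    ... | inj₂ (_ , e) | inj₂ (_ , f) = proper wf (trans (sym e) ev) (trans (sym f) ew)
    ... | inj₁ (p , e) | inj₂ (_ , f) = ⊥-elim (unseen p (w , trans (sym f) (trans ew (trans (sym ev) e))))
    ... | inj₂ (_ , e) | inj₁ (q , f) = ⊥-elim (unseen q (v , trans (sym e) (trans ev (trans (sym ew) f))))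
    oe : ∀ z w {β} → c′ z w ≡ just β → Adj G z w ≡ true
    oe z w e with set-cases c x y α z w
    ... | inj₁ (p , _) = pair-adj p
    ... | inj₂ (_ , f) = onEdge wf (trans (sym f) e)

  -- A legal move cannot colour the blocked edge, since every colour is seen at one of its ends, and
  -- seen colours stay seen.
  Blocked-set : Blocked G c → Blocked G c′
  Blocked-set (u , v , a , e , all) = u , v , a , still , λ β → Sum.map seen-keeps seen-keeps (all β)
    where
    notPair : ¬ SamePair x y u v
    notPair (inj₁ (refl , refl)) with all α
    ... | inj₁ s = proj₁ (proj₂ (proj₂ leg)) s
    ... | inj₂ s = proj₂ (proj₂ (proj₂ leg)) s
    notPair (inj₂ (refl , refl)) with all α
    ... | inj₁ s = proj₂ (proj₂ (proj₂ leg)) s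
    ... | inj₂ s = proj₁ (proj₂ (proj₂ leg)) s
    still : c′ u v ≡ nothing
    still = trans (set-miss c x y α notPair) e

-- Breaker passes from now on (`m = 0`), and the induction follows Maker's strategy.
Blocked-loses : ∀ {n k b} {G : SimpleGraph n} {c : Colouring n k} → WF G c → Blocked G c → ¬ MakerWins G b c
Blocked-loses wf (u , v , a , e , _) (finished all) = all u v a e
Blocked-loses wf bl (play x y α leg k) =
  Blocked-loses (WF-set wf leg) (Blocked-set wf leg bl) (k 0 _ z≤n none)

freeColour : ∀ {n k} {G : SimpleGraph n} (c : Colouring n k) {x y} → Adj G x y ≡ true → c x y ≡ nothing →
  Blocked G c ⊎ ∃ λ α → Legal G c x y α
freeColour c {x} {y} a e with F.any? (λ α → ¬? (seen? c x α) ×-dec ¬? (seen? c y α))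
... | yes (α , p , q) = inj₂ (α , a , e , p , q)
... | no ¬f = inj₁ (x , y , a , e , blk)
  where
  blk : ∀ α → Seen c x α ⊎ Seen c y α
  blk α with seen? c x α | seen? c y α
  ... | yes s | _     = inj₁ s
  ... | no _  | yes s = inj₂ s
  ... | no p  | no q  = ⊥-elim (¬f (α , p , q))

WF-Steps : ∀ {n k m} {G : SimpleGraph n} {c c′ : Colouring n k} → WF G c → Steps G c m c′ → WF G c′
WF-Steps wf none = wf
WF-Steps wf (step u v α leg st) = WF-Steps (WF-set wf leg) st

uncol? : ∀ {n k} (c : Colouring n k) x y → Dec (c x y ≡ nothing)
uncol? c x y = c x y ≟M nothing

nUncol : ∀ {n k} → Colouring n k → ℕ
nUncol c = sumF (λ x → cnt (uncol? c x))

sumF-strict : ∀ {n} {f g : Fin n → ℕ} → (∀ x → f x ≤ g x) → ∀ a → f a < g a → sumF f < sumF g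
sumF-strict h zero lt    = +-mono-<-≤ lt (sumF-mono (h ∘ suc))
sumF-strict h (suc a) lt = +-mono-≤-< (h zero) (sumF-strict (h ∘ suc) a lt)

nUncol-set : ∀ {n k} {G : SimpleGraph n} (c : Colouring n k) {x y α} → Legal G c x y α → nUncol (set c x y α) < nUncol c
nUncol-set c {x} {y} {α} (_ , e , _) =
  sumF-strict (λ z → cnt-mono (uncol? c′ z) (uncol? c z) (λ w → set-nothing c x y α)) x
    (cnt-drop (uncol? c x) (uncol? c′ x) y e (λ e′ → abs e′) (λ w → set-nothing c x y α))
  where
  c′ = set c x y α
  abs : c′ x y ≢ nothing
  abs e′ with () ← trans (sym e′) (set-hit c x y α (inj₁ (refl , refl)))

nUncol-Steps : ∀ {n k m} {G : SimpleGraph n} {c c′ : Colouring n k} → Steps G c m c′ → nUncol c′ ≤ nUncol c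
nUncol-Steps none = ≤-refl
nUncol-Steps {G = G} {c} (step u v α leg st) = ≤-trans (nUncol-Steps st) (<⇒≤ (nUncol-set {G = G} c leg))

-- An uncoloured edge meets at most 2Δ ∸ 2 coloured ones, so it can always be coloured.
module _ {n Δ : ℕ} (G : SimpleGraph n) (reg : Regular G Δ) (1≤Δ : 1 ≤ Δ) where

  deg : ∀ u → cnt (adj? G u) ≡ Δ
  deg u = trans (sym (degree-cnt G u)) (reg u)

  seen-bound : ∀ {k} {c : Colouring n k} → WF G c → ∀ {u v} → Adj G u v ≡ true → c u v ≡ nothing → suc (cnt (seen? c u)) ≤ Δ
  seen-bound {c = c} wf {u} {v} a e = begin
    suc (cnt (seen? c u)) ≤⟨ s≤s (cnt-inj (seen? c u) colNbr? (λ α s → proj₁ s)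
                               (λ α s → onEdge wf (proj₂ s) , λ e → j≢n (trans (sym (proj₂ s)) e))
                               (λ α β s t eq → Maybe.just-injective (trans (sym (proj₂ s)) (trans (cong (c u) eq) (proj₂ t))))) ⟩
    suc (cnt colNbr?)     ≤⟨ cnt-drop (adj? G u) colNbr? v a (λ p → proj₂ p e) (λ _ → proj₁) ⟩
    cnt (adj? G u)        ≡⟨ deg u ⟩
    Δ                     ∎
    where
    colNbr? = λ w → adj? G u w ×-dec ¬? (uncol? c u w)
    j≢n : ∀ {α} → just α ≢ nothing
    j≢n ()

  not-blocked : ∀ {c : Colouring n (2 * Δ ∸ 1)} → WF G c → ¬ Blocked G c
  not-blocked {c} wf (u , v , a , e , all) = <-irrefl refl (begin-strict
    2 * Δ ∸ 1                          ≡⟨ sym (trans (sumF-const {2 * Δ ∸ 1} 1) (*-identityʳ _)) ⟩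
    sumF {2 * Δ ∸ 1} (λ _ → 1)         ≤⟨ sumF-mono pt ⟩
    sumF (λ α → ind (seen? c u α) + ind (seen? c v α)) ≡⟨ sumF-+ (λ α → ind (seen? c u α)) (λ α → ind (seen? c v α)) ⟩
    cnt (seen? c u) + cnt (seen? c v)  ≡⟨⟩
    suc (cnt (seen? c u)) + cnt (seen? c v) ∸ 1 <⟨ ∸-monoˡ-< (≤-reflexive (sym (+-suc (suc (cnt (seen? c u))) _))) (s≤s z≤n) ⟩
    suc (cnt (seen? c u)) + suc (cnt (seen? c v)) ∸ 1 ≤⟨ ∸-monoˡ-≤ 1 (+-mono-≤ (seen-bound wf a e)
                                                (seen-bound wf (trans (Adj-sym G v u) a) (trans (csym wf v u) e))) ⟩
    Δ + Δ ∸ 1                          ≡⟨ cong (λ m → Δ + m ∸ 1) (sym (+-identityʳ Δ)) ⟩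
    2 * Δ ∸ 1                          ∎)
    where
    pt : ∀ α → 1 ≤ ind (seen? c u α) + ind (seen? c v α)
    pt α with all α
    ... | inj₁ s rewrite ind-yes (seen? c u α) s = s≤s z≤n
    ... | inj₂ s rewrite ind-yes (seen? c v α) s = m≤n+m 1 _

  maker-wins : ∀ b (c : Colouring n (2 * Δ ∸ 1)) → WF G c → Acc _<_ (nUncol c) → MakerWins G b c
  maker-wins b c wf (acc rs)
    with F.any? (λ u → F.any? (λ v → adj? G u v ×-dec uncol? c u v))
  ... | no none-left = finished (λ u v a e → none-left (u , v , a , e))
  ... | yes (u , v , a , e) with freeColour {G = G} c a e
  ...   | inj₁ bl = ⊥-elim (not-blocked wf bl)
  ...   | inj₂ (α , leg) = play u v α leg λ m c′ _ st →
          maker-wins b c′ (WF-Steps (WF-set wf leg) st)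
            (rs (≤-<-trans (nUncol-Steps st) (nUncol-set {G = G} c leg)))

  maker-upper : ∀ b → MakerWinsGame G b (2 * Δ ∸ 1)
  maker-upper b = maker-wins b empty (WF-empty G) (<-wellFounded _)

-- Gadgets

module Gadgets {n : ℕ} (G : SimpleGraph n) where

  -- The closed neighbourhood of `P`.
  Nb : (Fin n → Set) → Fin n → Set
  Nb P x = ∃ λ y → P y × (x ≡ y ⊎ Adj G x y ≡ true)

  nb? : ∀ {P : Fin n → Set} → (∀ x → Dec (P x)) → ∀ x → Dec (Nb P x)
  nb? P? x = F.any? (λ y → P? y ×-dec ((x F.≟ y) ⊎-dec adj? G x y))

  record Gadget : Set where
    field
      centre   : Fin n
      cand     : Fin n → Bool
      cand-adj : ∀ v → cand v ≡ true → Adj G centre v ≡ true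
  open Gadget public

  Core : Gadget → Fin n → Set
  Core γ x = x ≡ centre γ ⊎ cand γ x ≡ true

  core? : ∀ γ x → Dec (Core γ x)
  core? γ x = (x F.≟ centre γ) ⊎-dec (cand γ x Bool.≟ true)

  -- Only edges with an end in this set matter for the state of γ.
  Near : Gadget → Fin n → Set
  Near γ = Nb (Core γ)

  near? : ∀ γ x → Dec (Near γ x)
  near? γ = nb? (core? γ)

  adj⇒≢ : ∀ {x y} → Adj G x y ≡ true → x ≢ y
  adj⇒≢ {x} a refl with () ← trans (sym a) (irrefl G x)

  flip-adj : ∀ {x y} → Adj G x y ≡ true → Adj G y x ≡ true
  flip-adj {x} {y} a = trans (Adj-sym G y x) a

  core-near : ∀ {γ x} → Core γ x → Near γ x
  core-near p = _ , p , inj₁ refl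

  nbr-near : ∀ {γ x y} → Core γ x → Adj G x y ≡ true → Near γ y
  nbr-near p a = _ , p , inj₂ (flip-adj a)

  -- Edges between two wide regions come near neither gadget; narrow regions are smaller.
  Reg : Bool → Gadget → Fin n → Set
  Reg true  γ = Nb (Near γ)
  Reg false γ = Near γ

  reg? : ∀ wd γ x → Dec (Reg wd γ x)
  reg? true  γ = nb? (near? γ)
  reg? false γ = near? γ

  near-reg : ∀ wd {γ x} → Near γ x → Reg wd γ x
  near-reg true  nx = _ , nx , inj₁ refl
  near-reg false nx = nx

  module Play (k : ℕ) where

    private Col = Colouring n k

    Open : Col → Gadget → Fin n → Set
    Open c γ w = Adj G (centre γ) w ≡ true × c (centre γ) w ≡ nothing

    open? : ∀ c γ w → Dec (Open c γ w)
    open? c γ w = adj? G (centre γ) w ×-dec uncol? c (centre γ) w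

    -- A candidate that can still become the other end of the final edge.
    Clean : Col → Gadget → Fin n → Set
    Clean c γ v = cand γ v ≡ true × c (centre γ) v ≡ nothing × (∀ w → c v w ≡ nothing)

    clean? : ∀ c γ v → Dec (Clean c γ v)
    clean? c γ v = (cand γ v Bool.≟ true) ×-dec (uncol? c (centre γ) v ×-dec F.all? (uncol? c v))

    -- Breaker wants these colours at the centre: they could be in the way in the second phase.
    Dirty : Col → Gadget → Fin k → Set
    Dirty c γ α = ¬ Seen c (centre γ) α × ∃ λ x → Near γ x × Seen c x α

    dirty? : ∀ c γ α → Dec (Dirty c γ α)
    dirty? c γ α = ¬? (seen? c (centre γ) α) ×-dec F.any? (λ x → near? γ x ×-dec seen? c x α)

    -- First phase: at most l edges at the centre are uncoloured, and there are m more clean candidates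
    -- than dirty colours.
    record Ok1 (c : Col) (γ : Gadget) (l m : ℕ) : Set where
      field
        open≤ : cnt (open? c γ) ≤ l
        slack : m + cnt (dirty? c γ) ≤ cnt (clean? c γ)
    open Ok1 public

    Side : Col → Fin n → Fin n → Fin n → Set
    Side c u v w = Adj G v w ≡ true × c v w ≡ nothing × w ≢ u

    side? : ∀ c u v w → Dec (Side c u v w)
    side? c u v w = adj? G v w ×-dec (uncol? c v w ×-dec (w ≠? u))

    -- The edge vw cannot get the colour α, which is missing at both ends of uv.
    DirtyPair : Col → Fin n → Fin n → Fin n → Fin k → Set
    DirtyPair c u v w α = Side c u v w × ¬ Seen c u α × ¬ Seen c v α × Seen c w α

    dirtyPair? : ∀ c u v w α → Dec (DirtyPair c u v w α)
    dirtyPair? c u v w α = side? c u v w ×-dec (¬? (seen? c u α) ×-dec (¬? (seen? c v α) ×-dec seen? c w α))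

    -- A gadget of health 2 has no dirty pair, and one of health 1 at most one.
    DirtOk : ℕ → Col → Fin n → Fin n → Set
    DirtOk 1 c u v = ∀ {w α w′ α′} → DirtyPair c u v w α → DirtyPair c u v w′ α′ → w ≡ w′ × α ≡ α′
    DirtOk 2 c u v = ∀ {w α} → ¬ DirtyPair c u v w α
    DirtOk _ c u v = ⊥

    -- Second phase: the centre u is finished except for uv, and s edges at v other than uv are uncoloured.
    record Ok2 (c : Col) (γ : Gadget) (s h : ℕ) : Set where
      private u = centre γ
      field
        v      : Fin n
        v-cand : cand γ v ≡ true
        uv     : c u v ≡ nothing
        full   : ∀ w → Adj G u w ≡ true → w ≢ v → c u w ≢ nothing
        disj   : ∀ α → Seen c u α → ¬ Seen c v α
        sides  : cnt (side? c u v) ≡ s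
        dirt   : DirtOk h c u v

    clean⇒open : ∀ {c γ v} → Clean c γ v → Open c γ v
    clean⇒open {γ = γ} (cv , e , _) = cand-adj γ _ cv , e

    clean-unseen : ∀ {c γ v α} → Clean c γ v → ¬ Seen c v α
    clean-unseen (_ , _ , row) (w , e) with () ← trans (sym e) (row w)

    open1 : ∀ {c γ l m} → Ok1 c γ l (suc m) → ∃ (Open c γ)
    open1 {c} {γ} o with cnt-find (clean? c γ) (≤-trans (s≤s z≤n) (slack o))
    ... | v , cl = v , clean⇒open {c} {γ} cl

    Ok1-weaken : ∀ {c γ l m m′} → m′ ≤ m → Ok1 c γ l m → Ok1 c γ l m′
    Ok1-weaken {c} {γ} h o = record { open≤ = open≤ o ; slack = ≤-trans (+-monoˡ-≤ (cnt (dirty? c γ)) h) (slack o) }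

    -- The effect of a coloured edge on a gadget.

    module _ {c : Col} (wf : WF G c) {x y : Fin n} {α : Fin k} (leg : Legal G c x y α) (γ : Gadget) where

      private
        c′ = set c x y α
        u = centre γ
        adj-xy = proj₁ leg

      open-set : cnt (open? c′ γ) ≤ cnt (open? c γ)
      open-set = cnt-mono (open? c′ γ) (open? c γ) (λ w p → proj₁ p , set-nothing c x y α (proj₂ p))

      dirty-set : ∀ β → β ≢ α → Dirty c′ γ β → Dirty c γ β
      dirty-set β β≢α (ns , z , nz , s) with seen-old c x y α s
      ... | inj₁ s′ = (λ t → ns (seen-keeps wf leg t)) , z , nz , s′
      ... | inj₂ (β≡α , _) = ⊥-elim (β≢α β≡α)

      clean-set : ∀ v → v ≢ x → v ≢ y → Clean c γ v → Clean c′ γ v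
      clean-set v v≢x v≢y (cv , e , row) =
        cv , trans (set-miss c x y α notPair) e , λ w → trans (set-row c x y α w v≢x v≢y) (row w)
        where
        notPair : ¬ SamePair x y u v
        notPair (inj₁ (_ , q)) = v≢y q
        notPair (inj₂ (_ , q)) = v≢x q

      -- In the worst case both ends were clean candidates and `α` becomes a dirty colour, which
      -- takes three units of slack.
      Ok1-both : ∀ {l m} → Ok1 c γ l (3 + m) → Ok1 c′ γ l m
      Ok1-both {l} {m} o = record
        { open≤ = ≤-trans open-set (open≤ o)
        ; slack = ≤-pred (≤-pred (begin
            2 + (m + cnt (dirty? c′ γ)) ≤⟨ s≤s (s≤s (+-monoʳ-≤ m (cnt-add (dirty? c′ γ) (dirty? c γ) α dirty-set))) ⟩
            2 + (m + suc (cnt (dirty? c γ))) ≡⟨ cong (2 +_) (+-suc m _) ⟩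
            3 + m + cnt (dirty? c γ) ≤⟨ slack o ⟩
            cnt (clean? c γ) ≤⟨ cnt-add (clean? c γ) mid? x (λ v v≢x cl → cl , v≢x) ⟩
            suc (cnt mid?) ≤⟨ s≤s (cnt-add mid? (clean? c′ γ) y (λ v v≢y p → clean-set v (proj₂ p) v≢y (proj₁ p))) ⟩
            2 + cnt (clean? c′ γ) ∎)) }
        where
        mid? = λ v → clean? c γ v ×-dec (v ≠? x)

      module NotBoth (nb : ¬ (Near γ x × Near γ y)) where

        -- An edge at a core vertex has both ends near γ. Hence an edge with at most one near end
        -- leaves the rows of the core as they are, and its only harm is dirt.
        core∌ : ∀ {z} → Core γ z → z ≢ x × z ≢ y
        core∌ cz = (λ { refl → nb (core-near {γ} cz , nbr-near {γ} cz adj-xy) })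
                 , (λ { refl → nb (nbr-near {γ} cz (flip-adj adj-xy) , core-near {γ} cz) })

        core-row : ∀ {z} → Core γ z → ∀ w → c′ z w ≡ c z w
        core-row cz w = set-row c x y α w (proj₁ (core∌ cz)) (proj₂ (core∌ cz))

        core-seen : ∀ {z β} → Core γ z → Seen c′ z β → Seen c z β
        core-seen cz (w , e) = w , trans (sym (core-row cz w)) e

        clean-kept : cnt (clean? c γ) ≤ cnt (clean? c′ γ)
        clean-kept = cnt-mono (clean? c γ) (clean? c′ γ) (λ v cl →
          clean-set v (proj₁ (core∌ (inj₂ (proj₁ cl)))) (proj₂ (core∌ (inj₂ (proj₁ cl)))) cl)

        Ok1-one : ∀ {l m} → Ok1 c γ l (suc m) → Ok1 c′ γ l m
        Ok1-one {l} {m} o = record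
          { open≤ = ≤-trans open-set (open≤ o)
          ; slack = begin
              m + cnt (dirty? c′ γ)      ≤⟨ +-monoʳ-≤ m (cnt-add (dirty? c′ γ) (dirty? c γ) α dirty-set) ⟩
              m + suc (cnt (dirty? c γ)) ≡⟨ +-suc m _ ⟩
              suc m + cnt (dirty? c γ)   ≤⟨ slack o ⟩
              cnt (clean? c γ)           ≤⟨ clean-kept ⟩
              cnt (clean? c′ γ)          ∎ }

        side-back : ∀ {v w} → Core γ v → Side c′ u v w → Side c u v w
        side-back cv (a , e , ne) = a , trans (sym (core-row cv _)) e , ne

        side-forth : ∀ {v w} → Core γ v → Side c u v w → Side c′ u v w
        side-forth cv (a , e , ne) = a , trans (core-row cv _) e , ne

        pair-back : ∀ {v w β} → Core γ v → DirtyPair c′ u v w β →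
          DirtyPair c u v w β ⊎ (β ≡ α × (w ≡ x ⊎ w ≡ y))
        pair-back cv (sd , nu , nv , s) with seen-old c x y α s
        ... | inj₂ e = inj₂ e
        ... | inj₁ s′ = inj₁ (side-back cv sd , (λ t → nu (seen-keeps wf leg t)) , (λ t → nv (seen-keeps wf leg t)) , s′)

        Ok2-move : ∀ {s h h′} (o : Ok2 c γ s h) → DirtOk h′ c′ u (Ok2.v o) → Ok2 c′ γ s h′
        Ok2-move o d = record
          { v = v ; v-cand = v-cand
          ; uv = trans (core-row (inj₁ refl) v) uv
          ; full = λ w a ne e → full w a ne (set-nothing c x y α e)
          ; disj = λ β s t → disj β (core-seen (inj₁ refl) s) (core-seen (inj₂ v-cand) t)
          ; sides = trans (cnt-cong (side? c′ u v) (side? c u v)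
                      (λ w → side-back (inj₂ v-cand)) (λ w → side-forth (inj₂ v-cand))) sides
          ; dirt = d }
          where open Ok2 o

        -- A new dirty pair has the colour `α`, and its vertex is an end of `xy`. As a neighbour of
        -- `v` this vertex is near γ, and only one end of `xy` is, so all new pairs coincide.
        Ok2-one : ∀ {s} → Ok2 c γ s 2 → Ok2 c′ γ s 1
        Ok2-one {s} o = Ok2-move o dd
          where
          open Ok2 o
          near-w : ∀ {w β} → DirtyPair c′ u v w β → Near γ w
          near-w ((a , _) , _) = nbr-near {γ} (inj₂ v-cand) a
          same : ∀ {w w′} → Near γ w → Near γ w′ → w ≡ x ⊎ w ≡ y → w′ ≡ x ⊎ w′ ≡ y → w ≡ w′
          same p q (inj₁ refl) (inj₁ refl) = refl
          same p q (inj₁ refl) (inj₂ refl) = ⊥-elim (nb (p , q))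
          same p q (inj₂ refl) (inj₁ refl) = ⊥-elim (nb (q , p))
          same p q (inj₂ refl) (inj₂ refl) = refl
          dd : DirtOk 1 c′ u v
          dd p q with pair-back (inj₂ v-cand) p | pair-back (inj₂ v-cand) q
          ... | inj₁ p′ | _ = ⊥-elim (dirt p′)
          ... | inj₂ _ | inj₁ q′ = ⊥-elim (dirt q′)
          ... | inj₂ (e , i) | inj₂ (f , j) = same (near-w p) (near-w q) i j , trans e (sym f)

      module Neither (nx : ¬ Near γ x) (ny : ¬ Near γ y) where

        open NotBoth (λ p → nx (proj₁ p)) public

        near-seen : ∀ {z β} → Near γ z → Seen c′ z β → Seen c z β
        near-seen nz s with seen-old c x y α s
        ... | inj₁ s′ = s′
        ... | inj₂ (_ , inj₁ refl) = ⊥-elim (nx nz)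
        ... | inj₂ (_ , inj₂ refl) = ⊥-elim (ny nz)

        Ok1-none : ∀ {l m} → Ok1 c γ l m → Ok1 c′ γ l m
        Ok1-none {l} {m} o = record
          { open≤ = ≤-trans open-set (open≤ o)
          ; slack = begin
              m + cnt (dirty? c′ γ) ≤⟨ +-monoʳ-≤ m (cnt-mono (dirty? c′ γ) (dirty? c γ)
                 (λ β (ns , z , nz , s) → (λ t → ns (seen-keeps wf leg t)) , z , nz , near-seen nz s)) ⟩
              m + cnt (dirty? c γ)  ≤⟨ slack o ⟩
              cnt (clean? c γ)      ≤⟨ clean-kept ⟩
              cnt (clean? c′ γ)     ∎ }

        pair-back′ : ∀ {v w β} → Core γ v → DirtyPair c′ u v w β → DirtyPair c u v w β
        pair-back′ cv p with pair-back cv p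
        ... | inj₁ p′ = p′
        ... | inj₂ (_ , inj₁ refl) = ⊥-elim (nx (nbr-near {γ} cv (proj₁ (proj₁ p))))
        ... | inj₂ (_ , inj₂ refl) = ⊥-elim (ny (nbr-near {γ} cv (proj₁ (proj₁ p))))

        dirt-none : ∀ h {v} → Core γ v → DirtOk h c u v → DirtOk h c′ u v
        dirt-none 0 cv ()
        dirt-none 1 cv d p q = d (pair-back′ cv p) (pair-back′ cv q)
        dirt-none 2 cv d p = d (pair-back′ cv p)
        dirt-none (suc (suc (suc _))) cv ()

        Ok2-none : ∀ {s h} → Ok2 c γ s h → Ok2 c′ γ s h
        Ok2-none {h = h} o = Ok2-move o (dirt-none h (inj₂ (Ok2.v-cand o)) (Ok2.dirt o))

    -- Breaker's steps in the first phase.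

    module CentreMove {c : Col} (wf : WF G c) (γ : Gadget) {w : Fin n} {α : Fin k} (leg : Legal G c (centre γ) w α) where

      private
        u = centre γ
        c′ = set c u w α
        adj-uw = proj₁ leg

      open-drop : suc (cnt (open? c′ γ)) ≤ cnt (open? c γ)
      open-drop = cnt-drop (open? c γ) (open? c′ γ) w (adj-uw , proj₁ (proj₂ leg))
        (λ p → coloured (proj₂ p)) (λ z p → proj₁ p , set-nothing c u w α (proj₂ p))
        where
        coloured : c′ u w ≢ nothing
        coloured e with () ← trans (sym e) (set-hit c u w α (inj₁ (refl , refl)))

      dirty-back : ∀ β → Dirty c′ γ β → Dirty c γ β
      dirty-back β d with β F.≟ α
      ... | no β≢α = dirty-set wf leg γ β β≢α d
      ... | yes refl = ⊥-elim (proj₁ d (proj₁ (seen-ends c u w α)))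

      dirty≤ : cnt (dirty? c′ γ) ≤ cnt (dirty? c γ)
      dirty≤ = cnt-mono (dirty? c′ γ) (dirty? c γ) dirty-back

      clean-stays : ∀ v → v ≢ w → Clean c γ v → Clean c′ γ v
      clean-stays v v≢w cl = clean-set wf leg γ v (λ e → adj⇒≢ (cand-adj γ v (proj₁ cl)) (sym e)) v≢w cl

      clean-loss : cnt (clean? c γ) ≤ suc (cnt (clean? c′ γ))
      clean-loss = cnt-add (clean? c γ) (clean? c′ γ) w clean-stays

    -- If at most `l` edges are open already, Breaker has nothing to do. Otherwise a dirty colour,
    -- if there is one, goes to the edge to a clean candidate: one clean candidate and one dirty
    -- colour disappear, and the slack is kept. Without dirty colours, an edge to a neighbour that
    -- is not clean costs nothing. If all open neighbours are clean too, one of them is given up,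
    -- but at least `l` remain and nothing is dirty; hence the cap in `suc m ⊓ l`.
    Ok1-step : ∀ {c : Col} → WF G c → ∀ γ {l m} → Ok1 c γ (suc l) (suc m) →
      Blocked G c ⊎ Ok1 c γ l (suc m ⊓ l) ⊎
      ∃ λ w → ∃ λ α → Legal G c (centre γ) w α × Ok1 (set c (centre γ) w α) γ l (suc m ⊓ l)
    Ok1-step {c} wf γ {l} {m} o with cnt (open? c γ) ≤? l
    ... | yes op≤ = inj₂ (inj₁ (record { open≤ = op≤ ; slack = slack (Ok1-weaken (m⊓n≤m (suc m) l) o) }))
    ... | no op≰ with F.any? (dirty? c γ)
    ...   | yes (α , dα) = inj₂ (inj₂ (v , α , leg , record
              { open≤ = ≤-pred (≤-trans CM.open-drop (open≤ o))
              ; slack = ≤-trans (+-monoˡ-≤ _ (m⊓n≤m (suc m) l)) (≤-pred (begin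
                  suc (suc m + cnt (dirty? c′ γ)) ≡⟨ sym (+-suc (suc m) _) ⟩
                  suc m + suc (cnt (dirty? c′ γ)) ≤⟨ +-monoʳ-≤ (suc m) (cnt-drop (dirty? c γ) (dirty? c′ γ) α dα
                       (λ d → proj₁ d (proj₁ (seen-ends c u v α))) CM.dirty-back) ⟩
                  suc m + cnt (dirty? c γ)        ≤⟨ slack o ⟩
                  cnt (clean? c γ)                ≤⟨ CM.clean-loss ⟩
                  suc (cnt (clean? c′ γ))         ∎)) }))
      where
      u = centre γ
      found = cnt-find (clean? c γ) (≤-trans (s≤s z≤n) (slack o))
      v = proj₁ found
      cl = proj₂ found
      leg : Legal G c u v α
      leg = cand-adj γ v (proj₁ cl) , proj₁ (proj₂ cl) , proj₁ dα , clean-unseen {c} {γ} cl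
      c′ = set c u v α
      module CM = CentreMove wf γ leg
    ...   | no ¬dirty with F.any? (λ w → open? c γ w ×-dec ¬? (clean? c γ w))
    ...     | yes (w , op , ¬cl) with freeColour {G = G} c (proj₁ op) (proj₂ op)
    ...       | inj₁ bl = inj₁ bl
    ...       | inj₂ (α , leg) = inj₂ (inj₂ (w , α , leg , record
              { open≤ = ≤-pred (≤-trans CM.open-drop (open≤ o))
              ; slack = ≤-trans (+-monoˡ-≤ _ (m⊓n≤m (suc m) l)) (begin
                  suc m + cnt (dirty? c′ γ)       ≤⟨ +-monoʳ-≤ (suc m) CM.dirty≤ ⟩
                  suc m + cnt (dirty? c γ)        ≤⟨ slack o ⟩
                  cnt (clean? c γ)                ≤⟨ cnt-mono (clean? c γ) (clean? c′ γ)
                      (λ v cl → CM.clean-stays v (λ { refl → ¬cl cl }) cl) ⟩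
                  cnt (clean? c′ γ)               ∎) }))
      where
      c′ = set c (centre γ) w α
      module CM = CentreMove wf γ leg
    Ok1-step {c} wf γ {l} {m} o | no op≰ | no ¬dirty | no allClean
      with open1 o
    ... | w , op with freeColour {G = G} c (proj₁ op) (proj₂ op)
    ...   | inj₁ bl = inj₁ bl
    ...   | inj₂ (α , leg) = inj₂ (inj₂ (w , α , leg , record
              { open≤ = ≤-pred (≤-trans CM.open-drop (open≤ o))
              ; slack = begin
                  suc m ⊓ l + cnt (dirty? c′ γ) ≡⟨ cong (suc m ⊓ l +_) (cnt-zero (dirty? c′ γ) (λ β d → ¬dirty (β , CM.dirty-back β d))) ⟩
                  suc m ⊓ l + 0                 ≡⟨ +-identityʳ _ ⟩
                  suc m ⊓ l                     ≤⟨ m⊓n≤n (suc m) l ⟩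
                  l                             ≤⟨ ≤-pred (≤-trans (≰⇒> op≰) (≤-trans op⊆cl CM.clean-loss)) ⟩
                  cnt (clean? c′ γ)             ∎ }))
      where
      c′ = set c (centre γ) w α
      module CM = CentreMove wf γ leg
      op⊆cl : cnt (open? c γ) ≤ cnt (clean? c γ)
      op⊆cl = cnt-mono (open? c γ) (clean? c γ) λ v op → dec-cl v op
        where
        dec-cl : ∀ v → Open c γ v → Clean c γ v
        dec-cl v op with clean? c γ v
        ... | yes cl = cl
        ... | no ¬cl = ⊥-elim (allClean (v , op , ¬cl))

    -- The passage to the second phase, its steps, and the final blocked edge.

    module Regularity (Δ : ℕ) (deg : ∀ u → cnt (adj? G u) ≡ Δ) (k≤ : k ≤ (Δ ∸ 1) + (Δ ∸ 1)) where

      deg-1 : ∀ u v → Adj G u v ≡ true → cnt (λ w → adj? G u w ×-dec (w ≠? v)) ≡ Δ ∸ 1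
      deg-1 u v a = cong (_∸ 1) (trans (≤-antisym
        (cnt-drop (adj? G u) _ v a (λ p → proj₂ p refl) (λ _ → proj₁))
        (cnt-add (adj? G u) (λ w → adj? G u w ×-dec (w ≠? v)) v (λ w ne a → a , ne))) (deg u))

      -- The last open edge at the centre leads to a clean candidate and becomes the final edge.
      Ok1⇒Ok2 : ∀ {c γ m} → Ok1 c γ 1 (suc m) → Ok2 c γ (Δ ∸ 1) 2
      Ok1⇒Ok2 {c} {γ} {m} o = record
        { v = v ; v-cand = proj₁ cl ; uv = proj₁ (proj₂ cl)
        ; full = λ w a ne e → <-irrefl refl (≤-trans (two w a ne e) (open≤ o))
        ; disj = λ α _ s → clean-unseen {c} {γ} cl s
        ; sides = trans (cnt-cong (side? c u v) (λ w → adj? G v w ×-dec (w ≠? u))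
                    (λ w (a , _ , ne) → a , ne) (λ w (a , ne) → a , proj₂ (proj₂ cl) w , ne))
                  (deg-1 v u (flip-adj (cand-adj γ v (proj₁ cl))))
        ; dirt = λ {w} {α} (sd , nu , _ , s) → noDirty α (nu , w , nbr-near {γ} (inj₂ (proj₁ cl)) (proj₁ sd) , s) }
        where
        u = centre γ
        found = cnt-find (clean? c γ) (≤-trans (s≤s z≤n) (slack o))
        v = proj₁ found
        cl = proj₂ found
        two : ∀ w → Adj G u w ≡ true → w ≢ v → c u w ≡ nothing → 2 ≤ cnt (open? c γ)
        two w a ne e = ≤-trans
          (s≤s (cnt-witness (λ z → open? c γ z ×-dec (z ≠? w)) v (clean⇒open {c} {γ} cl , λ e → ne (sym e))))
          (cnt-drop (open? c γ) (λ z → open? c γ z ×-dec (z ≠? w)) w (a , e) (λ p → proj₂ p refl) (λ _ → proj₁))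
        -- A dirty colour would force two clean candidates, and hence two open edges at the centre.
        noDirty : ∀ α → ¬ Dirty c γ α
        noDirty α d = <-irrefl refl (begin-strict
          1                                 <⟨ s≤s (≤-trans (cnt-witness (dirty? c γ) α d) (m≤n+m _ m)) ⟩
          suc m + cnt (dirty? c γ)          ≤⟨ slack o ⟩
          cnt (clean? c γ)                  ≤⟨ cnt-mono (clean? c γ) (open? c γ) (λ v → clean⇒open {c} {γ}) ⟩
          cnt (open? c γ)                   ≤⟨ open≤ o ⟩
          1                                 ∎)

      colours≥ : ∀ {c : Col} → WF G c → ∀ u v → Adj G u v ≡ true → (∀ w → Adj G u w ≡ true → w ≢ v → c u w ≢ nothing) →
        Δ ∸ 1 ≤ cnt (seen? c u)
      colours≥ {c} wf u v a full = ≤-trans (≤-reflexive (sym (deg-1 u v a)))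
        (cnt-inj (λ w → adj? G u w ×-dec (w ≠? v)) (seen? c u)
          (λ w p → proj₁ (colour w p)) (λ w p → w , proj₂ (colour w p))
          (λ w z p q e → proper wf (proj₂ (colour w p)) (trans (proj₂ (colour z q)) (cong just (sym e)))))
        where
        colour : ∀ w → Adj G u w ≡ true × w ≢ v → ∃ λ α → c u w ≡ just α
        colour w (a , ne) with c u w in eq
        ... | just α = α , refl
        ... | nothing = ⊥-elim (full w a ne eq)

      Ok2⇒Blocked : ∀ {c : Col} → WF G c → ∀ {γ h} → Ok2 c γ 0 h → Blocked G c
      Ok2⇒Blocked {c} wf {γ} o = u , v , adj-uv , uv , cnt-full s? (begin
        k ≤⟨ k≤ ⟩
        (Δ ∸ 1) + (Δ ∸ 1) ≤⟨ +-mono-≤ (colours≥ wf u v adj-uv full) (colours≥ wf v u (flip-adj adj-uv) fullv) ⟩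
        cnt (seen? c u) + cnt (seen? c v) ≤⟨ cnt-∪ (seen? c u) (seen? c v) s? (λ _ → inj₁) (λ _ → inj₂) disj ⟩
        cnt s? ∎)
        where
        open Ok2 o
        u = centre γ
        adj-uv = cand-adj γ v v-cand
        s? = λ α → seen? c u α ⊎-dec seen? c v α
        fullv : ∀ w → Adj G v w ≡ true → w ≢ u → c v w ≢ nothing
        fullv w a ne e with () ← subst (1 ≤_) sides (cnt-witness (side? c u v) w (a , e , ne))

      -- Without a dirty pair, a colour free for `uv` can go to any side edge. A single dirty pair
      -- `(w₀, α)` is removed by giving `α` to a side edge other than `vw₀`: then `α` is seen at
      -- `v`, and by uniqueness nothing forbids it at the other end. This takes a second side edge,
      -- whence the hypothesis for `h ≡ 1`. Either way no dirty pair remains, and the health is 2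
      -- again.
      Ok2-step : ∀ {c : Col} → WF G c → ∀ γ {s h} → (h ≡ 1 → 1 ≤ s) → Ok2 c γ (suc s) h →
        Blocked G c ⊎ ∃ λ v → ∃ λ w → ∃ λ α → cand γ v ≡ true × Legal G c v w α × Ok2 (set c v w α) γ s 2
      Ok2-step {c} wf γ {s} {h} hs o = choose (F.any? (λ w → F.any? (λ α → dirtyPair? c u v w α)))
        where
        open Ok2 o
        u = centre γ
        adj-uv = cand-adj γ v v-cand
        v≢u : u ≢ v
        v≢u = adj⇒≢ adj-uv

        module Move {w α} (sd : Side c u v w) (nu : ¬ Seen c u α) (nv : ¬ Seen c v α) (nw : ¬ Seen c w α)
                    (gone : ∀ {z β} → z ≢ w → β ≢ α → ¬ DirtyPair c u v z β) where
          c′ = set c v w α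
          leg : Legal G c v w α
          leg = proj₁ sd , proj₁ (proj₂ sd) , nv , nw
          coloured : c′ v w ≢ nothing
          coloured e with () ← trans (sym e) (set-hit c v w α (inj₁ (refl , refl)))
          w≢u = proj₂ (proj₂ sd)
          u-row : ∀ z → c′ u z ≡ c u z
          u-row z = set-row c v w α z v≢u (λ e → w≢u (sym e))
          side-forth : ∀ z → z ≢ w → Side c u v z → Side c′ u v z
          side-forth z z≢w (a , e , ne) = a , trans (set-miss c v w α np) e , ne
            where
            np : ¬ SamePair v w v z
            np (inj₁ (_ , q)) = z≢w q
            np (inj₂ (p , q)) = z≢w (trans q p)
          side-back : ∀ z → Side c′ u v z → Side c u v z
          side-back z (a , e , ne) = a , set-nothing c v w α e , ne
          ok : Ok2 c′ γ s 2
          ok = record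
            { v = v ; v-cand = v-cand
            ; uv = trans (u-row v) uv
            ; full = λ z a ne e → full z a ne (set-nothing c v w α e)
            ; disj = dj
            ; sides = suc-injective (trans (≤-antisym
                (cnt-drop (side? c u v) (side? c′ u v) w sd (λ p → coloured (proj₁ (proj₂ p))) side-back)
                (cnt-add (side? c u v) (side? c′ u v) w side-forth)) sides)
            ; dirt = dt }
            where
            dj : ∀ β → Seen c′ u β → ¬ Seen c′ v β
            dj β (z , e) sv with seen-old c v w α sv
            ... | inj₁ sv′ = disj β (z , trans (sym (u-row z)) e) sv′
            ... | inj₂ (refl , _) = nu (z , trans (sym (u-row z)) e)
            dt : ∀ {z β} → ¬ DirtyPair c′ u v z β
            dt {z} {β} (sd′ , nu′ , nv′ , s′) with seen-old c v w α s′
            ... | inj₂ (refl , _) = nv′ (proj₁ (seen-ends c v w α))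
            ... | inj₁ s″ = gone (λ { refl → coloured (proj₁ (proj₂ sd′)) }) (λ { refl → nv′ (proj₁ (seen-ends c v w α)) })
                  (side-back z sd′ , (λ t → nu′ (seen-keeps wf leg t)) , (λ t → nv′ (seen-keeps wf leg t)) , s″)

        choose : Dec (∃ λ w → ∃ λ α → DirtyPair c u v w α) →
          Blocked G c ⊎ ∃ λ v → ∃ λ w → ∃ λ α → cand γ v ≡ true × Legal G c v w α × Ok2 (set c v w α) γ s 2
        choose (no ¬d) with freeColour {G = G} c adj-uv uv
        ... | inj₁ bl = inj₁ bl
        ... | inj₂ (α , _ , _ , nu , nv) = inj₂ (v , w , α , v-cand , M.leg , M.ok)
          where
          found = cnt-find (side? c u v) (≤-trans (s≤s z≤n) (≤-reflexive (sym sides)))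
          w = proj₁ found
          module M = Move (proj₂ found) nu nv (λ sw → ¬d (w , α , proj₂ found , nu , nv , sw)) (λ _ _ p → ¬d (_ , _ , p))
        choose (yes (w₀ , α , d)) = inj₂ (v , w , α , v-cand , M.leg , M.ok)
          where
          unique : ∀ h → DirtOk h c u v → h ≡ 1
          unique 1 _ = refl
          unique 2 nd = ⊥-elim (nd d)
          uniq : DirtOk 1 c u v
          uniq = subst (λ h → DirtOk h c u v) (unique h dirt) dirt
          found = cnt-find≢ (side? c u v) w₀ (≤-trans (s≤s (hs (unique h dirt))) (≤-reflexive (sym sides)))
          w = proj₁ found
          sd = proj₁ (proj₂ found)
          module M = Move sd (proj₁ (proj₂ d)) (proj₁ (proj₂ (proj₂ d)))
            (λ sw → proj₂ (proj₂ found) (proj₁ (uniq (sd , proj₁ (proj₂ d) , proj₁ (proj₂ (proj₂ d)) , sw) d)))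
            (λ _ β≢α p → β≢α (proj₂ (uniq p d)))

-- Breaker's strategy

-- The health after a step of Breaker to level t.
data Next (Δ t h : ℕ) : ℕ → Set where
  below : t < Δ → Next Δ t h 2
  above : ∀ l → t ≡ l + Δ → Next Δ t h (h ⊓ (2 + l))

-- The health lost to an edge of Maker with one end in the region.
dmg : Bool → ℕ
dmg true  = 0
dmg false = 1

-- W t h is the weight of a gadget with t steps to go and health h.  Maker destroys a weight of at most
-- 2 * H t per move as long as every gadget has at least t steps to go, and b steps of Breaker to levels
-- ≤ t restore it.
record Weights (wide : Bool) (b Δ T : ℕ) : Set where
  field
    W : ℕ → ℕ → ℕ
    H : ℕ → ℕ
    W-0      : ∀ h → W 0 h ≡ 0
    W-dead   : ∀ t → W t 0 ≡ 0
    W-1-1    : W 1 1 ≡ 0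
    H-mono   : ∀ t → suc t ≤ T → H (suc t) ≤ H t
    lossBoth : ∀ t h → W t h ≤ W t (h ∸ 3) + 2 * H t
    lossOne  : ∀ t h → W t h ≤ W t (h ∸ dmg wide) + H t
    gain     : ∀ {t h h′} → 1 ≤ t → suc t ≤ T → Next Δ t h h′ → 0 < W (suc t) h →
               b * W (suc t) h + 2 * H t ≤ b * W t h′

module Strategy {n k Δ T b : ℕ} (G : SimpleGraph n) (deg : ∀ u → cnt (adj? G u) ≡ Δ) (k≤ : k ≤ (Δ ∸ 1) + (Δ ∸ 1))
                (2≤Δ : 2 ≤ Δ) (1≤b : 1 ≤ b) (wide : Bool) (weights : Weights wide b Δ T) where

  open Gadgets G
  open Play k
  open Regularity Δ deg k≤
  open Weights weights

  private Col = Colouring n k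

  -- The level `t` counts the steps to go. In the first phase these are `l + 1` steps until one edge
  -- is left at the centre, and Δ ∸ 1 steps after that. `dead` promises nothing, so destroyed
  -- gadgets may stay in the lists.
  data Ok (c : Col) (γ : Gadget) : ℕ → ℕ → Set where
    dead : ∀ {t} → Ok c γ t 0
    ph1  : ∀ {t m} l → t ≡ l + Δ → Ok1 c γ (2 + l) m → Ok c γ t m
    ph2  : ∀ {t h} → t < Δ → Ok2 c γ t h → Ok c γ t h

  module _ {c : Col} (wf : WF G c) {x y : Fin n} {α : Fin k} (leg : Legal G c x y α) {γ : Gadget} where

    private c′ = set c x y α

    -- In the second phase the health is at most 2, so that losing 3 leaves nothing to show.
    Ok-both : ∀ {t h} → Ok c γ t h → Ok c′ γ t (h ∸ 3)
    Ok-both dead = dead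
    Ok-both (ph1 {m = 0} l e o) = dead
    Ok-both (ph1 {m = 1} l e o) = dead
    Ok-both (ph1 {m = 2} l e o) = dead
    Ok-both (ph1 {m = suc (suc (suc m))} l e o) = ph1 l e (Ok1-both wf leg γ o)
    Ok-both (ph2 {h = 0} lt o) = dead
    Ok-both (ph2 {h = 1} lt o) = dead
    Ok-both (ph2 {h = 2} lt o) = dead
    Ok-both (ph2 {h = suc (suc (suc h))} lt o) = ⊥-elim (Ok2.dirt o)

    Ok-one : ¬ (Near γ x × Near γ y) → ∀ {t h} → Ok c γ t h → Ok c′ γ t (h ∸ 1)
    Ok-one nb dead = dead
    Ok-one nb (ph1 {m = 0} l e o) = dead
    Ok-one nb (ph1 {m = suc m} l e o) = ph1 l e (NotBoth.Ok1-one wf leg γ nb o)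
    Ok-one nb (ph2 {h = 0} lt o) = dead
    Ok-one nb (ph2 {h = 1} lt o) = dead
    Ok-one nb (ph2 {h = 2} lt o) = ph2 lt (NotBoth.Ok2-one wf leg γ nb o)
    Ok-one nb (ph2 {h = suc (suc (suc h))} lt o) = ⊥-elim (Ok2.dirt o)

    Ok-none : ¬ Near γ x → ¬ Near γ y → ∀ {t h} → Ok c γ t h → Ok c′ γ t h
    Ok-none nx ny dead = dead
    Ok-none nx ny (ph1 l e o) = ph1 l e (Neither.Ok1-none wf leg γ nx ny o)
    Ok-none nx ny (ph2 lt o) = ph2 lt (Neither.Ok2-none wf leg γ nx ny o)

    -- With wide regions, an edge that has an end near γ lies in the region with both ends. So an
    -- edge with only one end there does not touch γ, and `dmg true` can be 0.
    Ok-oneReg : ∀ wd → ¬ (Reg wd γ x × Reg wd γ y) → ∀ {t h} → Ok c γ t h → Ok c′ γ t (h ∸ dmg wd)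
    Ok-oneReg false nb o = Ok-one nb o
    Ok-oneReg true nb o = Ok-none
      (λ nx → nb (near-reg true {γ} nx , (x , nx , inj₂ (flip-adj (proj₁ leg)))))
      (λ ny → nb ((y , ny , inj₂ (proj₁ leg)) , near-reg true {γ} ny)) o

  after : ∀ {A B : Set} → Dec A → Dec B → ℕ → ℕ
  after (yes _) (yes _) h = h ∸ 3
  after (yes _) (no _)  h = h ∸ dmg wide
  after (no _)  (yes _) h = h ∸ dmg wide
  after (no _)  (no _)  h = h

  Entry : Set
  Entry = Gadget × ℕ

  damage : Fin n → Fin n → Entry → Entry
  damage x y (γ , h) = γ , after (reg? wide γ x) (reg? wide γ y) h

  Ok-damage : ∀ {c : Col} → WF G c → ∀ {x y α} → Legal G c x y α → ∀ {t} e → Ok c (proj₁ e) t (proj₂ e) →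
    Ok (set c x y α) (proj₁ (damage x y e)) t (proj₂ (damage x y e))
  Ok-damage wf {x} {y} leg (γ , h) o with reg? wide γ x | reg? wide γ y
  ... | yes _ | yes _ = Ok-both wf leg o
  ... | yes _ | no ny = Ok-oneReg wf leg wide (λ p → ny (proj₂ p)) o
  ... | no nx | yes _ = Ok-oneReg wf leg wide (λ p → nx (proj₁ p)) o
  ... | no nx | no ny = Ok-none wf leg (nx ∘ near-reg wide) (ny ∘ near-reg wide) o

  -- The loss is charged to the ends of Maker's edge, at most `H t` to each. Since the regions are
  -- disjoint, a move costs at most `2 * H t` altogether, whether it hits one gadget with both ends
  -- or two gadgets with one end each.
  W-damage : ∀ t x y γ h → W t h ≤ W t (proj₂ (damage x y (γ , h))) + (ind (reg? wide γ x) + ind (reg? wide γ y)) * H t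
  W-damage t x y γ h with reg? wide γ x | reg? wide γ y
  ... | yes _ | yes _ = lossBoth t h
  ... | yes _ | no ny = ≤-trans (lossOne t h) (+-monoʳ-≤ _ (≤-reflexive (sym (+-identityʳ (H t)))))
  ... | no nx | yes _ = ≤-trans (lossOne t h) (+-monoʳ-≤ _ (≤-reflexive (sym (+-identityʳ (H t)))))
  ... | no nx | no ny = m≤m+n _ _

  load : Fin n → List Entry → ℕ
  load x [] = 0
  load x ((γ , _) ∷ L) = ind (reg? wide γ x) + load x L

  pot : ℕ → List Entry → ℕ
  pot t [] = 0
  pot t ((_ , h) ∷ L) = W t h + pot t L

  AllOk : Col → ℕ → List Entry → Set
  AllOk c t = All (λ e → Ok c (proj₁ e) t (proj₂ e))

  load-damage : ∀ z x y L → load z (map (damage x y) L) ≡ load z L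
  load-damage z x y [] = refl
  load-damage z x y ((γ , _) ∷ L) = cong (ind (reg? wide γ z) +_) (load-damage z x y L)

  AllOk-damage : ∀ {c : Col} → WF G c → ∀ {x y α} → Legal G c x y α → ∀ {t L} → AllOk c t L →
    AllOk (set c x y α) t (map (damage x y) L)
  AllOk-damage wf leg [] = []
  AllOk-damage wf leg {L = e ∷ _} (o ∷ os) = Ok-damage wf leg e o ∷ AllOk-damage wf leg os

  pot-damage : ∀ t x y L → pot t L ≤ pot t (map (damage x y) L) + (load x L + load y L) * H t
  pot-damage t x y [] = z≤n
  pot-damage t x y ((γ , h) ∷ L) = ≤-trans
    (+-mono-≤ (W-damage t x y γ h) (pot-damage t x y L))
    (≤-reflexive (arith (W t (proj₂ (damage x y (γ , h)))) (pot t (map (damage x y) L))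
      (ind (reg? wide γ x)) (ind (reg? wide γ y)) (load x L) (load y L) (H t)))
    where
    arith : ∀ w p a b c d h → w + (a + b) * h + (p + (c + d) * h) ≡ w + p + (a + c + (b + d)) * h
    arith = solve-∀

  -- For Breaker's own steps: their ends lie in the region of the gadget that is advanced, hence in
  -- no other region.
  AllOk-far : ∀ {c : Col} → WF G c → ∀ {x y α} → Legal G c x y α → ∀ {t L} → load x L ≡ 0 → load y L ≡ 0 →
    AllOk c t L → AllOk (set c x y α) t L
  AllOk-far wf leg lx ly [] = []
  AllOk-far wf {x} {y} leg {L = (γ , h) ∷ L} lx ly (o ∷ os) =
    Ok-none wf leg (far x lx) (far y ly) o ∷
    AllOk-far wf leg (m+n≡0⇒n≡0 (ind (reg? wide γ x)) lx) (m+n≡0⇒n≡0 (ind (reg? wide γ y)) ly) os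
    where
    far : ∀ z → load z ((γ , h) ∷ L) ≡ 0 → ¬ Near γ z
    far z lz nz with () ← trans (sym (ind-yes (reg? wide γ z) (near-reg wide nz))) (m+n≡0⇒m≡0 (ind (reg? wide γ z)) lz)

  StepOutcome : Col → Gadget → ℕ → ℕ → Set
  StepOutcome c γ t h = Blocked G c ⊎ (1 ≤ t × ∃ λ h′ → Next Δ t h h′ × Ok c γ t h′)

  StepResult : Col → Gadget → ℕ → ℕ → Set
  StepResult c γ t h = StepOutcome c γ t h ⊎
    ∃ λ x → ∃ λ y → ∃ λ α → Near γ x × Near γ y × Legal G c x y α × StepOutcome (set c x y α) γ t h

  -- At level 1 there is no second side edge to take the colour of a dirty pair, so health 1 is
  -- excluded there. Such gadgets have weight 0 by `W-1-1` and are given up.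
  Ok-step : ∀ {c : Col} → WF G c → ∀ γ {t h} → 1 ≤ h → (t ≡ 0 → h ≢ 1) → Ok c γ (suc t) h → StepResult c γ t h
  Ok-step wf γ () _ dead
  Ok-step {c} wf γ {t} {suc m} _ _ (ph1 zero e o) = conv (Ok1-step wf γ o)
    where
    t≡ : Δ ∸ 1 ≡ t
    t≡ = cong (_∸ 1) (sym e)
    1≤t : 1 ≤ t
    1≤t = ≤-pred (subst (2 ≤_) (sym e) 2≤Δ)
    ok : ∀ {c′ : Col} → Ok1 c′ γ 1 (suc m ⊓ 1) → StepOutcome c′ γ t (suc m)
    ok o′ = inj₂ (1≤t , 2 , below (≤-reflexive e) , ph2 (≤-reflexive e) (subst (λ s → Ok2 _ γ s 2) t≡ (Ok1⇒Ok2 o′)))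
    conv : Blocked G c ⊎ Ok1 c γ 1 (suc m ⊓ 1) ⊎
      ∃ (λ w → ∃ λ α → Legal G c (centre γ) w α × Ok1 (set c (centre γ) w α) γ 1 (suc m ⊓ 1)) → StepResult c γ t (suc m)
    conv (inj₁ bl) = inj₁ (inj₁ bl)
    conv (inj₂ (inj₁ o′)) = inj₁ (ok o′)
    conv (inj₂ (inj₂ (w , α , leg , o′))) =
      inj₂ (centre γ , w , α , core-near {γ} (inj₁ refl) , nbr-near {γ} (inj₁ refl) (proj₁ leg) , leg , ok o′)
  Ok-step {c} wf γ {t} {suc m} _ _ (ph1 (suc l) e o) = conv (Ok1-step wf γ o)
    where
    t≡ : t ≡ l + Δ
    t≡ = suc-injective e
    1≤t : 1 ≤ t
    1≤t = ≤-trans (≤-trans (s≤s z≤n) 2≤Δ) (≤-trans (m≤n+m Δ l) (≤-reflexive (sym t≡)))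
    ok : ∀ {c′ : Col} → Ok1 c′ γ (2 + l) (suc m ⊓ (2 + l)) → StepOutcome c′ γ t (suc m)
    ok o′ = inj₂ (1≤t , _ , above l t≡ , ph1 l t≡ o′)
    conv : Blocked G c ⊎ Ok1 c γ (2 + l) (suc m ⊓ (2 + l)) ⊎
      ∃ (λ w → ∃ λ α → Legal G c (centre γ) w α × Ok1 (set c (centre γ) w α) γ (2 + l) (suc m ⊓ (2 + l))) →
      StepResult c γ t (suc m)
    conv (inj₁ bl) = inj₁ (inj₁ bl)
    conv (inj₂ (inj₁ o′)) = inj₁ (ok o′)
    conv (inj₂ (inj₂ (w , α , leg , o′))) =
      inj₂ (centre γ , w , α , core-near {γ} (inj₁ refl) , nbr-near {γ} (inj₁ refl) (proj₁ leg) , leg , ok o′)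
  Ok-step {c} wf γ {t} {h} _ h≢1 (ph2 lt o) with Ok2-step wf γ (positive t h≢1) o
    where
    positive : ∀ t → (t ≡ 0 → h ≢ 1) → h ≡ 1 → 1 ≤ t
    positive zero    h≢1 e = ⊥-elim (h≢1 refl e)
    positive (suc _) _   _ = s≤s z≤n
  ... | inj₁ bl = inj₁ (inj₁ bl)
  ... | inj₂ (v , w , α , cv , leg , o′) =
        inj₂ (v , w , α , core-near {γ} (inj₂ cv) , nbr-near {γ} (inj₂ cv) (proj₁ leg) , leg , out t lt o′)
    where
    out : ∀ t → suc t < Δ → Ok2 (set c v w α) γ t 2 → StepOutcome (set c v w α) γ t h
    out zero lt o′ = inj₁ (Ok2⇒Blocked (WF-set wf leg) o′)
    out (suc t) lt o′ = inj₂ (s≤s z≤n , 2 , below (<⇒≤ lt) , ph2 (<⇒≤ lt) o′)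

  -- Hi has t + 1 steps to go and Lo has t.
  record State (c : Col) (t : ℕ) (Hi Lo : List Entry) : Set where
    field
      okHi : AllOk c (suc t) Hi
      okLo : AllOk c t Lo
      disj : ∀ x → load x Hi + load x Lo ≤ 1
  open State

  Φ : ℕ → List Entry → List Entry → ℕ
  Φ t Hi Lo = pot (suc t) Hi + pot t Lo

  pot-0 : ∀ L → pot 0 L ≡ 0
  pot-0 [] = refl
  pot-0 ((_ , h) ∷ L) = cong₂ _+_ (W-0 h) (pot-0 L)

  Outcome : Col → ℕ → ℕ → ℕ → Set
  Outcome c t r goal = ∃ λ m → ∃ λ c′ → m ≤ r × Steps G c m c′ × WF G c′ ×
    (Blocked G c′ ⊎ ∃ λ t′ → ∃ λ Hi → ∃ λ Lo → t′ ≤ t × State c′ t′ Hi Lo × goal ≤ b * Φ t′ Hi Lo)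

  -- The gain `β` per step, measured after multiplication by `b`, is fixed when the turn begins. It
  -- stays available as the level falls because `H` grows downwards. When `Hi` is used up, `Lo`
  -- takes its place one level lower; the recursion is lexicographic in `r`, `t` and `Hi`.
  turn : ∀ r t (c : Col) Hi Lo β → WF G c → State c t Hi Lo → suc t ≤ T → β ≤ 2 * H t → 0 < Φ t Hi Lo →
    Outcome c t r (b * Φ t Hi Lo + r * β)
  turn zero t c Hi Lo β wf st t≤ β≤ pos =
    0 , c , z≤n , none , wf , inj₂ (t , Hi , Lo , ≤-refl , st , ≤-reflexive (+-identityʳ _))
  -- Level 0 carries no weight: a step that would lead there blocks the final edge instead.
  turn (suc r) zero c [] Lo β wf st t≤ β≤ pos = ⊥-elim (<-irrefl (sym (pot-0 Lo)) pos)
  turn (suc r) (suc t) c [] Lo β wf st t≤ β≤ pos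
    with turn (suc r) t c Lo [] β wf
      (record { okHi = okLo st ; okLo = [] ; disj = λ x → ≤-trans (≤-reflexive (+-identityʳ _)) (disj st x) })
      (<⇒≤ t≤) (≤-trans β≤ (*-monoʳ-≤ 2 (H-mono t (<⇒≤ t≤)))) (≤-trans pos (≤-reflexive (sym (+-identityʳ _))))
  ... | m , c′ , m≤ , steps , wf′ , inj₁ bl = m , c′ , m≤ , steps , wf′ , inj₁ bl
  ... | m , c′ , m≤ , steps , wf′ , inj₂ (t′ , Hi′ , Lo′ , t′≤ , st′ , g) =
        m , c′ , m≤ , steps , wf′ , inj₂ (t′ , Hi′ , Lo′ , m≤n⇒m≤1+n t′≤ , st′ ,
          subst (λ p → b * p + suc r * β ≤ _) (+-identityʳ _) g)
  turn (suc r) t c ((γ , h) ∷ Hi) Lo β wf st t≤ β≤ pos with W (suc t) h in eqW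
  -- A gadget without weight is dropped, since nothing guarantees a step for it.
  ... | zero = turn (suc r) t c Hi Lo β wf
        (record { okHi = All.tail (okHi st) ; okLo = okLo st
                ; disj = λ x → ≤-trans (+-monoˡ-≤ (load x Lo) (m≤n+m (load x Hi) _)) (disj st x) })
        t≤ β≤ pos
  ... | suc _ = go (Ok-step wf γ 1≤h h≢1 (All.head (okHi st)))
    where
    0<W : 0 < W (suc t) h
    0<W = subst (0 <_) (sym eqW) (s≤s z≤n)
    1≤h : 1 ≤ h
    1≤h = n≢0⇒n>0 (λ { refl → <-irrefl (sym (W-dead (suc t))) 0<W })
    h≢1 : t ≡ 0 → h ≢ 1
    h≢1 refl refl = <-irrefl (sym W-1-1) 0<W
    Φ₀ = W (suc t) h + pot (suc t) Hi + pot t Lo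
    Φ₀≡ : suc _ + pot (suc t) Hi + pot t Lo ≡ Φ₀
    Φ₀≡ = cong (λ w → w + pot (suc t) Hi + pot t Lo) (sym eqW)

    proceed : ∀ {c′ : Col} → WF G c′ → AllOk c′ (suc t) Hi → AllOk c′ t Lo → ∀ {h′} → 1 ≤ t → Next Δ t h h′ → Ok c′ γ t h′ →
      Outcome c′ t r (b * Φ₀ + suc r * β)
    proceed {c′} wf′ okH okL {h′} 1≤t nx o
      with turn r t c′ Hi ((γ , h′) ∷ Lo) β wf′
        (record { okHi = okH ; okLo = o ∷ okL
                ; disj = λ x → ≤-trans (≤-reflexive (shuffle (load x Hi) (ind (reg? wide γ x)) (load x Lo))) (disj st x) })
        t≤ β≤ pos′
      where
      shuffle : ∀ a b c → a + (b + c) ≡ b + a + c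
      shuffle = solve-∀
      W≤ : b * W (suc t) h + β ≤ b * W t h′
      W≤ = ≤-trans (+-monoʳ-≤ (b * W (suc t) h) β≤) (gain 1≤t t≤ nx 0<W)
      pos′ : 0 < pot (suc t) Hi + (W t h′ + pot t Lo)
      pos′ = ≤-trans (n≢0⇒n>0 (λ e → <-irrefl (sym (trans (cong (b *_) e) (*-zeroʳ b)))
               (≤-trans (*-mono-≤ 1≤b 0<W) (≤-trans (m≤m+n (b * W (suc t) h) β) W≤))))
               (≤-trans (m≤m+n (W t h′) (pot t Lo)) (m≤n+m _ (pot (suc t) Hi)))
    ... | m , c″ , m≤ , steps , wf″ , inj₁ bl = m , c″ , m≤ , steps , wf″ , inj₁ bl
    ... | m , c″ , m≤ , steps , wf″ , inj₂ (t′ , Hi′ , Lo′ , t′≤ , st′ , g) =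
          m , c″ , m≤ , steps , wf″ , inj₂ (t′ , Hi′ , Lo′ , t′≤ , st′ , ≤-trans better g)
      where
      P = pot (suc t) Hi
      Q = pot t Lo
      expand : ∀ b w p q β r → b * (w + p + q) + suc r * β ≡ (b * w + β) + (b * (p + q) + r * β)
      expand = solve-∀
      collect : ∀ b w p q x → b * w + (b * (p + q) + x) ≡ b * (p + (w + q)) + x
      collect = solve-∀
      W≤′ : b * W (suc t) h + β ≤ b * W t h′
      W≤′ = ≤-trans (+-monoʳ-≤ (b * W (suc t) h) β≤) (gain 1≤t t≤ nx 0<W)
      better : b * Φ₀ + suc r * β ≤ b * (P + (W t h′ + Q)) + r * β
      better = begin
        b * Φ₀ + suc r * β                               ≡⟨ expand b (W (suc t) h) P Q β r ⟩
        (b * W (suc t) h + β) + (b * (P + Q) + r * β)     ≤⟨ +-monoˡ-≤ _ W≤′ ⟩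
        b * W t h′ + (b * (P + Q) + r * β)                ≡⟨ collect b (W t h′) P Q (r * β) ⟩
        b * (P + (W t h′ + Q)) + r * β                    ∎

    lift : ∀ {c′ : Col} j → (∀ {m c″} → Steps G c′ m c″ → Steps G c (j + m) c″) → j ≤ 1 →
      Outcome c′ t r (b * Φ₀ + suc r * β) → Outcome c t (suc r) (b * (suc _ + pot (suc t) Hi + pot t Lo) + suc r * β)
    lift j pre j≤ (m , c″ , m≤ , steps , wf″ , res) =
      j + m , c″ , +-mono-≤ j≤ m≤ , pre steps , wf″ ,
      subst (λ p → Blocked G c″ ⊎ ∃ λ t′ → ∃ λ Hi → ∃ λ Lo → t′ ≤ t × State c″ t′ Hi Lo × b * p + suc r * β ≤ b * Φ t′ Hi Lo)
        (sym Φ₀≡) res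

    far : ∀ {x} → Near γ x → load x Hi ≡ 0 × load x Lo ≡ 0
    far {x} nx = m+n≡0⇒m≡0 (load x Hi) s≡0 , m+n≡0⇒n≡0 (load x Hi) s≡0
      where
      s≡0 : load x Hi + load x Lo ≡ 0
      s≡0 = n≤0⇒n≡0 (≤-pred (subst (λ i → i + load x Hi + load x Lo ≤ 1) (ind-yes (reg? wide γ x) (near-reg wide nx)) (disj st x)))

    go : StepResult c γ t h → Outcome c t (suc r) (b * (suc _ + pot (suc t) Hi + pot t Lo) + suc r * β)
    go (inj₁ (inj₁ bl)) = 0 , c , z≤n , none , wf , inj₁ bl
    go (inj₁ (inj₂ (1≤t , h′ , nx , o))) = lift 0 id z≤n (proceed wf (All.tail (okHi st)) (okLo st) 1≤t nx o)
    go (inj₂ (x , y , α , nx , ny , leg , inj₁ bl)) =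
      1 , set c x y α , s≤s z≤n , step x y α leg none , WF-set wf leg , inj₁ bl
    go (inj₂ (x , y , α , nx , ny , leg , inj₂ (1≤t , h′ , nxt , o))) =
      lift 1 (step x y α leg) ≤-refl (proceed (WF-set wf leg)
        (AllOk-far wf leg (proj₁ (far nx)) (proj₁ (far ny)) (All.tail (okHi st)))
        (AllOk-far wf leg (proj₂ (far nx)) (proj₂ (far ny)) (okLo st)) 1≤t nxt o)

  Ok-open : ∀ {c : Col} {γ t h} → 1 ≤ h → Ok c γ t h → ∃ λ x → ∃ λ y → Adj G x y ≡ true × c x y ≡ nothing
  Ok-open () dead
  Ok-open {γ = γ} (s≤s _) (ph1 l e o) = centre γ , open1 o
  Ok-open {γ = γ} _ (ph2 _ o) = centre γ , Ok2.v o , cand-adj γ _ (Ok2.v-cand o) , Ok2.uv o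

  pot-open : ∀ {c : Col} {t} L → AllOk c t L → 0 < pot t L → ∃ λ x → ∃ λ y → Adj G x y ≡ true × c x y ≡ nothing
  pot-open {t = t} ((γ , h) ∷ L) (o ∷ os) pos with h
  ... | suc _ = Ok-open (s≤s z≤n) o
  ... | zero = pot-open L os (subst (λ w → 0 < w + pot t L) (W-dead t) pos)

  Φ-open : ∀ {c : Col} {t Hi Lo} → State c t Hi Lo → 0 < Φ t Hi Lo → ∃ λ x → ∃ λ y → Adj G x y ≡ true × c x y ≡ nothing
  Φ-open {t = t} {Hi} {Lo} st pos with pot (suc t) Hi in eq
  ... | suc _ = pot-open Hi (okHi st) (subst (0 <_) (sym eq) (s≤s z≤n))
  ... | zero = pot-open Lo (okLo st) pos

  H≤H0 : ∀ t → t ≤ T → H t ≤ H 0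
  H≤H0 zero _ = ≤-refl
  H≤H0 (suc t) t< = ≤-trans (H-mono t t<) (H≤H0 t (<⇒≤ t<))

  -- The bound on `Φ` is an invariant: Breaker's `b` steps win back the `2 * H t` that Maker
  -- destroys. It exceeds what one move of Maker can take, so the potential is positive at each
  -- point where it matters, some edge is uncoloured, and `finished` cannot occur. The induction is
  -- on Maker's strategy.
  breaker-wins : ∀ {c : Col} {t Hi Lo} → WF G c → State c t Hi Lo → suc t ≤ T → 2 * H 0 < Φ t Hi Lo → ¬ MakerWins G b c
  breaker-wins wf st t≤ big (finished all) with Φ-open st (≤-trans (s≤s z≤n) big)
  ... | x , y , a , e = all x y a e
  breaker-wins {c} {t} {Hi} {Lo} wf st t≤ big (play x y α leg reply) =
    continue (turn b t c′ Hi′ Lo′ (2 * H t) (WF-set wf leg) st′ t≤ ≤-refl pos′)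
    where
    c′ = set c x y α
    Hi′ = map (damage x y) Hi
    Lo′ = map (damage x y) Lo
    st′ : State c′ t Hi′ Lo′
    st′ = record { okHi = AllOk-damage wf leg (okHi st) ; okLo = AllOk-damage wf leg (okLo st)
                 ; disj = λ z → ≤-trans (≤-reflexive (cong₂ _+_ (load-damage z x y Hi) (load-damage z x y Lo))) (disj st z) }
    expand : ∀ p q a b c d h → p + (a + b) * h + (q + (c + d) * h) ≡ p + q + ((a + c) + (b + d)) * h
    expand = solve-∀
    Φ≤ : Φ t Hi Lo ≤ Φ t Hi′ Lo′ + 2 * H t
    Φ≤ = begin
      pot (suc t) Hi + pot t Lo ≤⟨ +-mono-≤ (pot-damage (suc t) x y Hi) (pot-damage t x y Lo) ⟩
      pot (suc t) Hi′ + (load x Hi + load y Hi) * H (suc t) + (pot t Lo′ + (load x Lo + load y Lo) * H t)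
        ≤⟨ +-monoˡ-≤ _ (+-monoʳ-≤ (pot (suc t) Hi′) (*-monoʳ-≤ (load x Hi + load y Hi) (H-mono t t≤))) ⟩
      pot (suc t) Hi′ + (load x Hi + load y Hi) * H t + (pot t Lo′ + (load x Lo + load y Lo) * H t)
        ≡⟨ expand (pot (suc t) Hi′) (pot t Lo′) (load x Hi) (load y Hi) (load x Lo) (load y Lo) (H t) ⟩
      Φ t Hi′ Lo′ + (load x Hi + load x Lo + (load y Hi + load y Lo)) * H t
        ≤⟨ +-monoʳ-≤ (Φ t Hi′ Lo′) (*-monoˡ-≤ (H t) (+-mono-≤ (disj st x) (disj st y))) ⟩
      Φ t Hi′ Lo′ + 2 * H t ∎
    pos′ : 0 < Φ t Hi′ Lo′
    pos′ = +-cancelʳ-< (2 * H t) 0 _ (begin-strict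
      2 * H t                ≤⟨ *-monoʳ-≤ 2 (H≤H0 t (<⇒≤ t≤)) ⟩
      2 * H 0                <⟨ big ⟩
      Φ t Hi Lo              ≤⟨ Φ≤ ⟩
      Φ t Hi′ Lo′ + 2 * H t  ∎)
    continue : Outcome c′ t b (b * Φ t Hi′ Lo′ + b * (2 * H t)) → ⊥
    continue (m , c″ , m≤ , steps , wf″ , inj₁ bl) = Blocked-loses wf″ bl (reply m c″ m≤ steps)
    continue (m , c″ , m≤ , steps , wf″ , inj₂ (t′ , Hi″ , Lo″ , t′≤ , st″ , g)) =
      breaker-wins wf″ st″ (≤-trans (s≤s t′≤) t≤) (begin-strict
        2 * H 0               <⟨ big ⟩
        Φ t Hi Lo             ≤⟨ Φ≤ ⟩
        Φ t Hi′ Lo′ + 2 * H t ≤⟨ *-cancelˡ-≤ b {{>-nonZero 1≤b}} (≤-trans (≤-reflexive (*-distribˡ-+ b (Φ t Hi′ Lo′) (2 * H t))) g) ⟩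
        Φ t′ Hi″ Lo″          ∎) (reply m c″ m≤ steps)

-- The weights

prod : (ℕ → ℕ) → ℕ → ℕ
prod f zero    = 1
prod f (suc t) = prod f t * f (suc t)

-- A sequence with Z (t+1) / Z t = p (t+1) / q (t+1) for t < T, without denominators.
module Ratios (p q : ℕ → ℕ) (T : ℕ) where

  up : ℕ → ℕ
  up zero    = 1
  up (suc j) = q (T ∸ j) * up j

  Z : ℕ → ℕ
  Z t = prod p t * up (T ∸ t)

  Z-ratio : ∀ t → suc t ≤ T → q (suc t) * Z (suc t) ≡ p (suc t) * Z t
  Z-ratio t t< = trans (arith (q (suc t)) (prod p t) (p (suc t)) (up (T ∸ suc t)))
                       (cong (λ u → p (suc t) * (prod p t * u)) (sym up-step))
    where
    arith : ∀ q P p u → q * (P * p * u) ≡ p * (P * (q * u))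
    arith = solve-∀
    up-step : up (T ∸ t) ≡ q (suc t) * up (T ∸ suc t)
    up-step = trans (cong up (+-∸-assoc 1 t<)) (cong (λ i → q i * up (T ∸ suc t)) (m∸[m∸n]≡n t<))

  Z-top : Z T ≡ prod p T
  Z-top = trans (cong (λ j → prod p T * up j) (n∸n≡0 T)) (*-identityʳ _)

  up-prod : ∀ t j → t + j ≡ T → prod q t * up j ≡ prod q T
  up-prod t zero    e = trans (*-identityʳ _) (cong (prod q) (trans (sym (+-identityʳ t)) e))
  up-prod t (suc j) e = trans (sym (*-assoc (prod q t) (q (T ∸ j)) (up j)))
    (trans (cong (λ i → prod q t * q i * up j) Tj) (up-prod (suc t) j (trans (sym (+-suc t j)) e)))
    where
    Tj : T ∸ j ≡ suc t
    Tj = trans (cong (_∸ j) (trans (sym e) (+-suc t j))) (m+n∸n≡m (suc t) j)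

  Z-bottom : Z 0 ≡ prod q T
  Z-bottom = trans (+-identityʳ _) (trans (sym (+-identityʳ _)) (up-prod 0 T refl))

sg : ℕ → ℕ
sg zero    = 0
sg (suc _) = 1

is2 : ℕ → ℕ
is2 2 = 1
is2 _ = 0

-- The largest weight, in units of `H`, that a gadget may have while one edge can destroy it. With
-- narrow regions a single end in the region may be fatal and is charged `H`; with wide regions both
-- ends must lie there, which is charged `2 * H`. Per step the weight then shrinks by the factor (b
-- w - 2)/(b w) with w this value, so b = 2 calls for w = 2.
wt : Bool → ℕ
wt true  = 2
wt false = 1

-- The level t = l + Δ of the first phase is the one with 2 + l uncoloured edges at the centre.  Below
-- l = lB a single move of Maker may destroy a gadget.  From lB on the weight is linear in the health and
-- vanishes when 2 + l exceeds the health by a l / 4, so that about a l / 12 moves are needed.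
module Build (wide : Bool) (b e Δ lB lT : ℕ) (a : ℕ → ℕ) (2≤Δ : 2 ≤ Δ)
  (be : b * wt wide ≡ 2 + e) (1≤b : 1 ≤ b) (1≤lB : 1 ≤ lB)
  (a≤ : ∀ l → lB ≤ l → a l ≤ 4 * (2 + l))
  (a-up   : ∀ l → lB ≤ l → suc l ≤ lT → b * a (suc l) + 12 ≤ b * a l + 4 * b)
  (a-down : ∀ l → lB ≤ l → suc l ≤ lT → b * a l ≤ b * a (suc l) + 12)
  (a-big  : ∀ l → lB ≤ l → l ≤ lT → 12 ≤ b * a l) where

  T : ℕ
  T = lT + Δ

  private w = wt wide

  w≤2 : w ≤ 2
  w≤2 = go wide
    where
    go : ∀ wd → wt wd ≤ 2
    go true  = ≤-refl
    go false = s≤s z≤n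

  w*dmg : w ≤ 1 ⊎ dmg wide ≡ 0
  w*dmg = go wide
    where
    go : ∀ wd → wt wd ≤ 1 ⊎ dmg wd ≡ 0
    go true  = inj₂ refl
    go false = inj₁ ≤-refl

  1≤w : 1 ≤ w
  1≤w = go wide
    where
    go : ∀ wd → 1 ≤ wt wd
    go true  = s≤s z≤n
    go false = s≤s z≤n

  -- `vC` is the level with two uncoloured edges at the centre, `vJ` the junction at `l = lB`, `vB`
  -- the zone between them, and `vA` the zone of linear weights above the junction.
  data View : ℕ → Set where
    v0 : View 0
    v1 : View 1
    v2 : ∀ t → 2 + t < Δ → View (2 + t)
    vC : ∀ {t} → t ≡ Δ → View t
    vB : ∀ {t} l → t ≡ suc l + Δ → suc l < lB → View t
    vJ : ∀ {t} → t ≡ lB + Δ → View t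
    vA : ∀ {t} l → t ≡ suc l + Δ → lB ≤ l → View t

  view : ∀ t → View t
  view 0 = v0
  view 1 = v1
  view (suc (suc t)) with <-cmp (2 + t) Δ
  ... | tri< lt _ _ = v2 t lt
  ... | tri≈ _ eq _ = vC eq
  ... | tri> _ _ gt with m≤n⇒∃[o]m+o≡n gt
  ...   | l , eq with <-cmp (suc l) lB
  ...     | tri< lt _ _ = vB l (trans (sym eq) (cong suc (+-comm Δ l))) lt
  ...     | tri≈ _ refl _ = vJ (trans (sym eq) (cong suc (+-comm Δ l)))
  ...     | tri> _ _ g = vA l (trans (sym eq) (cong suc (+-comm Δ l))) (≤-pred g)

  ωA : ℕ → ℕ → ℕ
  ωA l h = (a l + 4 * (h ⊓ (2 + l))) ∸ 4 * (2 + l)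

  ωV : ∀ {t} → View t → ℕ → ℕ
  ωV v0 h = 0
  -- At level 1 a gadget with a dirty pair is lost, and only health 2 counts.
  ωV v1 h = w * is2 h
  ωV (v2 t _) h = h ⊓ 2
  ωV (vC _) h = w * sg h
  ωV (vB l _ _) h = w * sg h
  ωV (vJ _) h = ωA lB h
  ωV (vA l _ _) h = ωA (suc l) h

  ηV : ∀ {t} → View t → ℕ
  -- An edge with both ends in the region costs 3 units of health of weight 4 each, and 12 = 2 · 6.
  ηV (vJ _) = 6
  ηV (vA _ _ _) = 6
  ηV _ = 1

  -- Above level 1 these ratios turn `gain` into an equality when the weight attains its upper
  -- bound. Only `vC` may be coarser, which costs a constant factor at a single level.
  pV qV : ∀ {t} → View t → ℕ
  pV v0 = 1
  pV v1 = 1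
  pV (v2 zero _) = e
  pV (v2 (suc _) _) = b ∸ 1
  pV (vC _) = e
  pV (vB _ _ _) = e
  pV (vJ _) = e
  pV (vA l _ _) = b * a l ∸ 12
  qV v0 = 1
  qV v1 = 1
  qV (v2 zero _) = 2 * b
  qV (v2 (suc _) _) = b
  qV (vC _) = 2 * b
  qV (vB _ _ _) = b * w
  qV (vJ _) = 4 * b * (2 + lB)
  qV (vA l _ _) = b * a (suc l)

  p q : ℕ → ℕ
  p t = pV (view t)
  q t = qV (view t)

  open Ratios p q T public

  W : ℕ → ℕ → ℕ
  W t h = Z t * ωV (view t) h

  H : ℕ → ℕ
  H t = ηV (view t) * Z t

  1≤2b : 1 ≤ 2 * b
  1≤2b = ≤-trans 1≤b (m≤m+n b _)

  qV≥1 : ∀ {t} (v : View t) → t ≤ T → 1 ≤ qV v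
  qV≥1 v0 _ = ≤-refl
  qV≥1 v1 _ = ≤-refl
  qV≥1 (v2 zero _) _ = 1≤2b
  qV≥1 (v2 (suc _) _) _ = 1≤b
  qV≥1 (vC _) _ = 1≤2b
  qV≥1 (vB _ _ _) _ = *-mono-≤ 1≤b 1≤w
  qV≥1 (vJ _) _ = *-mono-≤ (*-mono-≤ {1} {4} (s≤s z≤n) 1≤b) (s≤s z≤n)
  qV≥1 (vA l refl lB≤l) t≤ = ≤-trans (s≤s z≤n) (a-big (suc l) (m≤n⇒m≤1+n lB≤l) (+-cancelʳ-≤ Δ (suc l) lT t≤))

  4-tri : ∀ h l → a l ≤ 4 * (2 + l) → ωA l h ≤ 4 * (h ⊓ (2 + l))
  4-tri h l le = ≤-trans (∸-monoˡ-≤ (4 * (2 + l)) (+-monoˡ-≤ (4 * (h ⊓ (2 + l))) le))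
                         (≤-reflexive (m+n∸m≡n (4 * (2 + l)) _))

  ωA-loss : ∀ l h d → ωA l h ≤ ωA l (h ∸ d) + 4 * d
  ωA-loss l h d = begin
    (a l + 4 * (h ⊓ L)) ∸ 4 * L                    ≤⟨ ∸-monoˡ-≤ (4 * L) (+-monoʳ-≤ (a l) (*-monoʳ-≤ 4 cap)) ⟩
    (a l + 4 * ((h ∸ d) ⊓ L + d)) ∸ 4 * L          ≡⟨ cong (_∸ 4 * L) (arith (a l) ((h ∸ d) ⊓ L) d) ⟩
    ((a l + 4 * ((h ∸ d) ⊓ L)) + 4 * d) ∸ 4 * L    ≤⟨ +-∸≤ (a l + 4 * ((h ∸ d) ⊓ L)) (4 * d) (4 * L) ⟩
    ωA l (h ∸ d) + 4 * d ∎
    where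
    L = 2 + l
    arith : ∀ a x d → a + 4 * (x + d) ≡ a + 4 * x + 4 * d
    arith = solve-∀
    +-∸≤ : ∀ x y z → x + y ∸ z ≤ (x ∸ z) + y
    +-∸≤ x y z = m≤n+o⇒m∸n≤o (x + y) z (begin
      x + y             ≤⟨ +-monoˡ-≤ y (m≤n+m∸n x z) ⟩
      z + (x ∸ z) + y   ≡⟨ +-assoc z (x ∸ z) y ⟩
      z + ((x ∸ z) + y) ∎)
    cap : h ⊓ L ≤ (h ∸ d) ⊓ L + d
    cap with ≤-total (h ∸ d) L
    ... | inj₁ le rewrite m≤n⇒m⊓n≡m le = ≤-trans (m⊓n≤m h L) (≤-trans (m≤n+m∸n h d) (≤-reflexive (+-comm d _)))
    ... | inj₂ ge rewrite m≥n⇒m⊓n≡n ge = ≤-trans (m⊓n≤n h L) (m≤m+n L d)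

  sg≤1 : ∀ h → sg h ≤ 1
  sg≤1 zero = z≤n
  sg≤1 (suc _) = ≤-refl

  is2≤1 : ∀ h → is2 h ≤ 1
  is2≤1 0 = z≤n
  is2≤1 1 = z≤n
  is2≤1 2 = ≤-refl
  is2≤1 (suc (suc (suc _))) = z≤n

  w*≤ : ∀ {x} → x ≤ 1 → w * x ≤ w
  w*≤ le = ≤-trans (*-monoʳ-≤ w le) (≤-reflexive (*-identityʳ w))

  small : ∀ {f : ℕ → ℕ} → (∀ h → f h ≤ 1) → ∀ h → w * f h ≤ w * f (h ∸ dmg wide) + 1
  small f≤ h with w*dmg
  ... | inj₁ w≤1 = ≤-trans (≤-trans (w*≤ (f≤ h)) w≤1) (m≤n+m 1 _)
  ... | inj₂ eq rewrite eq = m≤m+n _ 1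

  dmg≤1 : dmg wide ≤ 1
  dmg≤1 = go wide
    where
    go : ∀ wd → dmg wd ≤ 1
    go true = z≤n
    go false = ≤-refl

  ⊓2-loss : ∀ h d → h ⊓ 2 ≤ (h ∸ d) ⊓ 2 + d
  ⊓2-loss h zero = m≤m+n _ 0
  ⊓2-loss zero (suc d) = z≤n
  ⊓2-loss (suc h) (suc d) = ≤-trans (⊓-mono-suc h) (≤-trans (s≤s (⊓2-loss h d)) (≤-reflexive (sym (+-suc _ d))))
    where
    ⊓-mono-suc : ∀ h → suc h ⊓ 2 ≤ suc (h ⊓ 2)
    ⊓-mono-suc h = s≤s (⊓-monoʳ-≤ h (s≤s z≤n))

  ω-both : ∀ {t} (v : View t) h → ωV v h ≤ ωV v (h ∸ 3) + 2 * ηV v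
  ω-both v0 h = z≤n
  ω-both v1 h = ≤-trans (w*≤ (is2≤1 h)) (≤-trans w≤2 (m≤n+m 2 _))
  ω-both (v2 t _) h = ≤-trans (m⊓n≤n h 2) (m≤n+m 2 _)
  ω-both (vC _) h = ≤-trans (w*≤ (sg≤1 h)) (≤-trans w≤2 (m≤n+m 2 _))
  ω-both (vB l _ _) h = ≤-trans (w*≤ (sg≤1 h)) (≤-trans w≤2 (m≤n+m 2 _))
  ω-both (vJ _) h = ωA-loss lB h 3
  ω-both (vA l _ _) h = ωA-loss (suc l) h 3

  ω-one : ∀ {t} (v : View t) h → ωV v h ≤ ωV v (h ∸ dmg wide) + ηV v
  ω-one v0 h = z≤n
  ω-one v1 h = small is2≤1 h
  ω-one (v2 t _) h = ≤-trans (⊓2-loss h (dmg wide)) (+-monoʳ-≤ _ dmg≤1)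
  ω-one (vC _) h = small sg≤1 h
  ω-one (vB l _ _) h = small sg≤1 h
  ω-one (vJ _) h = ≤-trans (ωA-loss lB h (dmg wide)) (+-monoʳ-≤ _ (≤-trans (*-monoʳ-≤ 4 dmg≤1) (m≤m+n 4 2)))
  ω-one (vA l _ _) h = ≤-trans (ωA-loss (suc l) h (dmg wide)) (+-monoʳ-≤ _ (≤-trans (*-monoʳ-≤ 4 dmg≤1) (m≤m+n 4 2)))

  ω-dead : ∀ {t} (v : View t) → ωV v 0 ≡ 0
  ω-dead v0 = refl
  ω-dead v1 = *-zeroʳ w
  ω-dead (v2 t _) = refl
  ω-dead (vC _) = *-zeroʳ w
  ω-dead (vB l _ _) = *-zeroʳ w
  ω-dead (vJ _) = n≤0⇒n≡0 (4-tri 0 lB (a≤ lB ≤-refl))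
  ω-dead (vA l _ lB≤l) = n≤0⇒n≡0 (4-tri 0 (suc l) (a≤ (suc l) (m≤n⇒m≤1+n lB≤l)))

  -- Reduces `gain` to an inequality between `p`, `q`, `ω` and `η` alone, since consecutive values
  -- of `Z` have the ratio `p / q`.
  scale : ∀ {p q Zs Z} ω ω′ η → q * Zs ≡ p * Z → 1 ≤ q → b * (p * ω) + 2 * (q * η) ≤ b * (q * ω′) →
    b * (Zs * ω) + 2 * (η * Z) ≤ b * (Z * ω′)
  scale {p} {q} {Zs} {Z} ω ω′ η r 1≤q h = *-cancelˡ-≤ q {{>-nonZero 1≤q}} (begin
    q * (b * (Zs * ω) + 2 * (η * Z))  ≡⟨ ar1 q b Zs ω η Z ⟩
    b * ω * (q * Zs) + 2 * (q * η) * Z ≡⟨ cong (λ x → b * ω * x + 2 * (q * η) * Z) r ⟩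
    b * ω * (p * Z) + 2 * (q * η) * Z  ≡⟨ ar2 b ω p Z q η ⟩
    (b * (p * ω) + 2 * (q * η)) * Z   ≤⟨ *-monoˡ-≤ Z h ⟩
    b * (q * ω′) * Z                  ≡⟨ ar3 b q ω′ Z ⟩
    q * (b * (Z * ω′))                ∎)
    where
    ar1 : ∀ q b Zs ω η Z → q * (b * (Zs * ω) + 2 * (η * Z)) ≡ b * ω * (q * Zs) + 2 * (q * η) * Z
    ar1 = solve-∀
    ar2 : ∀ b ω p Z q η → b * ω * (p * Z) + 2 * (q * η) * Z ≡ (b * (p * ω) + 2 * (q * η)) * Z
    ar2 = solve-∀
    ar3 : ∀ b q ω′ Z → b * (q * ω′) * Z ≡ q * (b * (Z * ω′))
    ar3 = solve-∀

  scaleη : ∀ {p q Zs Z} η η′ → q * Zs ≡ p * Z → 1 ≤ q → p * η ≤ q * η′ → η * Zs ≤ η′ * Z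
  scaleη {p} {q} {Zs} {Z} η η′ r 1≤q h = *-cancelˡ-≤ q {{>-nonZero 1≤q}} (begin
    q * (η * Zs)  ≡⟨ ar q η Zs ⟩
    (q * Zs) * η  ≡⟨ cong (_* η) r ⟩
    (p * Z) * η   ≡⟨ ar′ p Z η ⟩
    (p * η) * Z   ≤⟨ *-monoˡ-≤ Z h ⟩
    (q * η′) * Z  ≡⟨ *-assoc q η′ Z ⟩
    q * (η′ * Z)  ∎)
    where
    ar : ∀ q η Zs → q * (η * Zs) ≡ (q * Zs) * η
    ar = solve-∀
    ar′ : ∀ p Z η → (p * Z) * η ≡ (p * η) * Z
    ar′ = solve-∀

  e≤2b : e ≤ 2 * b
  e≤2b = begin
    e         ≤⟨ m≤n+m e 2 ⟩
    2 + e     ≡⟨ sym be ⟩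
    b * w     ≤⟨ *-monoʳ-≤ b w≤2 ⟩
    b * 2     ≡⟨ *-comm b 2 ⟩
    2 * b     ∎

  e≤bw : e ≤ b * w
  e≤bw = ≤-trans (m≤n+m e 2) (≤-reflexive (sym be))

  1*≤ : ∀ {x y z} → x ≤ y → 1 ≤ z → x * 1 ≤ y * z
  1*≤ = *-mono-≤

  η≥1 : ∀ {t} (v : View t) → 1 ≤ ηV v
  η≥1 v0 = ≤-refl
  η≥1 v1 = ≤-refl
  η≥1 (v2 t _) = ≤-refl
  η≥1 (vC _) = ≤-refl
  η≥1 (vB l _ _) = ≤-refl
  η≥1 (vJ _) = s≤s z≤n
  η≥1 (vA l _ _) = s≤s z≤n

  ηV-high : ∀ {t} (v : View t) → lB + Δ ≤ t → ηV v ≡ 6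
  ηV-high v0 le = ⊥-elim (<-irrefl refl (≤-trans (≤-trans 1≤lB (m≤m+n lB Δ)) le))
  ηV-high v1 le = ⊥-elim (<-irrefl refl (≤-trans (+-mono-≤ {0} {lB} z≤n 2≤Δ) le))
  ηV-high (v2 t lt) le = ⊥-elim (<-irrefl refl (<-≤-trans lt (≤-trans (m≤n+m Δ lB) le)))
  ηV-high (vC refl) le = ⊥-elim (<-irrefl refl (≤-trans (+-monoˡ-≤ Δ 1≤lB) le))
  ηV-high (vB l refl lt) le = ⊥-elim (<-irrefl refl (<-≤-trans lt (+-cancelʳ-≤ Δ lB (suc l) le)))
  ηV-high (vJ _) le = refl
  ηV-high (vA l _ _) le = refl

  η-mono : ∀ {t} (vs : View (suc t)) (v : View t) → suc t ≤ T → pV vs * ηV vs ≤ qV vs * ηV v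
  η-mono v1 v t≤ = 1*≤ (≤-refl {1}) (η≥1 v)
  η-mono (v2 zero _) v t≤ = 1*≤ e≤2b (η≥1 v)
  η-mono (v2 (suc _) _) v t≤ = 1*≤ (m∸n≤m b 1) (η≥1 v)
  η-mono (vC _) v t≤ = 1*≤ e≤2b (η≥1 v)
  η-mono (vB l _ _) v t≤ = 1*≤ e≤bw (η≥1 v)
  η-mono (vJ _) v t≤ = begin
    e * 6                ≤⟨ *-monoˡ-≤ 6 e≤2b ⟩
    2 * b * 6            ≡⟨ ar b ⟩
    4 * b * 3            ≤⟨ *-monoʳ-≤ (4 * b) (+-monoʳ-≤ 2 1≤lB) ⟩
    4 * b * (2 + lB)     ≡⟨ sym (*-identityʳ _) ⟩
    4 * b * (2 + lB) * 1 ≤⟨ *-monoʳ-≤ (4 * b * (2 + lB)) (η≥1 v) ⟩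
    4 * b * (2 + lB) * ηV v ∎
    where
    ar : ∀ b → 2 * b * 6 ≡ 4 * b * 3
    ar = solve-∀
  η-mono (vA l eq lB≤l) v t≤ rewrite ηV-high v (subst (lB + Δ ≤_) (sym (suc-injective eq)) (+-monoˡ-≤ Δ lB≤l)) =
    *-monoˡ-≤ 6 (m≤n+o⇒m∸n≤o (b * a l) 12 (≤-trans (a-down l lB≤l sl≤) (≤-reflexive (+-comm _ 12))))
    where
    sl≤ : suc l ≤ lT
    sl≤ = +-cancelʳ-≤ Δ (suc l) lT (subst (_≤ T) eq t≤)

  sg1 : ∀ {x} → 1 ≤ x → sg x ≡ 1
  sg1 (s≤s _) = refl

  pos-sg : ∀ h → 0 < w * sg h → 1 ≤ h
  pos-sg zero lt = ⊥-elim (<-irrefl (sym (*-zeroʳ w)) lt)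
  pos-sg (suc _) _ = s≤s z≤n

  pos-A : ∀ l h → lB ≤ l → 0 < ωA l h → 1 ≤ h
  pos-A l zero lB≤l lt = ⊥-elim (<-irrefl refl (≤-trans lt (4-tri 0 l (a≤ l lB≤l))))
  pos-A l (suc _) _ _ = s≤s z≤n

  gain-B : ∀ x → x ≤ 1 → b * (e * (w * x)) + 2 * (b * w * 1) ≤ b * (b * w * w)
  gain-B x x≤1 = begin
    b * (e * (w * x)) + 2 * (b * w * 1) ≤⟨ +-monoˡ-≤ _ (*-monoʳ-≤ b (*-monoʳ-≤ e (w*≤ x≤1))) ⟩
    b * (e * w) + 2 * (b * w * 1)       ≡⟨ ar b e w ⟩
    b * ((2 + e) * w)                   ≡⟨ cong (λ z → b * (z * w)) (sym be) ⟩
    b * (b * w * w)                     ∎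
    where
    ar : ∀ b e w → b * (e * w) + 2 * (b * w * 1) ≡ b * ((2 + e) * w)
    ar = solve-∀

  gain-low : ∀ x → x ≤ 2 → b * (e * x) + 2 * (2 * b * 1) ≤ b * (2 * b * w)
  gain-low x x≤2 = begin
    b * (e * x) + 2 * (2 * b * 1) ≤⟨ +-monoˡ-≤ _ (*-monoʳ-≤ b (*-monoʳ-≤ e x≤2)) ⟩
    b * (e * 2) + 2 * (2 * b * 1) ≡⟨ ar b e ⟩
    2 * b * (2 + e)               ≡⟨ cong (2 * b *_) (sym be) ⟩
    2 * b * (b * w)               ≡⟨ ar′ b w ⟩
    b * (2 * b * w)               ∎
    where
    ar : ∀ b e → b * (e * 2) + 2 * (2 * b * 1) ≡ 2 * b * (2 + e)
    ar = solve-∀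
    ar′ : ∀ b w → 2 * b * (b * w) ≡ b * (2 * b * w)
    ar′ = solve-∀

  gain-2 : ∀ x → x ≤ 2 → b * ((b ∸ 1) * x) + 2 * (b * 1) ≤ b * (b * 2)
  gain-2 x x≤2 = begin
    b * ((b ∸ 1) * x) + 2 * (b * 1) ≤⟨ +-monoˡ-≤ _ (*-monoʳ-≤ b (*-monoʳ-≤ (b ∸ 1) x≤2)) ⟩
    b * ((b ∸ 1) * 2) + 2 * (b * 1) ≡⟨ ar b (b ∸ 1) ⟩
    b * (((b ∸ 1) + 1) * 2)         ≡⟨ cong (λ z → b * (z * 2)) (m∸n+n≡m 1≤b) ⟩
    b * (b * 2)                     ∎
    where
    ar : ∀ b c → b * (c * 2) + 2 * (b * 1) ≡ b * ((c + 1) * 2)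
    ar = solve-∀

  gain-J : ∀ h → b * (e * ωA lB h) + 2 * (4 * b * (2 + lB) * 1) ≤ b * (4 * b * (2 + lB) * w)
  gain-J h = begin
    b * (e * ωA lB h) + 2 * (4 * b * L * 1) ≤⟨ +-monoˡ-≤ _ (*-monoʳ-≤ b (*-monoʳ-≤ e cap)) ⟩
    b * (e * (4 * L)) + 2 * (4 * b * L * 1) ≡⟨ ar b e L ⟩
    4 * b * L * (2 + e)                     ≡⟨ cong (4 * b * L *_) (sym be) ⟩
    4 * b * L * (b * w)                     ≡⟨ ar′ b L w ⟩
    b * (4 * b * L * w)                     ∎
    where
    L = 2 + lB
    cap : ωA lB h ≤ 4 * L
    cap = ≤-trans (4-tri h lB (a≤ lB ≤-refl)) (*-monoʳ-≤ 4 (m⊓n≤n h L))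
    ar : ∀ b e L → b * (e * (4 * L)) + 2 * (4 * b * L * 1) ≡ 4 * b * L * (2 + e)
    ar = solve-∀
    ar′ : ∀ b L w → 4 * b * L * (b * w) ≡ b * (4 * b * L * w)
    ar′ = solve-∀

  -- At full health the weights are `a (suc l)` and `a l`, and `p` is made for equality. Otherwise
  -- the step reduces the deficit of the health against its cap by one, which is worth 4: by `a-up`
  -- the change of `a` leaves at least 12 / b of this, and by `a-down` the ratio `p / q` is at most
  -- 1.
  gain-A : ∀ l h → lB ≤ l → suc l ≤ lT → 0 < ωA (suc l) h →
    b * ((b * a l ∸ 12) * ωA (suc l) h) + 2 * (b * a (suc l) * 6) ≤ b * (b * a (suc l) * ωA l (h ⊓ (2 + l)))
  gain-A l h lB≤l sl≤ pos = begin
    b * (P * x) + 2 * (b * a′ * 6)   ≡⟨ ar b P x a′ ⟩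
    b * (P * x + 12 * a′)            ≤⟨ *-monoʳ-≤ b core ⟩
    b * (b * a′ * y)                 ∎
    where
    L = 2 + l
    a₀ = a l
    a′ = a (suc l)
    P = b * a₀ ∸ 12
    x = ωA (suc l) h
    y = ωA l (h ⊓ L)
    ar : ∀ b P x a′ → b * (P * x) + 2 * (b * a′ * 6) ≡ b * (P * x + 12 * a′)
    ar = solve-∀
    ba≥ : 12 ≤ b * a₀
    ba≥ = a-big l lB≤l (<⇒≤ sl≤)
    core : P * x + 12 * a′ ≤ b * a′ * y
    core with h ≤? L
    ... | no h≰ = begin
      P * x + 12 * a′       ≡⟨ cong (λ z → P * z + 12 * a′) x≡ ⟩
      P * a′ + 12 * a′      ≡⟨ sym (*-distribʳ-+ a′ P 12) ⟩
      (P + 12) * a′         ≡⟨ cong (_* a′) (m∸n+n≡m ba≥) ⟩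
      b * a₀ * a′           ≡⟨ sw b a₀ a′ ⟩
      b * a′ * a₀           ≡⟨ cong (b * a′ *_) (sym y≡) ⟩
      b * a′ * y            ∎
      where
      sw : ∀ b a a′ → b * a * a′ ≡ b * a′ * a
      sw = solve-∀
      x≡ : x ≡ a′
      x≡ = trans (cong (λ m → (a′ + 4 * m) ∸ 4 * suc L) (m≥n⇒m⊓n≡n (≰⇒> h≰))) (m+n∸n≡m a′ (4 * suc L))
      y≡ : y ≡ a₀
      y≡ = trans (cong (λ m → (a₀ + 4 * m) ∸ 4 * L)
             (trans (cong (_⊓ L) (m≥n⇒m⊓n≡n (<⇒≤ (≰⇒> h≰)))) (⊓-idem L))) (m+n∸n≡m a₀ (4 * L))
    ... | yes h≤ = begin
      P * x + 12 * a′             ≤⟨ +-monoˡ-≤ (12 * a′) (*-monoˡ-≤ x P≤) ⟩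
      b * a′ * x + 12 * a′        ≡⟨ ar2 b a′ x ⟩
      a′ * (b * x + 12)           ≤⟨ *-monoʳ-≤ a′ bx≤by ⟩
      a′ * (b * y)                ≡⟨ ar3 a′ b y ⟩
      b * a′ * y                  ∎
      where
      ar2 : ∀ b a x → b * a * x + 12 * a ≡ a * (b * x + 12)
      ar2 = solve-∀
      ar3 : ∀ a b y → a * (b * y) ≡ b * a * y
      ar3 = solve-∀
      P≤ : P ≤ b * a′
      P≤ = m≤n+o⇒m∸n≤o (b * a₀) 12 (≤-trans (a-down l lB≤l sl≤) (≤-reflexive (+-comm _ 12)))
      xdef : x ≡ (a′ + 4 * h) ∸ 4 * suc L
      xdef = cong (λ m → (a′ + 4 * m) ∸ 4 * suc L) (m≤n⇒m⊓n≡m (m≤n⇒m≤1+n h≤))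
      ydef : y ≡ (a₀ + 4 * h) ∸ 4 * L
      ydef = cong (λ m → (a₀ + 4 * m) ∸ 4 * L) (trans (cong (_⊓ L) (m≤n⇒m⊓n≡m h≤)) (m≤n⇒m⊓n≡m h≤))
      x+ : x + 4 * suc L ≡ a′ + 4 * h
      x+ = trans (cong (_+ 4 * suc L) xdef) (m∸n+n≡m (<⇒≤ (0<m∸o (a′ + 4 * h) (4 * suc L) (subst (0 <_) xdef pos))))
        where
        0<m∸o : ∀ m o → 0 < m ∸ o → o < m
        0<m∸o m o lt = ≰⇒> (λ m≤o → <-irrefl (sym (m≤n⇒m∸n≡0 m≤o)) lt)
      bx≤by : b * x + 12 ≤ b * y
      bx≤by = +-cancelʳ-≤ (b * (4 * L)) _ _ (+-cancelʳ-≤ (4 * b) _ _ (begin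
        b * x + 12 + b * (4 * L) + 4 * b    ≡⟨ e1 b x L ⟩
        b * (x + 4 * suc L) + 12            ≡⟨ cong (λ z → b * z + 12) x+ ⟩
        b * (a′ + 4 * h) + 12               ≡⟨ e2 b a′ h ⟩
        (b * a′ + 12) + b * (4 * h)         ≤⟨ +-monoˡ-≤ (b * (4 * h)) (a-up l lB≤l sl≤) ⟩
        (b * a₀ + 4 * b) + b * (4 * h)      ≡⟨ e3 b a₀ h ⟩
        b * (a₀ + 4 * h) + 4 * b            ≤⟨ +-monoˡ-≤ (4 * b) (*-monoʳ-≤ b (m≤n+m∸n (a₀ + 4 * h) (4 * L))) ⟩
        b * (4 * L + ((a₀ + 4 * h) ∸ 4 * L)) + 4 * b ≡⟨ cong (λ z → b * (4 * L + z) + 4 * b) (sym ydef) ⟩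
        b * (4 * L + y) + 4 * b             ≡⟨ e4 b L y ⟩
        b * y + b * (4 * L) + 4 * b         ∎))
        where
        e1 : ∀ b x L → b * x + 12 + b * (4 * L) + 4 * b ≡ b * (x + 4 * suc L) + 12
        e1 = solve-∀
        e2 : ∀ b a h → b * (a + 4 * h) + 12 ≡ (b * a + 12) + b * (4 * h)
        e2 = solve-∀
        e3 : ∀ b a h → (b * a + 4 * b) + b * (4 * h) ≡ b * (a + 4 * h) + 4 * b
        e3 = solve-∀
        e4 : ∀ b L y → b * (4 * L + y) + 4 * b ≡ b * y + b * (4 * L) + 4 * b
        e4 = solve-∀

  not-below : ∀ {t} l → t ≡ l + Δ → ¬ t < Δ
  not-below l refl lt = <-irrefl refl (≤-trans lt (m≤n+m Δ l))

  w≤ωV-below : ∀ {t} (v : View t) → 1 ≤ t → t < Δ → w ≤ ωV v 2 × ηV v ≡ 1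
  w≤ωV-below v1 _ _ = ≤-reflexive (sym (*-identityʳ w)) , refl
  w≤ωV-below (v2 t _) _ _ = w≤2 , refl
  w≤ωV-below (vC eq) _ lt = ⊥-elim (not-below 0 eq lt)
  w≤ωV-below (vB l eq _) _ lt = ⊥-elim (not-below (suc l) eq lt)
  w≤ωV-below (vJ eq) _ lt = ⊥-elim (not-below lB eq lt)
  w≤ωV-below (vA l eq _) _ lt = ⊥-elim (not-below (suc l) eq lt)

  ωV-zoneB : ∀ {t} (v : View t) l → t ≡ l + Δ → l < lB → ∀ h → ωV v h ≡ w * sg h × ηV v ≡ 1
  ωV-zoneB v0 l eq _ h = ⊥-elim (<-irrefl eq (≤-trans (s≤s z≤n) (≤-trans 2≤Δ (m≤n+m Δ l))))
  ωV-zoneB v1 l eq _ h = ⊥-elim (<-irrefl eq (≤-trans 2≤Δ (m≤n+m Δ l)))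
  ωV-zoneB (v2 t lt) l eq _ h = ⊥-elim (<-irrefl eq (≤-trans lt (m≤n+m Δ l)))
  ωV-zoneB (vC _) l eq _ h = refl , refl
  ωV-zoneB (vB _ _ _) l eq _ h = refl , refl
  ωV-zoneB (vJ e′) l eq lt h = ⊥-elim (<-irrefl (+-cancelʳ-≡ Δ l lB (trans (sym eq) e′)) lt)
  ωV-zoneB (vA l′ e′ le) l eq lt h =
    ⊥-elim (<-irrefl refl (<-≤-trans lt (≤-trans (m≤n⇒m≤1+n le) (≤-reflexive (+-cancelʳ-≡ Δ (suc l′) l (trans (sym e′) eq))))))

  ωV-zoneA : ∀ {t} (v : View t) l → t ≡ l + Δ → lB ≤ l → ∀ h → ωV v h ≡ ωA l h
  ωV-zoneA v0 l eq _ h = ⊥-elim (<-irrefl eq (≤-trans (s≤s z≤n) (≤-trans 2≤Δ (m≤n+m Δ l))))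
  ωV-zoneA v1 l eq _ h = ⊥-elim (<-irrefl eq (≤-trans 2≤Δ (m≤n+m Δ l)))
  ωV-zoneA (v2 t lt) l eq _ h = ⊥-elim (<-irrefl eq (≤-trans lt (m≤n+m Δ l)))
  ωV-zoneA (vC e′) l eq le h = ⊥-elim (<-irrefl (+-cancelʳ-≡ Δ 0 l (trans (sym e′) eq)) (≤-trans 1≤lB le))
  ωV-zoneA (vB l′ e′ lt) l eq le h =
    ⊥-elim (<-irrefl (+-cancelʳ-≡ Δ (suc l′) l (trans (sym e′) eq)) (<-≤-trans lt le))
  ωV-zoneA (vJ e′) l eq le h = cong (λ i → ωA i h) (+-cancelʳ-≡ Δ lB l (trans (sym e′) eq))
  ωV-zoneA (vA l′ e′ _) l eq le h = cong (λ i → ωA i h) (+-cancelʳ-≡ Δ (suc l′) l (trans (sym e′) eq))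

  gainV : ∀ {t h h′} (vs : View (suc t)) (v : View t) → 1 ≤ t → suc t ≤ T → Next Δ t h h′ → 0 < ωV vs h →
    b * (pV vs * ωV vs h) + 2 * (qV vs * ηV v) ≤ b * (qV vs * ωV v h′)
  gainV v1 v () _ _ _
  gainV {h = h} (v2 zero lt) v 1≤t t≤ (below _) pos with w≤ωV-below v 1≤t (<⇒≤ lt)
  ... | w≤ , η≡ rewrite η≡ = ≤-trans (gain-low (h ⊓ 2) (m⊓n≤n h 2)) (*-monoʳ-≤ b (*-monoʳ-≤ (2 * b) w≤))
  gainV {h = h} (v2 (suc t) lt) (v2 _ _) 1≤t t≤ (below _) pos = gain-2 (h ⊓ 2) (m⊓n≤n h 2)
  gainV (v2 (suc t) lt) (vC eq) 1≤t t≤ (below lt′) pos = ⊥-elim (not-below 0 eq lt′)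
  gainV (v2 (suc t) lt) (vB l eq _) 1≤t t≤ (below lt′) pos = ⊥-elim (not-below (suc l) eq lt′)
  gainV (v2 (suc t) lt) (vJ eq) 1≤t t≤ (below lt′) pos = ⊥-elim (not-below lB eq lt′)
  gainV (v2 (suc t) lt) (vA l eq _) 1≤t t≤ (below lt′) pos = ⊥-elim (not-below (suc l) eq lt′)
  gainV (v2 t lt) v 1≤t t≤ (above l eq) pos =
    ⊥-elim (<-irrefl refl (<-≤-trans lt (≤-trans (m≤n+m Δ l) (≤-trans (≤-reflexive (sym eq)) (n≤1+n _)))))
  gainV {h = h} (vC eq) v 1≤t t≤ (below lt) pos with w≤ωV-below v 1≤t lt
  ... | w≤ , η≡ rewrite η≡ = ≤-trans (gain-low (w * sg h) (≤-trans (w*≤ (sg≤1 h)) w≤2)) (*-monoʳ-≤ b (*-monoʳ-≤ (2 * b) w≤))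
  gainV (vC eq) v 1≤t t≤ (above l eq′) pos =
    ⊥-elim (<-irrefl refl (≤-trans (m≤n+m (suc Δ) l) (≤-reflexive (trans (+-suc l Δ) (trans (cong suc (sym eq′)) eq)))))
  gainV (vB l eq _) v 1≤t t≤ (below lt) pos = ⊥-elim (not-below l (suc-injective eq) lt)
  gainV {h = h} (vB l eq lt) v 1≤t t≤ (above l′ eq′) pos
    with ωV-zoneB v l (suc-injective eq) (<⇒≤ lt) (h ⊓ (2 + l′))
  ... | ω≡ , η≡ rewrite ω≡ | η≡ | sg1 (⊓-glb (pos-sg h pos) (s≤s {0} {suc l′} z≤n)) | *-identityʳ w =
    gain-B (sg h) (sg≤1 h)
  gainV (vJ eq) v 1≤t t≤ (below lt) pos =
    ⊥-elim (<-irrefl refl (≤-trans (+-monoˡ-≤ Δ 1≤lB) (≤-trans (≤-reflexive (sym eq)) lt)))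
  gainV {t} {h} (vJ eq) v 1≤t t≤ (above l′ eq′) pos
    with ωV-zoneB v l′ eq′ (≤-reflexive (+-cancelʳ-≡ Δ (suc l′) lB (trans (cong suc (sym eq′)) eq))) (h ⊓ (2 + l′))
  ... | ω≡ , η≡ rewrite ω≡ | η≡ | sg1 (⊓-glb (pos-A lB h ≤-refl pos) (s≤s {0} {suc l′} z≤n)) | *-identityʳ w = gain-J h
  gainV (vA l eq _) v 1≤t t≤ (below lt) pos = ⊥-elim (not-below l (suc-injective eq) lt)
  gainV {h = h} (vA l eq le) v 1≤t t≤ (above l′ eq′) pos
    rewrite ηV-high v (subst (lB + Δ ≤_) (sym (suc-injective eq)) (+-monoˡ-≤ Δ le))
          | ωV-zoneA v l (suc-injective eq) le (h ⊓ (2 + l′))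
          | +-cancelʳ-≡ Δ l′ l (trans (sym eq′) (suc-injective eq)) =
    gain-A l h le (+-cancelʳ-≤ Δ (suc l) lT (subst (_≤ T) eq t≤)) pos

  weights : Weights wide b Δ T
  weights = record
    { W = W ; H = H
    ; W-0 = λ h → *-zeroʳ (Z 0)
    ; W-dead = λ t → trans (cong (Z t *_) (ω-dead (view t))) (*-zeroʳ (Z t))
    ; W-1-1 = trans (cong (Z 1 *_) (*-zeroʳ w)) (*-zeroʳ (Z 1))
    ; H-mono = λ t t≤ → scaleη {p (suc t)} {q (suc t)} _ _ (Z-ratio t t≤) (qV≥1 (view (suc t)) t≤) (η-mono (view (suc t)) (view t) t≤)
    ; lossBoth = λ t h → ≤-trans (*-monoʳ-≤ (Z t) (ω-both (view t) h)) (≤-reflexive (ar (Z t) _ (ηV (view t))))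
    ; lossOne = λ t h → ≤-trans (*-monoʳ-≤ (Z t) (ω-one (view t) h)) (≤-reflexive (ar′ (Z t) _ (ηV (view t))))
    ; gain = λ {t} {h} {h′} 1≤t t≤ nx pos →
        scale {p (suc t)} {q (suc t)} _ _ (ηV (view t)) (Z-ratio t t≤) (qV≥1 (view (suc t)) t≤)
          (gainV (view (suc t)) (view t) 1≤t t≤ nx (pos-right (Z (suc t)) _ pos))
    }
    where
    ar : ∀ z x η → z * (x + 2 * η) ≡ z * x + 2 * (η * z)
    ar = solve-∀
    ar′ : ∀ z x η → z * (x + η) ≡ z * x + η * z
    ar′ = solve-∀
    pos-right : ∀ x y → 0 < x * y → 0 < y
    pos-right x zero lt = ⊥-elim (<-irrefl (sym (*-zeroʳ x)) lt)
    pos-right x (suc y) _ = s≤s z≤n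

  -- In this and the following lemmas `Q * A ≤ P * B` stands for A / B ≤ P / Q. Such bounds for
  -- `prod p / prod q` are multiplied up zone by zone.
  mul-step : ∀ {P Q A B : ℕ} p q x y → Q * A ≤ P * B → q * x ≤ p * y → Q * q * (A * x) ≤ P * p * (B * y)
  mul-step {P} {Q} {A} {B} p q x y h h′ = begin
    Q * q * (A * x)   ≡⟨ ar Q q A x ⟩
    Q * A * (q * x)   ≤⟨ *-mono-≤ h h′ ⟩
    P * B * (p * y)   ≡⟨ ar P B p y ⟩
    P * p * (B * y)   ∎
    where
    ar : ∀ a b c d → a * b * (c * d) ≡ a * c * (b * d)
    ar = solve-∀

  ratio-2 : ∀ {t} (v : View t) → t ≡ 2 → t ≤ Δ → qV v * e ≤ pV v * (2 * b)
  ratio-2 (v2 zero _) eq _ = ≤-reflexive (*-comm (2 * b) e)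
  ratio-2 (vC _) eq _ = ≤-reflexive (*-comm (2 * b) e)
  ratio-2 (vB l refl _) eq le = ⊥-elim (m+1+n≰m Δ {l} (≤-trans (≤-reflexive (+-comm Δ (suc l))) le))
  ratio-2 (vJ refl) eq le = ⊥-elim (<-irrefl refl (≤-trans (+-monoˡ-≤ Δ 1≤lB) le))
  ratio-2 (vA l refl _) eq le = ⊥-elim (m+1+n≰m Δ {l} (≤-trans (≤-reflexive (+-comm Δ (suc l))) le))

  ratio-mid : ∀ {t} (v : View t) → 3 ≤ t → t < Δ → qV v * (b ∸ 1) ≤ pV v * b
  ratio-mid v1 (s≤s ()) _
  ratio-mid (v2 zero _) (s≤s (s≤s ())) _
  ratio-mid (v2 (suc t) _) _ _ = ≤-reflexive (*-comm b (b ∸ 1))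
  ratio-mid (vC eq) _ lt = ⊥-elim (not-below 0 eq lt)
  ratio-mid (vB l eq _) _ lt = ⊥-elim (not-below (suc l) eq lt)
  ratio-mid (vJ eq) _ lt = ⊥-elim (not-below lB eq lt)
  ratio-mid (vA l eq _) _ lt = ⊥-elim (not-below (suc l) eq lt)

  ratio-C : ∀ {t} (v : View t) → t ≡ Δ → qV v * e ≤ pV v * (2 * b)
  ratio-C v0 eq = ⊥-elim (<-irrefl eq (≤-trans (s≤s z≤n) 2≤Δ))
  ratio-C v1 eq = ⊥-elim (<-irrefl eq 2≤Δ)
  ratio-C (v2 t lt) eq = ⊥-elim (<-irrefl eq lt)
  ratio-C (vC _) eq = ≤-reflexive (*-comm (2 * b) e)
  ratio-C (vB l e′ _) eq = ⊥-elim (m≢1+n+m Δ {l} (trans (sym eq) e′))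
  ratio-C (vJ e′) eq = ⊥-elim (<-irrefl (trans (sym eq) e′) (+-monoˡ-≤ Δ 1≤lB))
  ratio-C (vA l e′ _) eq = ⊥-elim (m≢1+n+m Δ {l} (trans (sym eq) e′))

  zone-B : ∀ {t} (v : View t) l → t ≡ suc l + Δ → suc l < lB → qV v * e ≤ pV v * (b * w)
  zone-B v0 l () _
  zone-B v1 l eq _ = ⊥-elim (<-irrefl (suc-injective eq) (≤-trans (s≤s z≤n) (≤-trans 2≤Δ (m≤n+m Δ l))))
  zone-B (v2 t lt) l eq _ = ⊥-elim (not-below (suc l) eq lt)
  zone-B (vC e′) l eq _ = ⊥-elim (m≢1+n+m Δ {l} (trans (sym e′) eq))
  zone-B (vB _ _ _) l eq _ = ≤-reflexive (*-comm (b * w) e)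
  zone-B (vJ e′) l eq lt = ⊥-elim (<-irrefl (+-cancelʳ-≡ Δ (suc l) lB (trans (sym eq) e′)) lt)
  zone-B (vA l′ e′ le) l eq lt =
    ⊥-elim (<-irrefl refl (<-≤-trans lt (≤-trans (m≤n⇒m≤1+n le) (≤-reflexive (+-cancelʳ-≡ Δ (suc l′) (suc l) (trans (sym e′) eq))))))

  zone-J : ∀ {t} (v : View t) → t ≡ lB + Δ → qV v * e ≤ pV v * (4 * b * (2 + lB))
  zone-J v0 eq = ⊥-elim (<-irrefl eq (≤-trans 1≤lB (m≤m+n lB Δ)))
  zone-J v1 eq = ⊥-elim (<-irrefl eq (≤-trans 2≤Δ (m≤n+m Δ lB)))
  zone-J (v2 t lt) eq = ⊥-elim (not-below lB eq lt)
  zone-J (vC e′) eq = ⊥-elim (<-irrefl (trans (sym e′) eq) (+-monoˡ-≤ Δ 1≤lB))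
  zone-J (vB l e′ lt) eq = ⊥-elim (<-irrefl (+-cancelʳ-≡ Δ (suc l) lB (trans (sym e′) eq)) lt)
  zone-J (vJ _) eq = ≤-reflexive (*-comm (4 * b * (2 + lB)) e)
  zone-J (vA l e′ le) eq = ⊥-elim (<-irrefl (sym (+-cancelʳ-≡ Δ (suc l) lB (trans (sym e′) eq))) (s≤s le))

  zone-A : ∀ {t} (v : View t) l → t ≡ suc l + Δ → lB ≤ l → qV v ≡ b * a (suc l) × pV v ≡ b * a l ∸ 12
  zone-A v0 l () _
  zone-A v1 l eq _ = ⊥-elim (<-irrefl (suc-injective eq) (≤-trans (s≤s z≤n) (≤-trans 2≤Δ (m≤n+m Δ l))))
  zone-A (v2 t lt) l eq _ = ⊥-elim (not-below (suc l) eq lt)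
  zone-A (vC e′) l eq _ = ⊥-elim (m≢1+n+m Δ {l} (trans (sym e′) eq))
  zone-A (vB l′ e′ lt) l eq le =
    ⊥-elim (<-irrefl (+-cancelʳ-≡ Δ (suc l′) (suc l) (trans (sym e′) eq)) (<-≤-trans lt (m≤n⇒m≤1+n le)))
  zone-A (vJ e′) l eq le = ⊥-elim (<-irrefl (+-cancelʳ-≡ Δ lB (suc l) (trans (sym e′) eq)) (s≤s le))
  zone-A (vA l′ e′ _) l eq le with refl ← +-cancelʳ-≡ Δ l′ l (suc-injective (trans (sym e′) eq)) = refl , refl

  private
    A₂ = e * e * (b ∸ 1) ^ Δ
    B₂ = 2 * b * (2 * b) * b ^ Δ
    A₄ = A₂ * e ^ pred lB * e
    B₄ = B₂ * (b * w) ^ pred lB * (4 * b * (2 + lB))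

  snoc : ∀ A x t → A * x ^ suc t ≡ A * x ^ t * x
  snoc A x t = trans (cong (A *_) (*-comm x (x ^ t))) (sym (*-assoc A (x ^ t) x))

  pow-step : ∀ {P Q A B : ℕ} p q x y t → Q * (A * x ^ t) ≤ P * (B * y ^ t) → q * x ≤ p * y →
    Q * q * (A * x ^ suc t) ≤ P * p * (B * y ^ suc t)
  pow-step {P} {Q} {A} {B} p q x y t h h′ rewrite snoc A x t | snoc B y t =
    mul-step {P} {Q} {A * x ^ t} {B * y ^ t} p q x y h h′

  pad : ∀ {P Q A B : ℕ} {x y} → Q * A ≤ P * B → x ≤ y → Q * (A * x) ≤ P * (B * y)
  pad {P} {Q} {A} {B} {x} {y} h h′ = begin
    Q * (A * x) ≡⟨ sym (*-assoc Q A x) ⟩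
    Q * A * x   ≤⟨ *-mono-≤ h h′ ⟩
    P * B * y   ≡⟨ *-assoc P B y ⟩
    P * (B * y) ∎

  prod-low : ∀ t → 2 + t < Δ → prod q (2 + t) * (e * (b ∸ 1) ^ t) ≤ prod p (2 + t) * (2 * b * b ^ t)
  prod-low zero lt = pad {prod p 2} {prod q 2} {e} {2 * b} {1} {1} (begin
    1 * q 2 * e       ≡⟨ cong (_* e) (*-identityˡ (q 2)) ⟩
    q 2 * e           ≤⟨ ratio-2 (view 2) refl (<⇒≤ lt) ⟩
    p 2 * (2 * b)     ≡⟨ cong (_* (2 * b)) (sym (*-identityˡ (p 2))) ⟩
    1 * p 2 * (2 * b) ∎) ≤-refl
  prod-low (suc t) lt = pow-step {prod p (2 + t)} {prod q (2 + t)} {e} {2 * b} (p (3 + t)) (q (3 + t)) (b ∸ 1) b t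
    (prod-low t (<⇒≤ lt)) (ratio-mid (view (3 + t)) (s≤s (s≤s (s≤s z≤n))) lt)

  -- For Δ ≥ 3 only Δ ∸ 3 levels have the ratio (b ∸ 1)/b. Three more such factors are at most 1 and
  -- round the exponent up to Δ.
  prod-Δ : ∀ t → t ≡ Δ → prod q t * (e * e * (b ∸ 1) ^ t) ≤ prod p t * (2 * b * (2 * b) * b ^ t)
  prod-Δ 0 eq = ⊥-elim (<-irrefl eq (≤-trans (s≤s z≤n) 2≤Δ))
  prod-Δ 1 eq = ⊥-elim (<-irrefl eq 2≤Δ)
  prod-Δ 2 eq = pad {prod p 2} {prod q 2} {e * e} {2 * b * (2 * b)} (pad {prod p 2} {prod q 2} {e} {2 * b} (begin
    1 * q 2 * e       ≡⟨ cong (_* e) (*-identityˡ (q 2)) ⟩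
    q 2 * e           ≤⟨ ratio-2 (view 2) refl 2≤Δ ⟩
    p 2 * (2 * b)     ≡⟨ cong (_* (2 * b)) (sym (*-identityˡ (p 2))) ⟩
    1 * p 2 * (2 * b) ∎) e≤2b) (^-monoˡ-≤ 2 (m∸n≤m b 1))
  prod-Δ (suc (suc (suc t))) eq = subst₂ (λ A B → prod q (3 + t) * A ≤ prod p (3 + t) * B)
    (ar e ((b ∸ 1) ^ t) (b ∸ 1)) (ar (2 * b) (b ^ t) b)
    (pad {prod p (3 + t)} {prod q (3 + t)} {e * (b ∸ 1) ^ t * e} {2 * b * b ^ t * (2 * b)}
      (mul-step {prod p (2 + t)} {prod q (2 + t)} {e * (b ∸ 1) ^ t} {2 * b * b ^ t} (p (3 + t)) (q (3 + t)) e (2 * b)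
        (prod-low t (≤-reflexive eq)) (ratio-C (view (3 + t)) eq))
      (^-monoˡ-≤ 3 (m∸n≤m b 1)))
    where
    ar : ∀ e y x → e * y * e * (x * (x * (x * 1))) ≡ e * e * (x * (x * (x * y)))
    ar = solve-∀

  prod-B : ∀ j → j < lB → prod q (j + Δ) * (A₂ * e ^ j) ≤ prod p (j + Δ) * (B₂ * (b * w) ^ j)
  prod-B zero lt = pad {prod p Δ} {prod q Δ} {A₂} {B₂} {1} {1} (prod-Δ Δ refl) ≤-refl
  prod-B (suc j) lt = pow-step {prod p (j + Δ)} {prod q (j + Δ)} {A₂} {B₂} (p (suc j + Δ)) (q (suc j + Δ)) e (b * w) j
    (prod-B j (<⇒≤ lt)) (zone-B (view (suc j + Δ)) j refl lt)

  suc-pred-lB : suc (pred lB) ≡ lB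
  suc-pred-lB = suc-pred lB {{>-nonZero 1≤lB}}

  prod-J : prod q (lB + Δ) * A₄ ≤ prod p (lB + Δ) * B₄
  prod-J = subst (λ i → prod q (i + Δ) * A₄ ≤ prod p (i + Δ) * B₄) suc-pred-lB
    (mul-step {prod p (pred lB + Δ)} {prod q (pred lB + Δ)} {A₂ * e ^ pred lB} {B₂ * (b * w) ^ pred lB} _ _ e (4 * b * (2 + lB))
      (prod-B (pred lB) (≤-reflexive suc-pred-lB)) (zone-J (view (suc (pred lB + Δ))) (cong (_+ Δ) suc-pred-lB)))

  module _ (A : ℕ) (A≤ : ∀ l → lB ≤ l → l ≤ lT → A ≤ a l) where

    private
      r = b * A ∸ 12
      s = b * A

    -- The factors a l telescope.
    prod-A : ∀ j → j + lB ≤ lT →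
      prod q (j + lB + Δ) * (A₄ * a lB * r ^ j) ≤ prod p (j + lB + Δ) * (B₄ * a (j + lB) * s ^ j)
    prod-A zero le = pad {prod p (lB + Δ)} {prod q (lB + Δ)} {A₄ * a lB} {B₄ * a lB} {1} {1}
      (pad {prod p (lB + Δ)} {prod q (lB + Δ)} {A₄} {B₄} prod-J ≤-refl) ≤-refl
    prod-A (suc j) le = begin
      Q * q′ * (A₄ * a lB * r ^ suc j)   ≡⟨ cong (Q * q′ *_) (snoc (A₄ * a lB) r j) ⟩
      Q * q′ * (A₄ * a lB * r ^ j * r)   ≡⟨ ar1 Q q′ (A₄ * a lB * r ^ j) r ⟩
      Q * (A₄ * a lB * r ^ j) * (q′ * r) ≤⟨ *-monoˡ-≤ (q′ * r) (prod-A j (<⇒≤ le)) ⟩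
      P * (B₄ * a l * s ^ j) * (q′ * r)  ≡⟨ ar2 P B₄ (a l) (s ^ j) (q′ * r) ⟩
      P * B₄ * s ^ j * (a l * (q′ * r))  ≤⟨ *-monoʳ-≤ (P * B₄ * s ^ j) key ⟩
      P * B₄ * s ^ j * (p′ * (a (suc l) * s)) ≡⟨ ar3 P B₄ (s ^ j) p′ (a (suc l)) s ⟩
      P * p′ * (B₄ * a (suc l) * (s * s ^ j)) ∎
      where
      l = j + lB
      lB≤l : lB ≤ l
      lB≤l = m≤n+m lB j
      Q = prod q (l + Δ)
      P = prod p (l + Δ)
      q′ = q (suc l + Δ)
      p′ = p (suc l + Δ)
      ar1 : ∀ Q q A r → Q * q * (A * r) ≡ Q * A * (q * r)
      ar1 = solve-∀
      ar2 : ∀ P B a s x → P * (B * a * s) * x ≡ P * B * s * (a * x)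
      ar2 = solve-∀
      ar3 : ∀ P B s p a s′ → P * B * s * (p * (a * s′)) ≡ P * p * (B * a * (s′ * s))
      ar3 = solve-∀
      big = a-big l lB≤l (<⇒≤ le)
      bA≤ = *-monoʳ-≤ b (A≤ l lB≤l (<⇒≤ le))
      -- 1 - 12 / (b x) increases with x, so the lower bound `A` may replace `a l`.
      frac≤ : b * a l * r ≤ (b * a l ∸ 12) * s
      frac≤ = begin
        b * a l * (s ∸ 12)           ≡⟨ *-distribˡ-∸ (b * a l) s 12 ⟩
        b * a l * s ∸ b * a l * 12   ≤⟨ ∸-monoʳ-≤ (b * a l * s) (≤-trans (*-monoʳ-≤ 12 bA≤) (≤-reflexive (*-comm 12 (b * a l)))) ⟩
        b * a l * s ∸ 12 * s         ≡⟨ sym (*-distribʳ-∸ s (b * a l) 12) ⟩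
        (b * a l ∸ 12) * s           ∎
      key : a l * (q′ * r) ≤ p′ * (a (suc l) * s)
      key = begin
        a l * (q′ * r)                  ≡⟨ cong (λ z → a l * (z * r)) (proj₁ (zone-A (view (suc l + Δ)) l refl lB≤l)) ⟩
        a l * (b * a (suc l) * r)       ≡⟨ ar4 (a l) b (a (suc l)) r ⟩
        a (suc l) * (b * a l * r)       ≤⟨ *-monoʳ-≤ (a (suc l)) frac≤ ⟩
        a (suc l) * ((b * a l ∸ 12) * s) ≡⟨ ar5 (a (suc l)) (b * a l ∸ 12) s ⟩
        (b * a l ∸ 12) * (a (suc l) * s) ≡⟨ cong (_* (a (suc l) * s)) (sym (proj₂ (zone-A (view (suc l + Δ)) l refl lB≤l))) ⟩
        p′ * (a (suc l) * s)            ∎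
        where
        ar4 : ∀ a b a′ r → a * (b * a′ * r) ≡ a′ * (b * a * r)
        ar4 = solve-∀
        ar5 : ∀ a x s → a * (x * s) ≡ x * (a * s)
        ar5 = solve-∀

    -- `N` gadgets of the initial weight outweigh `2 * H 0`, because `Z 0` and `Z T` are the
    -- products of all `q` and all `p`. The factor 32 b³ collects the 2 of `2 * H 0`, the factors
    -- `2 * b` at the levels 2 and Δ, and `4 * b` at the junction. By `aT≤` the initial health is
    -- worth at least a quarter of the full weight.
    cost : ∀ N h j → j + lB ≡ lT → 1 ≤ e → 2 ≤ b → 1 ≤ r → 4 * (2 + lB) ≤ a lB →
      1 ≤ a lT → a lT ≤ 4 * ωA lT h →
      32 * b ^ 3 * b ^ Δ * (b * w) ^ pred lB * s ^ j < N * (e ^ 3 * (b ∸ 1) ^ Δ * e ^ pred lB * r ^ j) →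
      2 * H 0 < N * W T h
    cost N h j eqT 1≤e 2≤b 1≤r aB≥ 1≤aT aT≤ big = *-cancelʳ-< (4 * (L * X)) (2 * H 0) (N * W T h) (begin-strict
      2 * H 0 * (4 * (L * X))       ≡⟨ cong (λ z → 2 * (1 * z) * (4 * (L * X))) Z-bottom ⟩
      2 * (1 * Qt) * (4 * (L * X))  ≡⟨ ar1 Qt L X ⟩
      2 * (Qt * (4 * L * X))        ≤⟨ *-monoʳ-≤ 2 (*-monoʳ-≤ Qt (*-monoˡ-≤ X aB≥)) ⟩
      2 * (Qt * (a lB * X))         ≡⟨ cong (λ z → 2 * (Qt * z)) (ar2 (a lB) e ((b ∸ 1) ^ Δ) (e ^ pred lB) (r ^ j)) ⟩
      2 * (Qt * (A₄ * a lB * r ^ j)) ≤⟨ *-monoʳ-≤ 2 top ⟩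
      2 * (Pt * (B₄ * aT * s ^ j))  ≡⟨ ar3 Pt b (b ^ Δ) ((b * w) ^ pred lB) L aT (s ^ j) ⟩
      (Pt * aT * L) * Y             <⟨ *-monoʳ-< (Pt * aT * L) {{>-nonZero (*-mono-≤ (*-mono-≤ 1≤Pt 1≤aT) (s≤s {0} {1 + lB} z≤n))}} big ⟩
      (Pt * aT * L) * (N * X)       ≤⟨ *-monoˡ-≤ (N * X) (*-monoˡ-≤ L (*-monoʳ-≤ Pt aT≤)) ⟩
      (Pt * (4 * ωA lT h) * L) * (N * X) ≡⟨ ar4 Pt (ωA lT h) L N X ⟩
      N * (Pt * ωA lT h) * (4 * (L * X)) ≡⟨ cong (λ z → N * z * (4 * (L * X))) (sym Wt≡) ⟩
      N * W T h * (4 * (L * X))     ∎)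
      where
      L = 2 + lB
      X = e ^ 3 * (b ∸ 1) ^ Δ * e ^ pred lB * r ^ j
      Y = 32 * b ^ 3 * b ^ Δ * (b * w) ^ pred lB * s ^ j
      Qt = prod q T
      Pt = prod p T
      aT = a lT
      lB≤lT : lB ≤ lT
      lB≤lT = ≤-trans (m≤n+m lB j) (≤-reflexive eqT)
      top : Qt * (A₄ * a lB * r ^ j) ≤ Pt * (B₄ * aT * s ^ j)
      top = subst (λ i → prod q (i + Δ) * (A₄ * a lB * r ^ j) ≤ prod p (i + Δ) * (B₄ * a i * s ^ j)) eqT
              (prod-A j (≤-reflexive eqT))
      ar1 : ∀ Q L X → 2 * (1 * Q) * (4 * (L * X)) ≡ 2 * (Q * (4 * L * X))
      ar1 = solve-∀
      ar2 : ∀ a e x y r → a * (e * (e * (e * 1)) * x * y * r) ≡ e * e * x * y * e * a * r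
      ar2 = solve-∀
      ar3 : ∀ P b y z L a s → 2 * (P * (2 * b * (2 * b) * y * z * (4 * b * L) * a * s)) ≡
        (P * a * L) * (32 * (b * (b * (b * 1))) * y * z * s)
      ar3 = solve-∀
      ar4 : ∀ P o L N X → (P * (4 * o) * L) * (N * X) ≡ N * (P * o) * (4 * (L * X))
      ar4 = solve-∀
      Wt≡ : W T h ≡ Pt * ωA lT h
      Wt≡ = cong₂ _*_ Z-top (ωV-zoneA (view T) lT refl lB≤lT h)
      1≤Pt : 1 ≤ Pt
      1≤Pt = prod≥1 T ≤-refl
        where
        pV≥1 : ∀ {t} (v : View t) → t ≤ T → 1 ≤ pV v
        pV≥1 v0 _ = ≤-refl
        pV≥1 v1 _ = ≤-refl
        pV≥1 (v2 zero _) _ = 1≤e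
        pV≥1 (v2 (suc _) _) _ = ∸-monoˡ-≤ 1 2≤b
        pV≥1 (vC _) _ = 1≤e
        pV≥1 (vB _ _ _) _ = 1≤e
        pV≥1 (vJ _) _ = 1≤e
        pV≥1 (vA l refl le) t≤ = ≤-trans 1≤r (∸-monoˡ-≤ 12 (*-monoʳ-≤ b (A≤ l le (<⇒≤ (+-cancelʳ-≤ Δ (suc l) lT t≤)))))
        prod≥1 : ∀ t → t ≤ T → 1 ≤ prod p t
        prod≥1 zero _ = ≤-refl
        prod≥1 (suc t) t≤ = *-mono-≤ (prod≥1 t (<⇒≤ t≤)) (pV≥1 (view (suc t)) t≤)

-- Choosing the gadgets

module Selection {n Δ : ℕ} (G : SimpleGraph n) (deg : ∀ u → cnt (adj? G u) ≡ Δ) where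

  open Gadgets G

  deg′ : ∀ y → cnt (λ x → adj? G x y) ≡ Δ
  deg′ y = trans (cnt-cong (λ x → adj? G x y) (adj? G y) (λ x → flip-adj) (λ x → flip-adj)) (deg y)

  cnt-nb : ∀ {P : Fin n → Set} (P? : ∀ x → Dec (P x)) → cnt (nb? P?) ≤ cnt P? * suc Δ
  cnt-nb {P} P? = begin
    cnt (nb? P?)                         ≤⟨ cnt-∃ A? (nb? P?) ⟩
    sumF (λ y → cnt (A? y))              ≤⟨ sumF-mono pt ⟩
    sumF (λ y → ind (P? y) * suc Δ)      ≡⟨ sumF-*ʳ (λ y → ind (P? y)) (suc Δ) ⟩
    cnt P? * suc Δ                       ∎
    where
    A? = λ y x → P? y ×-dec ((x F.≟ y) ⊎-dec adj? G x y)
    pt : ∀ y → cnt (A? y) ≤ ind (P? y) * suc Δ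
    pt y with P? y
    ... | no ¬p = ≤-reflexive (cnt-zero (λ x → no ¬p ×-dec ((x F.≟ y) ⊎-dec adj? G x y)) (λ x q → ¬p (proj₁ q)))
    ... | yes p = begin
      cnt (λ x → yes p ×-dec ((x F.≟ y) ⊎-dec adj? G x y))
        ≤⟨ cnt-∪≤ (λ x → x F.≟ y) (λ x → adj? G x y) (λ x → yes p ×-dec ((x F.≟ y) ⊎-dec adj? G x y)) (λ x → proj₂) ⟩
      cnt (λ x → x F.≟ y) + cnt (λ x → adj? G x y) ≡⟨ cong₂ _+_ (cnt-point y) (deg′ y) ⟩
      suc Δ             ≡⟨ sym (+-identityʳ _) ⟩
      suc Δ + 0         ∎

  cnt-core : ∀ γ → cnt (core? γ) ≤ suc Δ
  cnt-core γ = begin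
    cnt (core? γ) ≤⟨ cnt-∪≤ (λ x → x F.≟ centre γ) (adj? G (centre γ)) (core? γ)
                       (λ { x (inj₁ e) → inj₁ e ; x (inj₂ c) → inj₂ (cand-adj γ x c) }) ⟩
    cnt (λ x → x F.≟ centre γ) + cnt (adj? G (centre γ)) ≡⟨ cong₂ _+_ (cnt-point (centre γ)) (deg (centre γ)) ⟩
    suc Δ ∎

  regExp spread : Bool → ℕ
  regExp true  = 3
  regExp false = 2
  spread true  = 2
  spread false = 1

  cnt-reg : ∀ wd γ → cnt (reg? wd γ) ≤ suc Δ ^ regExp wd
  cnt-reg false γ = begin
    cnt (near? γ)          ≤⟨ cnt-nb (core? γ) ⟩
    cnt (core? γ) * suc Δ  ≤⟨ *-monoˡ-≤ (suc Δ) (cnt-core γ) ⟩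
    suc Δ * suc Δ          ≡⟨ cong (suc Δ *_) (sym (*-identityʳ (suc Δ))) ⟩
    suc Δ ^ 2              ∎
  cnt-reg true γ = begin
    cnt (nb? (near? γ))    ≤⟨ cnt-nb (near? γ) ⟩
    cnt (near? γ) * suc Δ  ≤⟨ *-monoˡ-≤ (suc Δ) (cnt-reg false γ) ⟩
    suc Δ ^ 2 * suc Δ      ≡⟨ *-comm (suc Δ ^ 2) (suc Δ) ⟩
    suc Δ ^ 3              ∎

  -- The vertices that a core has to avoid if its region is not to meet `U`: the layers of the
  -- region are turned around and put on `U`.
  Fat : Bool → (Fin n → Set) → Fin n → Set
  Fat true  U = Nb (Nb U)
  Fat false U = Nb U

  fat? : ∀ wd {U : Fin n → Set} → (∀ x → Dec (U x)) → ∀ x → Dec (Fat wd U x)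
  fat? true  U? = nb? (nb? U?)
  fat? false U? = nb? U?

  cnt-fat : ∀ wd {U : Fin n → Set} (U? : ∀ x → Dec (U x)) → cnt (fat? wd U?) ≤ cnt U? * suc Δ ^ spread wd
  cnt-fat false U? = ≤-trans (cnt-nb U?) (≤-reflexive (cong (cnt U? *_) (sym (*-identityʳ (suc Δ)))))
  cnt-fat true U? = begin
    cnt (nb? (nb? U?))          ≤⟨ cnt-nb (nb? U?) ⟩
    cnt (nb? U?) * suc Δ        ≤⟨ *-monoˡ-≤ (suc Δ) (cnt-nb U?) ⟩
    cnt U? * suc Δ * suc Δ      ≡⟨ ar (cnt U?) (suc Δ) ⟩
    cnt U? * suc Δ ^ 2          ∎
    where
    ar : ∀ c x → c * x * x ≡ c * (x * (x * 1))
    ar = solve-∀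

  Nb-back : ∀ {P U : Fin n → Set} {x} → Nb P x → U x → ∃ λ y → P y × Nb U y
  Nb-back (y , py , inj₁ refl) ux = y , py , (_ , ux , inj₁ refl)
  Nb-back (y , py , inj₂ a) ux = y , py , (_ , ux , inj₂ (flip-adj a))

  reg-fat : ∀ wd {γ} {U : Fin n → Set} {x} → Reg wd γ x → U x → ∃ λ y → Core γ y × Fat wd U y
  reg-fat false {U = U} r ux = Nb-back {U = U} r ux
  reg-fat true {U = U} r ux with Nb-back {U = U} r ux
  ... | y , ny , uy = Nb-back {U = Nb U} ny uy

  cover : Bool → Fin n → List Gadget → ℕ
  cover wd x [] = 0
  cover wd x (γ ∷ L) = ind (reg? wd γ x) + cover wd x L

  Covered : Bool → List Gadget → Fin n → Set
  Covered wd L x = 1 ≤ cover wd x L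

  covered? : ∀ wd L x → Dec (Covered wd L x)
  covered? wd L x = 1 ≤? cover wd x L

  cnt-covered : ∀ wd L → cnt (covered? wd L) ≤ length L * suc Δ ^ regExp wd
  cnt-covered wd [] = ≤-reflexive (cnt-zero (covered? wd []) (λ x ()))
  cnt-covered wd (γ ∷ L) = ≤-trans
    (cnt-∪≤ (reg? wd γ) (covered? wd L) (covered? wd (γ ∷ L)) split)
    (+-mono-≤ (cnt-reg wd γ) (cnt-covered wd L))
    where
    split : ∀ x → Covered wd (γ ∷ L) x → Reg wd γ x ⊎ Covered wd L x
    split x c with reg? wd γ x
    ... | yes r = inj₁ r
    ... | no _  = inj₂ c

  -- Otherwise there are too many edges between F and its complement.
  sparse-vertex : ∀ {F : Fin n → Set} (F? : ∀ x → Dec (F x)) d → cnt F? * (Δ + suc d) < n * suc d →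
    ∃ λ u → ¬ F u × cnt (λ v → adj? G u v ×-dec F? v) ≤ d
  sparse-vertex {F} F? d lt with F.any? (λ u → ¬? (F? u) ×-dec (cnt (λ v → adj? G u v ×-dec F? v) ≤? d))
  ... | yes r = r
  ... | no ¬r = ⊥-elim (<-irrefl refl (begin-strict
    cnt F? * (Δ + suc d)                     <⟨ lt ⟩
    n * suc d                                ≡⟨ sym (sumF-const {n} (suc d)) ⟩
    sumF {n} (λ _ → suc d)                   ≤⟨ sumF-mono pt ⟩
    sumF (λ u → ind (F? u) * suc d + cnt (λ v → adj? G u v ×-dec F? v)) ≡⟨ sumF-+ (λ u → ind (F? u) * suc d) _ ⟩
    sumF (λ u → ind (F? u) * suc d) + sumF (λ u → cnt (λ v → adj? G u v ×-dec F? v))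
      ≡⟨ cong₂ _+_ (sumF-*ʳ (λ u → ind (F? u)) (suc d)) (sumF-swap (λ u v → ind (adj? G u v ×-dec F? v))) ⟩
    cnt F? * suc d + sumF (λ v → cnt (λ u → adj? G u v ×-dec F? v)) ≤⟨ +-monoʳ-≤ (cnt F? * suc d) (sumF-mono pt′) ⟩
    cnt F? * suc d + sumF (λ v → ind (F? v) * Δ) ≡⟨ cong (cnt F? * suc d +_) (sumF-*ʳ (λ v → ind (F? v)) Δ) ⟩
    cnt F? * suc d + cnt F? * Δ              ≡⟨ ar (cnt F?) d Δ ⟩
    cnt F? * (Δ + suc d)                     ∎))
    where
    ar : ∀ c d D → c * suc d + c * D ≡ c * (D + suc d)
    ar = solve-∀
    pt : ∀ u → suc d ≤ ind (F? u) * suc d + cnt (λ v → adj? G u v ×-dec F? v)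
    pt u with F? u in eq
    ... | yes _ = ≤-trans (≤-reflexive (sym (+-identityʳ (suc d)))) (m≤m+n _ _)
    ... | no ¬f = ≰⇒> (λ le → ¬r (u , ¬f , le))
    pt′ : ∀ v → cnt (λ u → adj? G u v ×-dec F? v) ≤ ind (F? v) * Δ
    pt′ v with F? v
    ... | no ¬f = ≤-reflexive (cnt-zero (λ u → adj? G u v ×-dec no ¬f) (λ u p → ¬f (proj₂ p)))
    ... | yes f = begin
      cnt (λ u → adj? G u v ×-dec yes f) ≤⟨ cnt-mono (λ u → adj? G u v ×-dec yes f) (λ u → adj? G u v) (λ u → proj₁) ⟩
      cnt (λ u → adj? G u v)             ≡⟨ deg′ v ⟩
      Δ                                  ≡⟨ sym (+-identityʳ Δ) ⟩
      Δ + 0                              ∎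

  does-true : ∀ {A : Set} (d : Dec A) → does d ≡ true → A
  does-true (yes a) _ = a

  true-does : ∀ {A : Set} (d : Dec A) → A → does d ≡ true
  true-does (yes _) _ = refl
  true-does (no ¬a) a = ⊥-elim (¬a a)

  select : ∀ wd d N → N * suc Δ ^ (regExp wd + spread wd) * (Δ + suc d) < n * suc d →
    ∃ λ L → length L ≡ N × (∀ x → cover wd x L ≤ 1) × All (λ γ → Δ ≤ cnt (λ v → cand γ v Bool.≟ true) + d) L
  select wd d zero lt = [] , refl , (λ x → z≤n) , []
  select wd d (suc N) lt with select wd d N (≤-<-trans (*-monoˡ-≤ (Δ + suc d) (*-monoˡ-≤ (suc Δ ^ (regExp wd + spread wd)) (n≤1+n N))) lt)
  ... | L , len , cov , sizes = γ ∷ L , cong suc len , cov′ , size ∷ sizes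
    where
    F? = fat? wd (covered? wd L)
    F≤ : cnt F? * (Δ + suc d) < n * suc d
    F≤ = ≤-<-trans (*-monoˡ-≤ (Δ + suc d) (begin
      cnt F?                                              ≤⟨ cnt-fat wd (covered? wd L) ⟩
      cnt (covered? wd L) * suc Δ ^ spread wd             ≤⟨ *-monoˡ-≤ (suc Δ ^ spread wd) (cnt-covered wd L) ⟩
      length L * suc Δ ^ regExp wd * suc Δ ^ spread wd    ≡⟨ *-assoc (length L) _ _ ⟩
      length L * (suc Δ ^ regExp wd * suc Δ ^ spread wd)  ≡⟨ cong₂ _*_ len (sym (^-distribˡ-+-* (suc Δ) (regExp wd) (spread wd))) ⟩
      N * suc Δ ^ (regExp wd + spread wd)                 ≤⟨ *-monoˡ-≤ (suc Δ ^ (regExp wd + spread wd)) (n≤1+n N) ⟩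
      suc N * suc Δ ^ (regExp wd + spread wd)             ∎)) lt
    found = sparse-vertex F? d F≤
    u = proj₁ found
    good? = λ v → adj? G u v ×-dec ¬? (F? v)
    γ : Gadget
    -- The neighbours in `F?`, at most `d` of them, are no candidates. So the core avoids `F?`, and
    -- the new region is disjoint from the old ones.
    γ = record { centre = u ; cand = λ v → does (good? v) ; cand-adj = λ v e → proj₁ (does-true (good? v) e) }
    core-thin : ∀ y → Core γ y → ¬ Fat wd (Covered wd L) y
    core-thin y (inj₁ refl) = proj₁ (proj₂ found)
    core-thin y (inj₂ e) = proj₂ (does-true (good? y) e)
    cov′ : ∀ x → cover wd x (γ ∷ L) ≤ 1
    cov′ x with reg? wd γ x
    ... | no _ = cov x
    ... | yes r = s≤s (≤-pred (≰⇒> (λ c → let (y , cy , fy) = reg-fat wd {γ} {Covered wd L} r c in core-thin y cy fy)))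
    size : Δ ≤ cnt (λ v → cand γ v Bool.≟ true) + d
    size = begin
      Δ                       ≡⟨ sym (deg u) ⟩
      cnt (adj? G u)          ≤⟨ cnt-∪≤ (λ v → cand γ v Bool.≟ true) (λ v → adj? G u v ×-dec F? v) (adj? G u) split ⟩
      cnt (λ v → cand γ v Bool.≟ true) + cnt (λ v → adj? G u v ×-dec F? v) ≤⟨ +-monoʳ-≤ (cnt (λ v → cand γ v Bool.≟ true)) (proj₂ (proj₂ found)) ⟩
      cnt (λ v → cand γ v Bool.≟ true) + d ∎
      where
      split : ∀ v → Adj G u v ≡ true → cand γ v ≡ true ⊎ (Adj G u v ≡ true × Fat wd (Covered wd L) v)
      split v a = by (F? v)
        where
        by : Dec (Fat wd (Covered wd L) v) → cand γ v ≡ true ⊎ (Adj G u v ≡ true × Fat wd (Covered wd L) v)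
        by (yes f) = inj₂ (a , f)
        by (no ¬f) = inj₁ (true-does (good? v) (a , ¬f))

  module Opening {k T b : ℕ} (k≤ : k ≤ (Δ ∸ 1) + (Δ ∸ 1)) (2≤Δ : 2 ≤ Δ) (1≤b : 1 ≤ b)
                 (wide : Bool) (weights : Weights wide b Δ T) (T≡ : T ≡ Δ + Δ) where

    open Play k
    open Strategy {n} {k} {Δ} {T} {b} G deg k≤ 2≤Δ 1≤b wide weights
    open Weights weights

    Ok1-empty : ∀ γ d → Δ ≤ cnt (λ v → cand γ v Bool.≟ true) + d → Ok1 empty γ (2 + Δ) (Δ ∸ d)
    Ok1-empty γ d size = record
      { open≤ = ≤-trans (cnt-mono (open? empty γ) (adj? G (centre γ)) (λ w → proj₁))
                  (≤-trans (≤-reflexive (deg (centre γ))) (m≤n+m Δ 2))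
      ; slack = begin
          Δ ∸ d + cnt (dirty? empty γ) ≡⟨ cong (Δ ∸ d +_) (cnt-zero (dirty? empty γ) (λ { α (_ , x , _ , w , ()) })) ⟩
          Δ ∸ d + 0                    ≡⟨ +-identityʳ _ ⟩
          Δ ∸ d                        ≤⟨ m≤n+o⇒m∸n≤o Δ d (≤-trans size (≤-reflexive (+-comm _ d))) ⟩
          cnt (λ v → cand γ v Bool.≟ true) ≤⟨ cnt-mono (λ v → cand γ v Bool.≟ true) (clean? empty γ) (λ v c → c , refl , λ _ → refl) ⟩
          cnt (clean? empty γ)         ∎ }

    fresh : ℕ → List Gadget → List Entry
    fresh h = map (λ γ → γ , h)

    fresh-load : ∀ h x L → load x (fresh h L) ≡ cover wide x L
    fresh-load h x [] = refl
    fresh-load h x (γ ∷ L) = cong (ind (reg? wide γ x) +_) (fresh-load h x L)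

    fresh-pot : ∀ t h L → pot t (fresh h L) ≡ length L * W t h
    fresh-pot t h [] = refl
    fresh-pot t h (γ ∷ L) = cong (W t h +_) (fresh-pot t h L)

    fresh-ok : ∀ d {L} → All (λ γ → Δ ≤ cnt (λ v → cand γ v Bool.≟ true) + d) L → AllOk empty T (fresh (Δ ∸ d) L)
    fresh-ok d [] = []
    -- The start at `l = Δ` allows `2 + Δ` open edges at the centre, two more than there are.
    fresh-ok d {γ ∷ L} (s ∷ ss) = ph1 Δ T≡ (Ok1-empty γ d s) ∷ fresh-ok d ss

    breaker-beats : ∀ d N → N * suc Δ ^ (regExp wide + spread wide) * (Δ + suc d) < n * suc d →
      2 * H 0 < N * W T (Δ ∸ d) → ¬ MakerWinsGame G b k
    breaker-beats d N room big with select wide d N room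
    ... | L , refl , cov , sizes = go T refl
      where
      go : ∀ T′ → T′ ≡ T → ¬ MakerWinsGame G b k
      go zero eq = λ _ → <-irrefl (sym (m+n≡0⇒m≡0 Δ (trans (sym T≡) (sym eq)))) (≤-trans (s≤s z≤n) 2≤Δ)
      go (suc t) refl = breaker-wins {t = t} {Hi = fresh (Δ ∸ d) L} {Lo = []} (WF-empty G)
        (record { okHi = fresh-ok d sizes ; okLo = []
                ; disj = λ x → ≤-trans (≤-reflexive (trans (+-identityʳ _) (fresh-load (Δ ∸ d) x L))) (cov x) })
        ≤-refl
        (<-≤-trans big (≤-reflexive (sym (trans (+-identityʳ _) (fresh-pot (suc t) (Δ ∸ d) L)))))

-- Estimates

-- Bernoulli: (r / (r + δ))^m ≥ 1 − m δ / (r + δ).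
bernoulli : ∀ r δ m → (r + δ) * (r + δ) ^ m ≤ (r + δ) * r ^ m + m * δ * (r + δ) ^ m
bernoulli r δ zero = m≤m+n _ _
bernoulli r δ (suc m) = begin
  s * (s * s ^ m)                                    ≤⟨ *-monoʳ-≤ s (bernoulli r δ m) ⟩
  s * (s * r ^ m + m * δ * s ^ m)                    ≡⟨ ar1 r δ (r ^ m) m (s ^ m) ⟩
  s * (r * r ^ m) + (δ * (s * r ^ m) + m * δ * (s * s ^ m)) ≤⟨ +-monoʳ-≤ (s * (r * r ^ m)) (+-monoˡ-≤ (m * δ * (s * s ^ m))
                                                          (*-monoʳ-≤ δ (*-monoʳ-≤ s (^-monoˡ-≤ m (m≤m+n r δ))))) ⟩
  s * (r * r ^ m) + (δ * (s * s ^ m) + m * δ * (s * s ^ m)) ≡⟨ cong (s * (r * r ^ m) +_) (ar2 δ (s * s ^ m) m) ⟩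
  s * (r * r ^ m) + suc m * δ * (s * s ^ m)          ∎
  where
  s = r + δ
  ar1 : ∀ r δ x m y → (r + δ) * ((r + δ) * x + m * δ * y) ≡
    (r + δ) * (r * x) + (δ * ((r + δ) * x) + m * δ * ((r + δ) * y))
  ar1 = solve-∀
  ar2 : ∀ δ x m → δ * x + m * δ * x ≡ suc m * δ * x
  ar2 = solve-∀

half-pow : ∀ r δ m → 1 ≤ r → 2 * m * δ ≤ r + δ → (r + δ) ^ m ≤ 2 * r ^ m
half-pow r δ m 1≤r le = *-cancelˡ-≤ s {{>-nonZero (≤-trans 1≤r (m≤m+n r δ))}} (+-cancelʳ-≤ (s * s ^ m) _ _ (begin
  s * s ^ m + s * s ^ m                             ≤⟨ +-mono-≤ (bernoulli r δ m) (bernoulli r δ m) ⟩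
  (s * r ^ m + m * δ * s ^ m) + (s * r ^ m + m * δ * s ^ m) ≡⟨ ar s (r ^ m) m δ (s ^ m) ⟩
  s * (2 * r ^ m) + 2 * m * δ * s ^ m               ≤⟨ +-monoʳ-≤ (s * (2 * r ^ m)) (*-monoˡ-≤ (s ^ m) le) ⟩
  s * (2 * r ^ m) + s * s ^ m                       ∎))
  where
  s = r + δ
  ar : ∀ s x m δ y → (s * x + m * δ * y) + (s * x + m * δ * y) ≡ s * (2 * x) + 2 * m * δ * y
  ar = solve-∀

pow-* : ∀ x m L → (x ^ m) ^ L ≡ x ^ (L * m)
pow-* x m L = trans (^-*-assoc x m L) (cong (x ^_) (*-comm m L))

*-^ : ∀ x y m → (x * y) ^ m ≡ x ^ m * y ^ m
*-^ x y zero = refl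
*-^ x y (suc m) = trans (cong (x * y *_) (*-^ x y m)) (ar x y (x ^ m) (y ^ m))
  where
  ar : ∀ x y a b → x * y * (a * b) ≡ x * a * (y * b)
  ar = solve-∀

-- The bound K / K′ for (s / r)^J holds for smaller powers as well.
pow-shrink : ∀ r s K K′ j J → 1 ≤ r → r ≤ s → j ≤ J → K′ * s ^ J ≤ K * r ^ J → K′ * s ^ j ≤ K * r ^ j
pow-shrink r s K K′ j J 1≤r r≤s j≤J le with m≤n⇒∃[o]m+o≡n j≤J
... | i , refl = *-cancelʳ-≤ _ _ (r ^ i) {{>-nonZero (m^n>0 r {{>-nonZero 1≤r}} i)}} (begin
  K′ * s ^ j * r ^ i   ≤⟨ *-monoʳ-≤ (K′ * s ^ j) (^-monoˡ-≤ i r≤s) ⟩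
  K′ * s ^ j * s ^ i   ≡⟨ *-assoc K′ (s ^ j) (s ^ i) ⟩
  K′ * (s ^ j * s ^ i) ≡⟨ cong (K′ *_) (sym (^-distribˡ-+-* s j i)) ⟩
  K′ * s ^ (j + i)     ≤⟨ le ⟩
  K * r ^ (j + i)      ≡⟨ cong (K *_) (^-distribˡ-+-* r j i) ⟩
  K * (r ^ j * r ^ i)  ≡⟨ sym (*-assoc K (r ^ j) (r ^ i)) ⟩
  K * r ^ j * r ^ i    ∎)

-- The factors are cut into `L` blocks of length `m`, and by `half-pow` each block costs at most a
-- factor 2.
ratio-pow : ∀ r δ m L j → 1 ≤ r → 2 * m * δ ≤ r + δ → j ≤ L * m → (r + δ) ^ j ≤ 2 ^ L * r ^ j
ratio-pow r δ m L j 1≤r le j≤ = subst (_≤ 2 ^ L * r ^ j) (*-identityˡ _) (pow-shrink r s (2 ^ L) 1 j (L * m) 1≤r (m≤m+n r δ) j≤ (begin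
  1 * s ^ (L * m)       ≡⟨ *-identityˡ _ ⟩
  s ^ (L * m)           ≡⟨ sym (pow-* s m L) ⟩
  (s ^ m) ^ L           ≤⟨ ^-monoˡ-≤ L (half-pow r δ m 1≤r le) ⟩
  (2 * r ^ m) ^ L       ≡⟨ *-^ 2 (r ^ m) L ⟩
  2 ^ L * (r ^ m) ^ L   ≡⟨ cong (2 ^ L *_) (pow-* r m L) ⟩
  2 ^ L * r ^ (L * m)   ∎))
  where
  s = r + δ

-- N = ⌊Y / X⌋ + 1 exceeds Y / X, and since X ≤ Y it is at most 2 Y / X.
choose-N : ∀ X Y V n → 1 ≤ X → X ≤ Y → 2 * Y * V < n * X → ∃ λ N → Y < N * X × N * V < n
choose-N X Y V n 1≤X X≤Y lt = suc k , Y< , *-cancelʳ-< X (suc k * V) n (≤-<-trans NV≤ lt)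
  where
  instance _ = >-nonZero 1≤X
  k = Y / X
  Y< : Y < suc k * X
  Y< = begin-strict
    Y                ≡⟨ m≡m%n+[m/n]*n Y X ⟩
    Y % X + k * X    <⟨ +-monoˡ-< (k * X) (m%n<n Y X) ⟩
    X + k * X        ∎
  NV≤ : suc k * V * X ≤ 2 * Y * V
  NV≤ = begin
    suc k * V * X    ≡⟨ ar k V X ⟩
    (X + k * X) * V  ≤⟨ *-monoˡ-≤ V (+-mono-≤ X≤Y (m/n*n≤m Y X)) ⟩
    (Y + Y) * V      ≡⟨ cong (λ z → (Y + z) * V) (sym (+-identityʳ Y)) ⟩
    2 * Y * V        ∎
    where
    ar : ∀ k V X → suc k * V * X ≡ (X + k * X) * V
    ar = solve-∀

-- The number of gadgets needed against the number that fits into the graph.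

regionExp : Bool → ℕ
regionExp true  = 5
regionExp false = 3

module Lower (wide : Bool) (b e Δ lB A j : ℕ) (a : ℕ → ℕ) (2≤Δ : 2 ≤ Δ) (2≤b : 2 ≤ b) (1≤e : 1 ≤ e)
  (be : b * wt wide ≡ 2 + e) (1≤lB : 1 ≤ lB)
  (a≤ : ∀ l → lB ≤ l → a l ≤ 4 * (2 + l))
  (aB : 4 * (2 + lB) ≤ a lB)
  (a-up   : ∀ l → lB ≤ l → suc l ≤ Δ → b * a (suc l) + 12 ≤ b * a l + 4 * b)
  (a-down : ∀ l → lB ≤ l → suc l ≤ Δ → b * a l ≤ b * a (suc l) + 12)
  (A≤ : ∀ l → lB ≤ l → l ≤ Δ → A ≤ a l)
  (bA : 13 ≤ b * A)
  (jlB : j + lB ≡ Δ)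
  (aT : 32 + 16 * (Δ / 32) ≤ 3 * a Δ) where

  private
    r = b * A ∸ 12
    s = b * A
    d = Δ / 32
    1≤b = ≤-trans (s≤s z≤n) 2≤b

  -- By `cost` more than `Y / X` gadgets suffice, and each takes up `V` vertices. The 33 is the
  -- price of giving up only Δ / 32 candidates, see `Δ<32`.
  Y X V : ℕ
  Y = 32 * b ^ 3 * b ^ Δ * (b * wt wide) ^ pred lB * s ^ j
  X = e ^ 3 * (b ∸ 1) ^ Δ * e ^ pred lB * r ^ j
  V = suc Δ ^ regionExp wide * 33

  1≤r : 1 ≤ r
  1≤r = m<n⇒0<n∸m bA

  e≤b : e ≤ 2 * b
  e≤b = ≤-trans (m≤n+m e 2) (≤-trans (≤-reflexive (sym be)) (≤-trans (*-monoʳ-≤ b (w≤2 wide)) (≤-reflexive (*-comm b 2))))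
    where
    w≤2 : ∀ wd → wt wd ≤ 2
    w≤2 true  = ≤-refl
    w≤2 false = s≤s z≤n

  X≤Y : X ≤ Y
  X≤Y = *-mono-≤ (*-mono-≤ (*-mono-≤ e³ (^-monoˡ-≤ Δ (m∸n≤m b 1))) (^-monoˡ-≤ (pred lB) (≤-trans (m≤n+m e 2) (≤-reflexive (sym be)))))
                 (^-monoˡ-≤ j (m∸n≤m s 12))
    where
    e³ : e ^ 3 ≤ 32 * b ^ 3
    e³ = begin
      e ^ 3        ≤⟨ ^-monoˡ-≤ 3 e≤b ⟩
      (2 * b) ^ 3  ≡⟨ *-^ 2 b 3 ⟩
      8 * b ^ 3    ≤⟨ *-monoˡ-≤ (b ^ 3) (m≤m+n 8 24) ⟩
      32 * b ^ 3   ∎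

  1≤X : 1 ≤ X
  1≤X = *-mono-≤ (*-mono-≤ (*-mono-≤ (pw e 3 1≤e) (pw (b ∸ 1) Δ (∸-monoˡ-≤ 1 2≤b))) (pw e (pred lB) 1≤e)) (pw r j 1≤r)
    where
    pw : ∀ x m → 1 ≤ x → 1 ≤ x ^ m
    pw x m 1≤x = m^n>0 x {{>-nonZero 1≤x}} m

  d≤Δ : d ≤ Δ
  d≤Δ = ≤-trans (m≤m*n d 32) (m/n*n≤m Δ 32)

  Δ<32 : Δ + suc d ≤ 33 * suc d
  Δ<32 = begin
    Δ + suc d              ≡⟨ cong (_+ suc d) (m≡m%n+[m/n]*n Δ 32) ⟩
    Δ % 32 + d * 32 + suc d ≤⟨ +-monoˡ-≤ (suc d) (+-monoˡ-≤ (d * 32) (<⇒≤ (m%n<n Δ 32))) ⟩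
    32 + d * 32 + suc d    ≡⟨ ar d ⟩
    33 * suc d             ∎
    where
    ar : ∀ d → 32 + d * 32 + suc d ≡ 33 * suc d
    ar = solve-∀

  module B = Build wide b e Δ lB Δ a 2≤Δ be 1≤b 1≤lB a≤ a-up a-down
               (λ l p q → ≤-trans (m≤n+m 12 1) (≤-trans bA (*-monoʳ-≤ b (A≤ l p q))))

  lB≤Δ : lB ≤ Δ
  lB≤Δ = ≤-trans (m≤n+m lB j) (≤-reflexive jlB)

  1≤aΔ : 1 ≤ a Δ
  1≤aΔ = n≢0⇒n>0 (λ z → <-irrefl refl (≤-trans (≤-trans (s≤s z≤n) (m≤m+n 32 _)) (≤-trans aT (≤-reflexive (cong (3 *_) z)))))

  -- The initial health `Δ ∸ d` is `2 + d` below the cap `2 + Δ`. This takes 4 (2 + d) from the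
  -- weight `a Δ`, at most three quarters of it by `aT`.
  aT≤ : a Δ ≤ 4 * B.ωA Δ (Δ ∸ d)
  aT≤ = +-cancelʳ-≤ (32 + 16 * d) _ _ (begin
    a Δ + (32 + 16 * d)              ≤⟨ +-monoʳ-≤ (a Δ) aT ⟩
    a Δ + 3 * a Δ                    ≡⟨⟩
    4 * a Δ                          ≤⟨ *-monoʳ-≤ 4 (+-cancelʳ-≤ (4 * (Δ ∸ d)) (a Δ) (ω + (8 + 4 * d)) lem) ⟩
    4 * (ω + (8 + 4 * d))            ≡⟨ ar ω d ⟩
    4 * ω + (32 + 16 * d)            ∎)
    where
    ω = B.ωA Δ (Δ ∸ d)
    ar : ∀ o d → 4 * (o + (8 + 4 * d)) ≡ 4 * o + (32 + 16 * d)
    ar = solve-∀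
    ar′ : ∀ o d x → o + 4 * (2 + (d + x)) ≡ o + (8 + 4 * d) + 4 * x
    ar′ = solve-∀
    lem : a Δ + 4 * (Δ ∸ d) ≤ ω + (8 + 4 * d) + 4 * (Δ ∸ d)
    lem = begin
      a Δ + 4 * (Δ ∸ d)              ≡⟨ cong (λ m → a Δ + 4 * m) (sym (m≤n⇒m⊓n≡m (≤-trans (m∸n≤m Δ d) (m≤n+m Δ 2)))) ⟩
      a Δ + 4 * ((Δ ∸ d) ⊓ (2 + Δ))  ≤⟨ m≤n+m∸n (a Δ + 4 * ((Δ ∸ d) ⊓ (2 + Δ))) (4 * (2 + Δ)) ⟩
      4 * (2 + Δ) + ω                ≡⟨ +-comm (4 * (2 + Δ)) ω ⟩
      ω + 4 * (2 + Δ)                ≡⟨ cong (λ z → ω + 4 * (2 + z)) (sym (m+[n∸m]≡n d≤Δ)) ⟩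
      ω + 4 * (2 + (d + (Δ ∸ d)))    ≡⟨ ar′ ω d (Δ ∸ d) ⟩
      ω + (8 + 4 * d) + 4 * (Δ ∸ d)  ∎

  module _ {n k : ℕ} (G : SimpleGraph n) (deg : ∀ u → cnt (adj? G u) ≡ Δ) (k≤ : k ≤ (Δ ∸ 1) + (Δ ∸ 1)) where

    breaker : 2 * Y * V < n * X → ¬ MakerWinsGame G b k
    breaker big with choose-N X Y V n 1≤X X≤Y big
    ... | N , Y< , NV< = Opening.breaker-beats k≤ 2≤Δ 1≤b wide B.weights refl d N room
                           (B.cost A A≤ N (Δ ∸ d) j jlB 1≤e 2≤b 1≤r aB 1≤aΔ aT≤ Y<)
      where
      open Selection G deg
      exp≡ : ∀ wd → regExp wd + spread wd ≡ regionExp wd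
      exp≡ true  = refl
      exp≡ false = refl
      S = suc Δ ^ regionExp wide
      room : N * suc Δ ^ (regExp wide + spread wide) * (Δ + suc d) < n * suc d
      room = begin-strict
        N * suc Δ ^ (regExp wide + spread wide) * (Δ + suc d) ≡⟨ cong (λ i → N * suc Δ ^ i * (Δ + suc d)) (exp≡ wide) ⟩
        N * S * (Δ + suc d)        ≤⟨ *-monoʳ-≤ (N * S) Δ<32 ⟩
        N * S * (33 * suc d)       ≡⟨ ar N S (suc d) ⟩
        N * (S * 33) * suc d       <⟨ *-monoˡ-< (suc d) NV< ⟩
        n * suc d                  ∎
        where
        ar : ∀ N S x → N * S * (33 * x) ≡ N * (S * 33) * x
        ar = solve-∀

-- Numerical estimates for b = 3, b = 2 and b ≥ 4.

finish : ∀ {Y V X n Q cKP} → 1 ≤ Q → 2 * Y * V * Q < cKP * X → cKP ≤ n * Q → 2 * Y * V < n * X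
finish {Y} {V} {X} {n} {Q} {cKP} 1≤Q lt le = *-cancelʳ-< Q (2 * Y * V) (n * X) (begin-strict
  2 * Y * V * Q  <⟨ lt ⟩
  cKP * X        ≤⟨ *-monoˡ-≤ X le ⟩
  n * Q * X      ≡⟨ ar n Q X ⟩
  n * X * Q      ∎)
  where
  ar : ∀ n q x → n * q * x ≡ n * x * q
  ar = solve-∀

2+≤2* : ∀ D → 2 + D ≤ 2 * suc D
2+≤2* D = ≤-trans (m≤m+n (2 + D) D) (≤-reflexive (e D))
  where
  e : ∀ D → 2 + D + D ≡ 2 * suc D
  e = solve-∀

cube-bound : ∀ D → suc (suc D) ^ 3 * 33 ≤ 264 * (suc D * suc D * suc D)
cube-bound D = begin
  suc (suc D) ^ 3 * 33      ≤⟨ *-monoˡ-≤ 33 (^-monoˡ-≤ 3 (2+≤2* D)) ⟩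
  (2 * suc D) ^ 3 * 33      ≡⟨ ar (suc D) ⟩
  264 * (suc D * suc D * suc D) ∎
  where
  ar : ∀ x → 2 * x * (2 * x * (2 * x * 1)) * 33 ≡ 264 * (x * x * x)
  ar = solve-∀

fifth-bound : ∀ D → suc (suc D) ^ 5 * 33 ≤ 1056 * (suc D * suc D * suc D) * (suc D * suc D)
fifth-bound D = begin
  suc (suc D) ^ 5 * 33      ≤⟨ *-monoˡ-≤ 33 (^-monoˡ-≤ 5 (2+≤2* D)) ⟩
  (2 * suc D) ^ 5 * 33      ≡⟨ ar (suc D) ⟩
  1056 * (suc D * suc D * suc D) * (suc D * suc D) ∎
  where
  ar : ∀ x → 2 * x * (2 * x * (2 * x * (2 * x * (2 * x * 1)))) * 33 ≡ 1056 * (x * x * x) * (x * x)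
  ar = solve-∀

div-le : ∀ n q .{{_ : NonZero q}} → n / q * q ≤ n
div-le n q = m/n*n≤m n q

div-gt : ∀ n q .{{_ : NonZero q}} → n < q + n / q * q
div-gt n q = begin-strict
  n                  ≡⟨ m≡m%n+[m/n]*n n q ⟩
  n % q + n / q * q  <⟨ +-monoˡ-< (n / q * q) (m%n<n n q) ⟩
  q + n / q * q      ∎

pos^ : ∀ x m → 1 ≤ x → 1 ≤ x ^ m
pos^ x m 1≤x = m^n>0 x {{>-nonZero 1≤x}} m

-- The slope of a is limited by a-up to 4 − 12/b, hence the choices a = const for b = 3, slope −2 for b = 2
-- and slope 1 for b ≥ 4.
module Bias3 (D : ℕ) (1≤D : 1 ≤ D) where

  private
    Δ = suc D
    d = Δ / 32
    -- Since `lB` grows in proportion to Δ, so does the constant `aa = 4 (2 + lB)`, and the zone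
    -- above the junction costs a bounded factor. The zone below costs about 9^(Δ / 32), which is
    -- less than (13/12)^Δ.
    lB = 2 + d * 2
    aa = 4 * (4 + d * 2)
    j = Δ ∸ lB

  32d≤ : d * 32 ≤ Δ
  32d≤ = div-le Δ 32

  lB≤Δ : lB ≤ Δ
  lB≤Δ = go d 32d≤
    where
    go : ∀ d → d * 32 ≤ Δ → 2 + d * 2 ≤ Δ
    go zero _ = s≤s 1≤D
    go (suc d) le = ≤-trans (≤-trans (m≤m+n (2 + suc d * 2) (28 + d * 30)) (≤-reflexive (e d))) le
      where
      e : ∀ d → 2 + suc d * 2 + (28 + d * 30) ≡ suc d * 32
      e = solve-∀

  13≤ : 13 ≤ 3 * aa
  13≤ = ≤-trans (m≤m+n 13 35) (≤-trans (m≤m+n 48 (d * 24)) (≤-reflexive (e d)))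
    where
    e : ∀ d → 48 + d * 24 ≡ 3 * (4 * (4 + d * 2))
    e = solve-∀

  32≤ : 32 + 16 * d ≤ 3 * aa
  32≤ = ≤-trans (m≤m+n (32 + 16 * d) (16 + 8 * d)) (≤-reflexive (e d))
    where
    e : ∀ d → 32 + 16 * d + (16 + 8 * d) ≡ 3 * (4 * (4 + d * 2))
    e = solve-∀

  module L = Lower false 3 1 Δ lB aa j (λ _ → aa) (s≤s 1≤D) (s≤s (s≤s z≤n)) ≤-refl refl (s≤s z≤n)
    (λ l le → *-monoʳ-≤ 4 (+-monoʳ-≤ 2 le)) ≤-refl
    (λ l _ _ → ≤-refl) (λ l _ _ → m≤m+n _ 12) (λ l _ _ → ≤-refl)
    13≤ (m∸n+n≡m lB≤Δ) 32≤

  private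
    s = 3 * aa
    r = s ∸ 12

  12≤s : 12 ≤ s
  12≤s = ≤-trans (m≤m+n 12 (36 + d * 24)) (≤-reflexive (e d))
    where
    e : ∀ d → 12 + (36 + d * 24) ≡ 3 * (4 * (4 + d * 2))
    e = solve-∀

  -- 2 (d + 2) · 12 is exactly `s`, so a block of `d + 2` factors costs at most 2, and 32 blocks
  -- cover `j`.
  s^j : s ^ j ≤ 2 ^ 32 * r ^ j
  s^j = subst (λ z → z ^ j ≤ 2 ^ 32 * r ^ j) (m∸n+n≡m 12≤s)
    (ratio-pow r 12 (d + 2) 32 j L.1≤r (≤-reflexive (trans (e d) (sym (m∸n+n≡m 12≤s))))
      (≤-trans (m∸n≤m Δ lB) (≤-trans (<⇒≤ (div-gt Δ 32)) (≤-trans (m≤m+n _ 32) (≤-reflexive (e′ d))))))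
    where
    e : ∀ d → 2 * (d + 2) * 12 ≡ 3 * (4 * (4 + d * 2))
    e = solve-∀
    e′ : ∀ d → 32 + d * 32 + 32 ≡ 32 * (d + 2)
    e′ = solve-∀

  -- (13/12)^32 > 9
  12^ : 12 ^ Δ * 9 ^ d ≤ 13 ^ Δ
  12^ = subst (λ z → 12 ^ z * 9 ^ d ≤ 13 ^ z) (trans (+-comm (d * 32) ρ) (sym (m≡m%n+[m/n]*n Δ 32))) (begin
    12 ^ (d * 32 + ρ) * 9 ^ d       ≡⟨ cong (_* 9 ^ d) (^-distribˡ-+-* 12 (d * 32) ρ) ⟩
    12 ^ (d * 32) * 12 ^ ρ * 9 ^ d  ≡⟨ cong (λ z → z * 12 ^ ρ * 9 ^ d) (sym (pow-* 12 32 d)) ⟩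
    (12 ^ 32) ^ d * 12 ^ ρ * 9 ^ d  ≡⟨ sw ((12 ^ 32) ^ d) (12 ^ ρ) (9 ^ d) ⟩
    (12 ^ 32) ^ d * 9 ^ d * 12 ^ ρ  ≡⟨ cong (_* 12 ^ ρ) (sym (*-^ (12 ^ 32) 9 d)) ⟩
    (12 ^ 32 * 9) ^ d * 12 ^ ρ      ≤⟨ *-mono-≤ (^-monoˡ-≤ d (≤ᵇ⇒≤ (12 ^ 32 * 9) (13 ^ 32) tt)) (^-monoˡ-≤ ρ (n≤1+n 12)) ⟩
    (13 ^ 32) ^ d * 13 ^ ρ          ≡⟨ cong (_* 13 ^ ρ) (pow-* 13 32 d) ⟩
    13 ^ (d * 32) * 13 ^ ρ          ≡⟨ sym (^-distribˡ-+-* 13 (d * 32) ρ) ⟩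
    13 ^ (d * 32 + ρ)               ∎)
    where
    ρ = Δ % 32
    sw : ∀ x y z → x * y * z ≡ x * z * y
    sw = solve-∀

  main : ∀ c → 2 ^ 60 ≤ c → 2 * L.Y * L.V * 8 ^ D < c * (Δ * Δ * Δ) * 13 ^ D * L.X
  main c c≥ = *-cancelʳ-< 12 _ _ (begin-strict
    2 * L.Y * L.V * 8 ^ D * 12
      ≤⟨ *-monoˡ-≤ 12 (*-monoˡ-≤ (8 ^ D) (*-mono-≤ (*-monoʳ-≤ 2 Y≤) (cube-bound D))) ⟩
    2 * (864 * (3 * 3 ^ D) * (3 * 9 ^ d) * (2 ^ 32 * R)) * (264 * K) * 8 ^ D * 12
      ≡⟨ e1 (3 ^ D) (9 ^ d) (2 ^ 32) R K (8 ^ D) ⟩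
    κ * (K * R) * (12 * (3 ^ D * 8 ^ D) * 9 ^ d)
      ≡⟨ cong (λ z → κ * (K * R) * (12 * z * 9 ^ d)) (trans (sym (*-^ 3 8 D)) (*-^ 2 12 D)) ⟩
    κ * (K * R) * (12 * (2 ^ D * 12 ^ D) * 9 ^ d)
      ≡⟨ e2 κ (K * R) (2 ^ D) (12 ^ D) (9 ^ d) ⟩
    κ * (K * R * 2 ^ D) * (12 * 12 ^ D * 9 ^ d)
      ≤⟨ *-monoʳ-≤ (κ * (K * R * 2 ^ D)) 12^ ⟩
    κ * (K * R * 2 ^ D) * (13 * 13 ^ D)
      ≡⟨ e3 κ (K * R * 2 ^ D) (13 ^ D) ⟩
    (κ * 13) * (K * R * 2 ^ D * 13 ^ D)
      <⟨ *-monoˡ-< (K * R * 2 ^ D * 13 ^ D) {{>-nonZero (*-mono-≤ (*-mono-≤ (*-mono-≤ 1≤K 1≤R) (pos^ 2 D (s≤s z≤n))) (pos^ 13 D (s≤s z≤n)))}}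
           (<-≤-trans (<ᵇ⇒< (κ * 13) (2 ^ 60 * 24) tt) (*-monoˡ-≤ 24 c≥)) ⟩
    c * 24 * (K * R * 2 ^ D * 13 ^ D)
      ≡⟨ e4 c K R (2 ^ D) (13 ^ D) ⟩
    c * K * 13 ^ D * (1 * (2 * 2 ^ D) * 1 * R) * 12
      ≡⟨ cong (λ z → c * K * 13 ^ D * (1 * (2 * 2 ^ D) * z * R) * 12) (sym (^-zeroˡ (1 + d * 2))) ⟩
    c * (Δ * Δ * Δ) * 13 ^ D * L.X * 12 ∎)
    where
    κ = 2 * 864 * 9 * 264 * 2 ^ 32
    K = Δ * Δ * Δ
    R = r ^ j
    1≤K : 1 ≤ K
    1≤K = s≤s z≤n
    1≤R : 1 ≤ R
    1≤R = pos^ r j L.1≤r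
    Y≤ : L.Y ≤ 864 * (3 * 3 ^ D) * (3 * 9 ^ d) * (2 ^ 32 * R)
    Y≤ = *-mono-≤ (≤-reflexive (cong (λ z → 864 * (3 * 3 ^ D) * (3 * z)) (sym (pow-* 3 2 d)))) s^j
    e1 : ∀ x y t R K z → 2 * (864 * (3 * x) * (3 * y) * (t * R)) * (264 * K) * z * 12 ≡
      (2 * 864 * 9 * 264 * t) * (K * R) * (12 * (x * z) * y)
    e1 = solve-∀
    e2 : ∀ k x a b y → k * x * (12 * (a * b) * y) ≡ k * (x * a) * (12 * b * y)
    e2 = solve-∀
    e3 : ∀ k x y → k * x * (13 * y) ≡ (k * 13) * (x * y)
    e3 = solve-∀
    e4 : ∀ c K R a b → c * 24 * (K * R * a * b) ≡ c * K * b * (1 * (2 * a) * 1 * R) * 12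
    e4 = solve-∀

  result : ∀ c → 2 ^ 60 ≤ c → ∀ {n k} (G : SimpleGraph n) → (∀ u → cnt (adj? G u) ≡ Δ) → k ≤ D + D →
    c * (Δ * Δ * Δ) * 13 ^ D ≤ n * 8 ^ D → ¬ MakerWinsGame G 3 k
  result c c≥ {n} G deg k≤ hyp = L.breaker G deg k≤ (finish {L.Y} {L.V} {L.X} {n} (pos^ 8 D (s≤s z≤n)) (main c c≥) hyp)

-- Bernoulli's inequality (1 + 1/x)^i ≥ 1 + i/x without denominators.
bernoulli′ : ∀ x i → x ^ i * (x + i) ≤ x * suc x ^ i
bernoulli′ x zero = ≤-reflexive (e x)
  where
  e : ∀ x → 1 * (x + 0) ≡ x * 1
  e = solve-∀
bernoulli′ x (suc i) = begin
  x * x ^ i * (x + suc i)            ≡⟨ e1 x (x ^ i) i ⟩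
  x * (x ^ i * (x + i)) + x * x ^ i  ≤⟨ +-mono-≤ (*-monoʳ-≤ x (bernoulli′ x i)) (*-monoʳ-≤ x (^-monoˡ-≤ i (n≤1+n x))) ⟩
  x * (x * suc x ^ i) + x * suc x ^ i ≡⟨ e2 x (suc x ^ i) ⟩
  x * (suc x * suc x ^ i)            ∎
  where
  e1 : ∀ x y i → x * y * (x + suc i) ≡ x * (y * (x + i)) + x * y
  e1 = solve-∀
  e2 : ∀ x y → x * (x * y) + x * y ≡ x * (suc x * y)
  e2 = solve-∀

module Bias2 (D : ℕ) (1≤D : 1 ≤ D) where

  private
    Δ = suc D
    d = Δ / 32
    -- From `4 * (2 + lB)` at the junction `a` falls with slope -2, so `a Δ` is about 6 f - 2 Δ and
    -- stays of order Δ if f exceeds Δ / 3 by a fixed proportion. The zone below the junction costs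
    -- about 2^f, which has to stay below (169/128)^Δ, that is f below about 0.4 Δ.
    f = 3 * Δ / 8
    lB = 2 + f
    a : ℕ → ℕ
    a l = 6 * (4 + f) ∸ 2 * (2 + l)
    A = a Δ
    j = Δ ∸ lB

  8f≤ : f * 8 ≤ 3 * Δ
  8f≤ = div-le (3 * Δ) 8

  8f> : 3 * Δ < 8 + f * 8
  8f> = div-gt (3 * Δ) 8

  -- 8 (6 (4 + f) − 2 (2 + Δ)) = 160 + 48 f − 16 Δ > 2 Δ + 112
  room : 8 * (2 * (2 + Δ)) + (118 + 2 * Δ) ≤ 8 * (6 * (4 + f))
  room = begin
    8 * (2 * (2 + Δ)) + (118 + 2 * Δ)   ≡⟨ e1 Δ ⟩
    6 * suc (3 * Δ) + 144               ≤⟨ +-monoˡ-≤ 144 (*-monoʳ-≤ 6 8f>) ⟩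
    6 * (8 + f * 8) + 144               ≡⟨ e2 f ⟩
    8 * (6 * (4 + f))                   ∎
    where
    e1 : ∀ x → 8 * (2 * (2 + x)) + (118 + 2 * x) ≡ 6 * suc (3 * x) + 144
    e1 = solve-∀
    e2 : ∀ f → 6 * (8 + f * 8) + 144 ≡ 8 * (6 * (4 + f))
    e2 = solve-∀

  no-trunc : 2 * (2 + Δ) ≤ 6 * (4 + f)
  no-trunc = *-cancelˡ-≤ 8 (≤-trans (m≤m+n _ (118 + 2 * Δ)) room)

  A≥ : 59 + Δ ≤ 4 * A
  A≥ = *-cancelˡ-≤ 2 (+-cancelˡ-≤ (8 * (2 * (2 + Δ))) _ _ (begin
    8 * (2 * (2 + Δ)) + 2 * (59 + Δ)     ≡⟨ e1 Δ ⟩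
    8 * (2 * (2 + Δ)) + (118 + 2 * Δ)    ≤⟨ room ⟩
    8 * (6 * (4 + f))                    ≡⟨ cong (8 *_) (sym (m+[n∸m]≡n no-trunc)) ⟩
    8 * (2 * (2 + Δ) + A)                ≡⟨ e2 (2 * (2 + Δ)) A ⟩
    8 * (2 * (2 + Δ)) + 2 * (4 * A)      ∎))
    where
    e1 : ∀ x → 8 * (2 * (2 + x)) + 2 * (59 + x) ≡ 8 * (2 * (2 + x)) + (118 + 2 * x)
    e1 = solve-∀
    e2 : ∀ y A → 8 * (y + A) ≡ 8 * y + 2 * (4 * A)
    e2 = solve-∀

  lB≤Δ : lB ≤ Δ
  lB≤Δ = go D 1≤D
    where
    go : ∀ D → 1 ≤ D → 2 + 3 * suc D / 8 ≤ suc D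
    go 1 _ = ≤-refl
    go 2 _ = ≤-refl
    go (suc (suc (suc D))) _ = *-cancelˡ-≤ 8 (begin
      8 * (2 + f′)             ≡⟨ e1 f′ ⟩
      16 + f′ * 8              ≤⟨ +-monoʳ-≤ 16 (div-le (3 * (4 + D)) 8) ⟩
      16 + 3 * (4 + D)         ≤⟨ m≤m+n _ (4 + 5 * D) ⟩
      16 + 3 * (4 + D) + (4 + 5 * D) ≡⟨ e2 D ⟩
      8 * (4 + D)              ∎)
      where
      f′ = 3 * (4 + D) / 8
      e1 : ∀ f → 8 * (2 + f) ≡ 16 + f * 8
      e1 = solve-∀
      e2 : ∀ D → 16 + 3 * (4 + D) + (4 + 5 * D) ≡ 8 * (4 + D)
      e2 = solve-∀

  a-step : ∀ l → suc l ≤ Δ → a (suc l) + 2 ≡ a l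
  a-step l le = +-cancelʳ-≡ (2 * (2 + l)) _ _ (begin-equality
    a (suc l) + 2 + 2 * (2 + l)    ≡⟨ e (a (suc l)) l ⟩
    a (suc l) + 2 * (3 + l)        ≡⟨ m∸n+n≡m (≤-trans (*-monoʳ-≤ 2 (+-monoʳ-≤ 2 le)) no-trunc) ⟩
    6 * (4 + f)                    ≡⟨ sym (m∸n+n≡m (≤-trans (*-monoʳ-≤ 2 (+-monoʳ-≤ 2 (<⇒≤ le))) no-trunc)) ⟩
    a l + 2 * (2 + l)              ∎)
    where
    e : ∀ x l → x + 2 + 2 * (2 + l) ≡ x + 2 * (3 + l)
    e = solve-∀

  a≤ : ∀ l → lB ≤ l → a l ≤ 4 * (2 + l)
  a≤ l le = m≤n+o⇒m∸n≤o (6 * (4 + f)) (2 * (2 + l)) (≤-trans (*-monoʳ-≤ 6 (+-monoʳ-≤ 2 le)) (≤-reflexive (e (2 + l))))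
    where
    e : ∀ x → 6 * x ≡ 2 * x + 4 * x
    e = solve-∀

  aB : 4 * (2 + lB) ≤ a lB
  aB = ≤-reflexive (sym (trans (cong (_∸ 2 * (4 + f)) (e (4 + f))) (m+n∸m≡n (2 * (4 + f)) (4 * (4 + f)))))
    where
    e : ∀ x → 6 * x ≡ 2 * x + 4 * x
    e = solve-∀

  a-up : ∀ l → lB ≤ l → suc l ≤ Δ → 2 * a (suc l) + 12 ≤ 2 * a l + 8
  a-up l _ le = ≤-reflexive (trans (e (a (suc l))) (cong (λ z → 2 * z + 8) (a-step l le)))
    where
    e : ∀ x → 2 * x + 12 ≡ 2 * (x + 2) + 8
    e = solve-∀

  a-down : ∀ l → lB ≤ l → suc l ≤ Δ → 2 * a l ≤ 2 * a (suc l) + 12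
  a-down l _ le = ≤-trans (≤-reflexive (cong (2 *_) (sym (a-step l le)))) (≤-trans (m≤m+n _ 8) (≤-reflexive (e (a (suc l)))))
    where
    e : ∀ x → 2 * (x + 2) + 8 ≡ 2 * x + 12
    e = solve-∀

  13≤ : 13 ≤ 2 * A
  13≤ = *-cancelˡ-≤ 2 (≤-trans (≤-trans (m≤m+n 26 33) (m≤m+n 59 Δ)) (≤-trans A≥ (≤-reflexive (e A))))
    where
    e : ∀ x → 4 * x ≡ 2 * (2 * x)
    e = solve-∀

  32≤ : 32 + 16 * d ≤ 3 * A
  32≤ = *-cancelˡ-≤ 4 (begin
    4 * (32 + 16 * d)        ≡⟨ e1 d ⟩
    128 + 2 * (d * 32)       ≤⟨ +-mono-≤ (m≤m+n 128 49) (*-mono-≤ (n≤1+n 2) (div-le Δ 32)) ⟩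
    177 + 3 * Δ              ≡⟨ e2 Δ ⟩
    3 * (59 + Δ)             ≤⟨ *-monoʳ-≤ 3 A≥ ⟩
    3 * (4 * A)              ≡⟨ e3 A ⟩
    4 * (3 * A)              ∎)
    where
    e1 : ∀ d → 4 * (32 + 16 * d) ≡ 128 + 2 * (d * 32)
    e1 = solve-∀
    e2 : ∀ x → 177 + 3 * x ≡ 3 * (59 + x)
    e2 = solve-∀
    e3 : ∀ x → 3 * (4 * x) ≡ 4 * (3 * x)
    e3 = solve-∀

  module L = Lower true 2 2 Δ lB A j a (s≤s 1≤D) ≤-refl (s≤s z≤n) refl (s≤s z≤n) a≤ aB a-up a-down
    (λ l _ le → ∸-monoʳ-≤ (6 * (4 + f)) (*-monoʳ-≤ 2 (+-monoʳ-≤ 2 le))) 13≤ (m∸n+n≡m lB≤Δ) 32≤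

  private
    s = 2 * A
    r = s ∸ 12

  s^j : s ^ j ≤ 2 ^ 48 * r ^ j
  s^j = subst (λ z → z ^ j ≤ 2 ^ 48 * r ^ j) s≡
    (ratio-pow r 12 m 48 j L.1≤r (≤-trans m≤ (≤-reflexive (sym s≡)))
      (≤-trans (m∸n≤m Δ lB) (≤-trans (<⇒≤ (div-gt Δ 48)) (≤-reflexive (e′ (Δ / 48))))))
    where
    m = suc (Δ / 48)
    s≡ : r + 12 ≡ s
    s≡ = m∸n+n≡m (≤-trans (m≤n+m 12 1) 13≤)
    e′ : ∀ x → 48 + x * 48 ≡ 48 * suc x
    e′ = solve-∀
    m≤ : 2 * m * 12 ≤ s
    m≤ = *-cancelˡ-≤ 2 (begin
      2 * (2 * m * 12)     ≡⟨ e1 (Δ / 48) ⟩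
      48 + Δ / 48 * 48     ≤⟨ +-mono-≤ (m≤m+n 48 11) (div-le Δ 48) ⟩
      59 + Δ               ≤⟨ A≥ ⟩
      4 * A                ≡⟨ e2 A ⟩
      2 * (2 * A)          ∎)
      where
      e1 : ∀ x → 2 * (2 * suc x * 12) ≡ 48 + x * 48
      e1 = solve-∀
      e2 : ∀ x → 4 * x ≡ 2 * (2 * x)
      e2 = solve-∀

  private
    i = Δ / 8
    ρ = Δ % 8

  -- (169/128)^8 > 8 (15/14)²; the factor (15/14)^(2i) pays for the square of i.
  i²-bound : (128 ^ 8 * 8) ^ i * (suc i * suc i) ≤ 196 * (169 ^ 8) ^ i
  i²-bound = *-cancelˡ-≤ (196 ^ i) {{>-nonZero (pos^ 196 i (s≤s z≤n))}} (begin
    196 ^ i * (Bi * (suc i * suc i))       ≡⟨ cong (_* (Bi * (suc i * suc i))) (*-^ 14 14 i) ⟩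
    14 ^ i * 14 ^ i * (Bi * (suc i * suc i)) ≡⟨ e1 (14 ^ i) Bi (suc i) ⟩
    Bi * ((14 ^ i * suc i) * (14 ^ i * suc i)) ≤⟨ *-monoʳ-≤ Bi (*-mono-≤ lin lin) ⟩
    Bi * ((14 * 15 ^ i) * (14 * 15 ^ i))   ≡⟨ e2 Bi (15 ^ i) ⟩
    196 * (Bi * (15 ^ i * 15 ^ i))         ≡⟨ cong (λ z → 196 * (Bi * z)) (sym (*-^ 15 15 i)) ⟩
    196 * (Bi * 225 ^ i)                   ≡⟨ cong (196 *_) (sym (*-^ (128 ^ 8 * 8) 225 i)) ⟩
    196 * (128 ^ 8 * 8 * 225) ^ i          ≤⟨ *-monoʳ-≤ 196 (^-monoˡ-≤ i (≤ᵇ⇒≤ (128 ^ 8 * 8 * 225) (196 * 169 ^ 8) tt)) ⟩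
    196 * (196 * 169 ^ 8) ^ i              ≡⟨ cong (196 *_) (*-^ 196 (169 ^ 8) i) ⟩
    196 * (196 ^ i * (169 ^ 8) ^ i)        ≡⟨ e3 (196 ^ i) ((169 ^ 8) ^ i) ⟩
    196 ^ i * (196 * (169 ^ 8) ^ i)        ∎)
    where
    Bi = (128 ^ 8 * 8) ^ i
    lin : 14 ^ i * suc i ≤ 14 * 15 ^ i
    lin = ≤-trans (*-monoʳ-≤ (14 ^ i) (+-monoˡ-≤ i (s≤s z≤n))) (bernoulli′ 14 i)
    e1 : ∀ x b y → x * x * (b * (y * y)) ≡ b * ((x * y) * (x * y))
    e1 = solve-∀
    e2 : ∀ b x → b * ((14 * x) * (14 * x)) ≡ 196 * (b * (x * x))
    e2 = solve-∀
    e3 : ∀ x y → 196 * (x * y) ≡ x * (196 * y)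
    e3 = solve-∀

  growth : 128 ^ Δ * 8 ^ i * (suc i * suc i) ≤ 196 * 169 ^ Δ
  growth = subst (λ z → 128 ^ z * 8 ^ i * (suc i * suc i) ≤ 196 * 169 ^ z) (trans (+-comm (i * 8) ρ) (sym (m≡m%n+[m/n]*n Δ 8))) (begin
    128 ^ (i * 8 + ρ) * 8 ^ i * S          ≡⟨ cong (λ z → z * 8 ^ i * S) (^-distribˡ-+-* 128 (i * 8) ρ) ⟩
    128 ^ (i * 8) * 128 ^ ρ * 8 ^ i * S    ≡⟨ cong (λ z → z * 128 ^ ρ * 8 ^ i * S) (sym (pow-* 128 8 i)) ⟩
    (128 ^ 8) ^ i * 128 ^ ρ * 8 ^ i * S    ≡⟨ e1 ((128 ^ 8) ^ i) (128 ^ ρ) (8 ^ i) S ⟩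
    (128 ^ 8) ^ i * 8 ^ i * S * 128 ^ ρ    ≡⟨ cong (λ z → z * S * 128 ^ ρ) (sym (*-^ (128 ^ 8) 8 i)) ⟩
    (128 ^ 8 * 8) ^ i * S * 128 ^ ρ        ≤⟨ *-mono-≤ i²-bound (^-monoˡ-≤ ρ (m≤m+n 128 41)) ⟩
    196 * (169 ^ 8) ^ i * 169 ^ ρ          ≡⟨ cong (λ z → 196 * z * 169 ^ ρ) (pow-* 169 8 i) ⟩
    196 * 169 ^ (i * 8) * 169 ^ ρ          ≡⟨ *-assoc 196 (169 ^ (i * 8)) (169 ^ ρ) ⟩
    196 * (169 ^ (i * 8) * 169 ^ ρ)        ≡⟨ cong (196 *_) (sym (^-distribˡ-+-* 169 (i * 8) ρ)) ⟩
    196 * 169 ^ (i * 8 + ρ)                ∎)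
    where
    S = suc i * suc i
    e1 : ∀ x y z s → x * y * z * s ≡ x * z * s * y
    e1 = solve-∀

  Δ≤ : Δ ≤ 8 * suc i
  Δ≤ = ≤-trans (<⇒≤ (div-gt Δ 8)) (≤-reflexive (e i))
    where
    e : ∀ i → 8 + i * 8 ≡ 8 * suc i
    e = solve-∀

  2^f : 2 ^ f ≤ 4 * 8 ^ i
  2^f = begin
    2 ^ f              ≤⟨ ^-monoʳ-≤ 2 f≤ ⟩
    2 ^ (2 + i * 3)    ≡⟨ ^-distribˡ-+-* 2 2 (i * 3) ⟩
    4 * 2 ^ (i * 3)    ≡⟨ cong (4 *_) (sym (pow-* 2 3 i)) ⟩
    4 * 8 ^ i          ∎
    where
    e : ∀ i → 3 * (8 + i * 8) ≡ (3 + i * 3) * 8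
    e = solve-∀
    f≤ : f ≤ 2 + i * 3
    f≤ = ≤-pred (*-cancelʳ-< 8 f (3 + i * 3) (≤-<-trans 8f≤ (<-≤-trans (*-monoʳ-< 3 (div-gt Δ 8)) (≤-reflexive (e i)))))

  main : ∀ c → 2 ^ 90 ≤ c → 2 * L.Y * L.V * 8 ^ (D * 2) < c * (Δ * Δ * Δ) * 13 ^ (D * 2) * L.X
  main c c≥ = *-cancelʳ-< 128 _ _ (begin-strict
    2 * L.Y * L.V * 8 ^ (D * 2) * 128
      ≤⟨ *-monoˡ-≤ 128 (*-mono-≤ (*-mono-≤ (*-monoʳ-≤ 2 Y≤) (fifth-bound D)) (≤-reflexive (sym (pow-* 8 2 D)))) ⟩
    2 * (256 * (2 * 2 ^ D) * (4 * (2 ^ f * 2 ^ f)) * (2 ^ 48 * R)) * (1056 * K * (Δ * Δ)) * 64 ^ D * 128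
      ≡⟨ e1 (2 ^ D) (2 ^ f) (2 ^ 48) R K (Δ * Δ) (64 ^ D) ⟩
    κ * (K * R * 2 ^ f) * (128 * (2 ^ D * 64 ^ D) * 2 ^ f * (Δ * Δ))
      ≡⟨ cong (λ z → κ * (K * R * 2 ^ f) * (128 * z * 2 ^ f * (Δ * Δ))) (sym (*-^ 2 64 D)) ⟩
    κ * (K * R * 2 ^ f) * (128 ^ Δ * 2 ^ f * (Δ * Δ))
      ≤⟨ *-monoʳ-≤ (κ * (K * R * 2 ^ f)) (*-mono-≤ (*-monoʳ-≤ (128 ^ Δ) 2^f) (*-mono-≤ Δ≤ Δ≤)) ⟩
    κ * (K * R * 2 ^ f) * (128 ^ Δ * (4 * 8 ^ i) * (8 * suc i * (8 * suc i)))
      ≡⟨ e2 κ (K * R * 2 ^ f) (128 ^ Δ) (8 ^ i) (suc i) ⟩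
    (κ * 256) * (K * R * 2 ^ f) * (128 ^ Δ * 8 ^ i * (suc i * suc i))
      ≤⟨ *-monoʳ-≤ ((κ * 256) * (K * R * 2 ^ f)) growth ⟩
    (κ * 256) * (K * R * 2 ^ f) * (196 * (169 * 169 ^ D))
      ≡⟨ e3 (κ * 256) (K * R * 2 ^ f) (169 ^ D) ⟩
    (κ * 256 * 33124) * (K * R * 2 ^ f * 169 ^ D)
      <⟨ *-monoˡ-< (K * R * 2 ^ f * 169 ^ D) {{>-nonZero (*-mono-≤ (*-mono-≤ (*-mono-≤ 1≤K 1≤R) (pos^ 2 f (s≤s z≤n))) (pos^ 169 D (s≤s z≤n)))}}
           (<-≤-trans (<ᵇ⇒< (κ * 256 * 33124) (2 ^ 90 * 2048) tt) (*-monoˡ-≤ 2048 c≥)) ⟩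
    c * 2048 * (K * R * 2 ^ f * 169 ^ D)
      ≡⟨ cong (λ z → c * 2048 * (K * R * 2 ^ f * z)) (pow-* 13 2 D) ⟩
    c * 2048 * (K * R * 2 ^ f * 13 ^ (D * 2))
      ≡⟨ e4 c K R (2 ^ f) (13 ^ (D * 2)) ⟩
    c * K * 13 ^ (D * 2) * (8 * 1 * (2 * 2 ^ f) * R) * 128
      ≡⟨ cong (λ z → c * K * 13 ^ (D * 2) * (8 * z * (2 * 2 ^ f) * R) * 128) (sym (^-zeroˡ Δ)) ⟩
    c * (Δ * Δ * Δ) * 13 ^ (D * 2) * L.X * 128 ∎)
    where
    κ = 2 * 256 * 8 * 1056 * 2 ^ 48
    K = Δ * Δ * Δ
    R = r ^ j
    1≤K : 1 ≤ K
    1≤K = s≤s z≤n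
    1≤R : 1 ≤ R
    1≤R = pos^ r j L.1≤r
    Y≤ : L.Y ≤ 256 * (2 * 2 ^ D) * (4 * (2 ^ f * 2 ^ f)) * (2 ^ 48 * R)
    Y≤ = *-mono-≤ (≤-reflexive (cong (λ z → 256 * (2 * 2 ^ D) * (4 * z)) (*-^ 2 2 f))) s^j
    e1 : ∀ x y t R K q z → 2 * (256 * (2 * x) * (4 * (y * y)) * (t * R)) * (1056 * K * q) * z * 128 ≡
      (2 * 256 * 8 * 1056 * t) * (K * R * y) * (128 * (x * z) * y * q)
    e1 = solve-∀
    e2 : ∀ k x a b y → k * x * (a * (4 * b) * (8 * y * (8 * y))) ≡ (k * 256) * x * (a * b * (y * y))
    e2 = solve-∀
    e3 : ∀ k x y → k * x * (196 * (169 * y)) ≡ (k * 33124) * (x * y)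
    e3 = solve-∀
    e4 : ∀ c K R a b → c * 2048 * (K * R * a * b) ≡ c * K * b * (8 * 1 * (2 * a) * R) * 128
    e4 = solve-∀

  result : ∀ c → 2 ^ 90 ≤ c → ∀ {n k} (G : SimpleGraph n) → (∀ u → cnt (adj? G u) ≡ Δ) → k ≤ D + D →
    c * (Δ * Δ * Δ) * 13 ^ (D * 2) ≤ n * 8 ^ (D * 2) → ¬ MakerWinsGame G 2 k
  result c c≥ {n} G deg k≤ hyp =
    L.breaker G deg k≤ (finish {L.Y} {L.V} {L.X} {n} (pos^ 8 (D * 2) (s≤s z≤n)) (main c c≥) hyp)

isqrt : ∀ D → ∃ λ σ → σ * σ ≤ D × D < suc σ * suc σ
isqrt zero = 0 , z≤n , s≤s z≤n
isqrt (suc D) with isqrt D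
... | σ , lo , hi with suc D <? suc σ * suc σ
...   | yes lt = σ , m≤n⇒m≤1+n lo , lt
...   | no ¬lt = suc σ , ≮⇒≥ ¬lt , ≤-<-trans hi (*-mono-< (n<1+n (suc σ)) (n<1+n (suc σ)))

-- (1 + 1/m)^k ≤ 1 + (2^k − 1)/m
pow-linear : ℕ → ℕ
pow-linear zero    = 0
pow-linear (suc k) = suc (2 * pow-linear k)

suc-pow : ∀ m k → 1 ≤ m → m * suc m ^ k ≤ m ^ k * (m + pow-linear k)
suc-pow m zero 1≤m = ≤-reflexive (e m)
  where
  e : ∀ m → m * 1 ≡ 1 * (m + 0)
  e = solve-∀
suc-pow m (suc k) 1≤m = begin
  m * (suc m * suc m ^ k)             ≡⟨ e1 m (suc m ^ k) ⟩
  suc m * (m * suc m ^ k)             ≤⟨ *-monoʳ-≤ (suc m) (suc-pow m k 1≤m) ⟩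
  suc m * (m ^ k * (m + c))           ≡⟨ e2 m (m ^ k) c ⟩
  m ^ k * (m * m + m + c * m + c * 1) ≤⟨ *-monoʳ-≤ (m ^ k) (+-monoʳ-≤ (m * m + m + c * m) (*-monoʳ-≤ c 1≤m)) ⟩
  m ^ k * (m * m + m + c * m + c * m) ≡⟨ e3 m (m ^ k) c ⟩
  m * m ^ k * (m + suc (2 * c))       ∎
  where
  c = pow-linear k
  e1 : ∀ m x → m * (suc m * x) ≡ suc m * (m * x)
  e1 = solve-∀
  e2 : ∀ m x c → suc m * (x * (m + c)) ≡ x * (m * m + m + c * m + c * 1)
  e2 = solve-∀
  e3 : ∀ m x c → x * (m * m + m + c * m + c * m) ≡ m * x * (m + suc (2 * c))
  e3 = solve-∀

-- 27594 = 9 · 1022 · 3; opaque, to keep powers of two with this exponent from being computed.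
opaque
  halvings : ℕ
  halvings = 27594

  halvings≡ : halvings ≡ 9198 * 3
  halvings≡ = refl

-- The estimates for b ≥ 4, with m = b − 1, e = b − 2, g = b − 3.
module Estimate (b m e g s r σ j D : ℕ) (1≤m : 1 ≤ m) (1≤e : 1 ≤ e) (1≤r : 1 ≤ r) (3≤b : 3 ≤ b) (suc-m≡b : suc m ≡ b) (b≤ : b ≤ 2 * m)
  (six : m ^ 6 * b ≤ g * b ^ 6) (three : m ^ 3 * b ≤ e * b ^ 3)
  (σ²≤D : σ * σ ≤ D) (s^j : g ^ (3 + σ) * s ^ j ≤ b ^ (3 + σ) * r ^ j) where

  private
    ℓ = 3 + σ
    Δ = suc D
    Y = 32 * b ^ 3 * b ^ Δ * (b * 1) ^ σ * s ^ j
    X = e ^ 3 * m ^ Δ * e ^ σ * r ^ j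
    V = suc Δ ^ 3 * 33

  1≤b : 1 ≤ b
  1≤b = ≤-trans (s≤s z≤n) 3≤b

  b≡ : m + 1 ≡ b
  b≡ = trans (+-comm m 1) suc-m≡b

  raise : ∀ {x y z w} → x * y ≤ z * w → x ^ ℓ * y ^ ℓ ≤ z ^ ℓ * w ^ ℓ
  raise {x} {y} {z} {w} le = subst₂ _≤_ (*-^ x y ℓ) (*-^ z w ℓ) (^-monoˡ-≤ ℓ le)

  -- All losses of order √Δ become powers of b / m: b / e at the steps up to the junction counts as
  -- three factors, b / g for each block above it as six.
  absorb : b ^ ℓ * s ^ j * (m ^ 9) ^ ℓ ≤ e ^ ℓ * r ^ j * (b ^ 9) ^ ℓ
  absorb = *-cancelʳ-≤ _ _ (b ^ ℓ) {{>-nonZero (pos^ b ℓ 1≤b)}} (begin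
    b ^ ℓ * s ^ j * (m ^ 9) ^ ℓ * b ^ ℓ                 ≡⟨ cong (λ z → b ^ ℓ * s ^ j * z * b ^ ℓ) (split m) ⟩
    b ^ ℓ * s ^ j * ((m ^ 6) ^ ℓ * (m ^ 3) ^ ℓ) * b ^ ℓ ≡⟨ q1 (b ^ ℓ) (s ^ j) ((m ^ 6) ^ ℓ) ((m ^ 3) ^ ℓ) ⟩
    s ^ j * ((m ^ 6) ^ ℓ * b ^ ℓ) * ((m ^ 3) ^ ℓ * b ^ ℓ) ≤⟨ *-mono-≤ (*-monoʳ-≤ (s ^ j) (raise {m ^ 6} {b} {g} {b ^ 6} six)) (raise {m ^ 3} {b} {e} {b ^ 3} three) ⟩
    s ^ j * (g ^ ℓ * (b ^ 6) ^ ℓ) * (e ^ ℓ * (b ^ 3) ^ ℓ) ≡⟨ q2 (s ^ j) (g ^ ℓ) ((b ^ 6) ^ ℓ) (e ^ ℓ) ((b ^ 3) ^ ℓ) ⟩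
    (g ^ ℓ * s ^ j) * (e ^ ℓ * ((b ^ 6) ^ ℓ * (b ^ 3) ^ ℓ)) ≤⟨ *-monoˡ-≤ (e ^ ℓ * ((b ^ 6) ^ ℓ * (b ^ 3) ^ ℓ)) s^j ⟩
    (b ^ ℓ * r ^ j) * (e ^ ℓ * ((b ^ 6) ^ ℓ * (b ^ 3) ^ ℓ)) ≡⟨ cong (λ z → (b ^ ℓ * r ^ j) * (e ^ ℓ * z)) (sym (split b)) ⟩
    (b ^ ℓ * r ^ j) * (e ^ ℓ * (b ^ 9) ^ ℓ)             ≡⟨ q3 (b ^ ℓ) (r ^ j) (e ^ ℓ) ((b ^ 9) ^ ℓ) ⟩
    e ^ ℓ * r ^ j * (b ^ 9) ^ ℓ * b ^ ℓ                 ∎)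
    where
    split : ∀ x → (x ^ 9) ^ ℓ ≡ (x ^ 6) ^ ℓ * (x ^ 3) ^ ℓ
    split x = trans (cong (_^ ℓ) (^-distribˡ-+-* x 6 3)) (*-^ (x ^ 6) (x ^ 3) ℓ)
    q1 : ∀ b s x y → b * s * (x * y) * b ≡ s * (x * b) * (y * b)
    q1 = solve-∀
    q2 : ∀ s g x e y → s * (g * x) * (e * y) ≡ (g * s) * (e * (x * y))
    q2 = solve-∀
    q3 : ∀ b r e x → (b * r) * (e * x) ≡ e * r * x * b
    q3 = solve-∀

  private P = 2 * (m * b)

  1≤P : 1 ≤ P
  1≤P = *-mono-≤ {1} {2} (s≤s z≤n) (*-mono-≤ 1≤m 1≤b)

  -- If σ is large, the second-order term of exp dominates; otherwise (b/m)^(9σ) is bounded.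
  slack : P ^ D * (b ^ 9) ^ σ ≤ 2 ^ halvings * (suc P ^ D * (m ^ 9) ^ σ)
  slack with 1022 * b ≤? σ
  ... | yes big = ≤-trans large (m≤n*m _ (2 ^ halvings) {{>-nonZero (pos^ 2 halvings (s≤s z≤n))}})
    where
    -- (b/m)^9 ≤ 1 + 511/m with 511 = 2⁹ - 1, and 511/m = 1022 b / P is at most σ / P. By Bernoulli
    -- σ factors 1 + 1/P outweigh (b/m)^9, and D ≥ σ² provides σ such blocks.
    b⁹P : b ^ 9 * P ≤ (P + σ) * m ^ 9
    b⁹P = begin
      b ^ 9 * (2 * (m * b))     ≡⟨ q1 (b ^ 9) m b ⟩
      2 * b * (m * b ^ 9)       ≤⟨ *-monoʳ-≤ (2 * b) (subst (λ z → m * z ^ 9 ≤ m ^ 9 * (m + 511)) suc-m≡b (suc-pow m 9 1≤m)) ⟩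
      2 * b * (m ^ 9 * (m + 511)) ≡⟨ q2 b (m ^ 9) m ⟩
      (2 * (m * b) + 1022 * b) * m ^ 9 ≤⟨ *-monoˡ-≤ (m ^ 9) (+-monoʳ-≤ P big) ⟩
      (P + σ) * m ^ 9           ∎
      where
      q1 : ∀ x m b → x * (2 * (m * b)) ≡ 2 * b * (m * x)
      q1 = solve-∀
      q2 : ∀ b x m → 2 * b * (x * (m + 511)) ≡ (2 * (m * b) + 1022 * b) * x
      q2 = solve-∀
    block : P ^ σ * b ^ 9 ≤ suc P ^ σ * m ^ 9
    block = *-cancelˡ-≤ P {{>-nonZero 1≤P}} (begin
      P * (P ^ σ * b ^ 9)         ≡⟨ q1 P (P ^ σ) (b ^ 9) ⟩
      P ^ σ * (b ^ 9 * P)         ≤⟨ *-monoʳ-≤ (P ^ σ) b⁹P ⟩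
      P ^ σ * ((P + σ) * m ^ 9)   ≡⟨ sym (*-assoc (P ^ σ) (P + σ) (m ^ 9)) ⟩
      P ^ σ * (P + σ) * m ^ 9     ≤⟨ *-monoˡ-≤ (m ^ 9) (bernoulli′ P σ) ⟩
      P * suc P ^ σ * m ^ 9       ≡⟨ *-assoc P (suc P ^ σ) (m ^ 9) ⟩
      P * (suc P ^ σ * m ^ 9)     ∎)
      where
      q1 : ∀ p x y → p * (x * y) ≡ x * (y * p)
      q1 = solve-∀
    large : P ^ D * (b ^ 9) ^ σ ≤ suc P ^ D * (m ^ 9) ^ σ
    large with m≤n⇒∃[o]m+o≡n σ²≤D
    ... | i , eq = subst (λ z → P ^ z * (b ^ 9) ^ σ ≤ suc P ^ z * (m ^ 9) ^ σ) eq (begin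
      P ^ (σ * σ + i) * (b ^ 9) ^ σ        ≡⟨ cong (_* (b ^ 9) ^ σ) (^-distribˡ-+-* P (σ * σ) i) ⟩
      P ^ (σ * σ) * P ^ i * (b ^ 9) ^ σ    ≡⟨ cong (λ z → z * P ^ i * (b ^ 9) ^ σ) (sym (pow-* P σ σ)) ⟩
      (P ^ σ) ^ σ * P ^ i * (b ^ 9) ^ σ    ≡⟨ q ((P ^ σ) ^ σ) (P ^ i) ((b ^ 9) ^ σ) ⟩
      (P ^ σ) ^ σ * (b ^ 9) ^ σ * P ^ i    ≡⟨ cong (_* P ^ i) (sym (*-^ (P ^ σ) (b ^ 9) σ)) ⟩
      (P ^ σ * b ^ 9) ^ σ * P ^ i          ≤⟨ *-mono-≤ (^-monoˡ-≤ σ block) (^-monoˡ-≤ i (n≤1+n P)) ⟩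
      (suc P ^ σ * m ^ 9) ^ σ * suc P ^ i  ≡⟨ cong (_* suc P ^ i) (*-^ (suc P ^ σ) (m ^ 9) σ) ⟩
      (suc P ^ σ) ^ σ * (m ^ 9) ^ σ * suc P ^ i ≡⟨ q ((suc P ^ σ) ^ σ) ((m ^ 9) ^ σ) (suc P ^ i) ⟩
      (suc P ^ σ) ^ σ * suc P ^ i * (m ^ 9) ^ σ ≡⟨ cong (λ z → z * suc P ^ i * (m ^ 9) ^ σ) (pow-* (suc P) σ σ) ⟩
      suc P ^ (σ * σ) * suc P ^ i * (m ^ 9) ^ σ ≡⟨ cong (_* (m ^ 9) ^ σ) (sym (^-distribˡ-+-* (suc P) (σ * σ) i)) ⟩
      suc P ^ (σ * σ + i) * (m ^ 9) ^ σ    ∎)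
      where
      q : ∀ x y z → x * y * z ≡ x * z * y
      q = solve-∀
  ... | no small = begin
    P ^ D * (b ^ 9) ^ σ                     ≤⟨ *-mono-≤ (^-monoˡ-≤ D (n≤1+n P)) pw ⟩
    suc P ^ D * (2 ^ halvings * (m ^ 9) ^ σ)   ≡⟨ q (suc P ^ D) (2 ^ halvings) ((m ^ 9) ^ σ) ⟩
    2 ^ halvings * (suc P ^ D * (m ^ 9) ^ σ)   ∎
    where
    q : ∀ x y z → x * (y * z) ≡ y * (x * z)
    q = solve-∀
    -- h factors b / m cost at most 2 by Bernoulli. For b ≥ 3 moreover b ≤ 3 h, which is the 3 in
    -- `halvings`.
    h = b / 2
    9σ≤ : σ * 9 ≤ halvings * h
    9σ≤ = begin
      σ * 9               ≤⟨ *-monoˡ-≤ 9 (<⇒≤ (≰⇒> small)) ⟩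
      1022 * b * 9        ≡⟨ q1 b ⟩
      9198 * b            ≤⟨ *-monoʳ-≤ 9198 (≤-pred (≤-trans (div-gt b 2) (≤-trans (+-monoˡ-≤ (h * 2) (s≤s 1≤h)) (≤-reflexive (q2 h))))) ⟩
      9198 * (3 * h)      ≡⟨ sym (*-assoc 9198 3 h) ⟩
      9198 * 3 * h        ≡⟨ cong (_* h) (sym halvings≡) ⟩
      halvings * h           ∎
      where
      1≤h : 1 ≤ h
      1≤h = n≢0⇒n>0 (λ z → <-irrefl refl (≤-trans (≤-trans 3≤b (<⇒≤ (div-gt b 2))) (≤-reflexive (cong (λ y → 2 + y * 2) z))))
      q1 : ∀ b → 1022 * b * 9 ≡ 9198 * b
      q1 = solve-∀
      q2 : ∀ h → suc h + h * 2 ≡ suc (3 * h)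
      q2 = solve-∀
    pw : (b ^ 9) ^ σ ≤ 2 ^ halvings * (m ^ 9) ^ σ
    pw = subst₂ (λ x y → x ≤ 2 ^ halvings * y) (sym (pow-* b 9 σ)) (sym (pow-* m 9 σ))
      (subst (λ z → z ^ (σ * 9) ≤ 2 ^ halvings * m ^ (σ * 9)) b≡
        (ratio-pow m 1 h halvings (σ * 9) 1≤m
          (≤-trans (≤-reflexive (q′ h)) (≤-trans (div-le b 2) (≤-reflexive (sym b≡)))) 9σ≤))
      where
      q′ : ∀ h → 2 * h * 1 ≡ h * 2
      q′ = solve-∀

  private
    Q = 2 * (m * m)
    p = 2 * (m * m) + 2 * m + 1

  -- This is the identity 1 + 1/m + 1/(2 m²) = (1 + 1/m)(1 + 1/P): per level, the bound for exp
  -- exceeds the main term b / m by the factor 1 + 1/P.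
  p≡ : p ≡ suc P
  p≡ = trans (q m) (cong (λ z → suc (2 * (m * z))) suc-m≡b)
    where
    q : ∀ x → 2 * (x * x) + 2 * x + 1 ≡ suc (2 * (x * suc x))
    q = solve-∀

  -- The part of the loss that does not grow with D: one factor b / m because Δ = D + 1, and 27
  -- because ℓ = 3 + σ.
  b²⁸ : b * (b ^ 9) ^ 3 ≤ 2 ^ 28 * (m * (m ^ 9) ^ 3)
  b²⁸ = begin
    b * (b ^ 9) ^ 3              ≡⟨ cong (b *_) (pow-* b 9 3) ⟩
    b ^ 28                       ≤⟨ ^-monoˡ-≤ 28 b≤ ⟩
    (2 * m) ^ 28                 ≡⟨ *-^ 2 m 28 ⟩
    2 ^ 28 * m ^ 28              ≡⟨ cong (λ z → 2 ^ 28 * (m * z)) (sym (pow-* m 9 3)) ⟩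
    2 ^ 28 * (m * (m ^ 9) ^ 3)   ∎

  -- 16896 = 2 · 32 · 264, where 2 comes from `choose-N`, 32 from `cost` and 264 from `cube-bound`.
  reduced : ∀ c → 2 ^ (halvings + 46) ≤ c → 16896 * Q ^ D * b ^ Δ * (b ^ 9) ^ ℓ < c * p ^ D * m ^ Δ * (m ^ 9) ^ ℓ
  reduced c c≥ = begin-strict
    16896 * Q ^ D * (b * b ^ D) * (b ^ 9) ^ ℓ
      ≡⟨ cong (16896 * Q ^ D * (b * b ^ D) *_) (^-distribˡ-+-* (b ^ 9) 3 σ) ⟩
    16896 * Q ^ D * (b * b ^ D) * ((b ^ 9) ^ 3 * (b ^ 9) ^ σ)
      ≡⟨ q1 (Q ^ D) b (b ^ D) ((b ^ 9) ^ 3) ((b ^ 9) ^ σ) ⟩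
    16896 * (b * (b ^ 9) ^ 3) * ((Q ^ D * b ^ D) * (b ^ 9) ^ σ)
      ≡⟨ cong (λ z → 16896 * (b * (b ^ 9) ^ 3) * (z * (b ^ 9) ^ σ)) QbD ⟩
    16896 * (b * (b ^ 9) ^ 3) * (m ^ D * P ^ D * (b ^ 9) ^ σ)
      ≤⟨ *-monoˡ-≤ (m ^ D * P ^ D * (b ^ 9) ^ σ) (*-monoʳ-≤ 16896 b²⁸) ⟩
    16896 * (2 ^ 28 * (m * (m ^ 9) ^ 3)) * (m ^ D * P ^ D * (b ^ 9) ^ σ)
      ≡⟨ q2 (2 ^ 28) (m * (m ^ 9) ^ 3) (m ^ D) (P ^ D) ((b ^ 9) ^ σ) ⟩
    16896 * 2 ^ 28 * (m * (m ^ 9) ^ 3 * m ^ D) * (P ^ D * (b ^ 9) ^ σ)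
      ≤⟨ *-monoʳ-≤ (16896 * 2 ^ 28 * (m * (m ^ 9) ^ 3 * m ^ D)) slack ⟩
    16896 * 2 ^ 28 * (m * (m ^ 9) ^ 3 * m ^ D) * (2 ^ halvings * (suc P ^ D * (m ^ 9) ^ σ))
      ≡⟨ q3 (16896 * 2 ^ 28) (m * (m ^ 9) ^ 3 * m ^ D) (2 ^ halvings) (suc P ^ D * (m ^ 9) ^ σ) ⟩
    (16896 * 2 ^ 28 * 2 ^ halvings) * (m * (m ^ 9) ^ 3 * m ^ D * (suc P ^ D * (m ^ 9) ^ σ))
      <⟨ *-monoˡ-< _ {{>-nonZero pos}} (<-≤-trans const< c≥) ⟩
    c * (m * (m ^ 9) ^ 3 * m ^ D * (suc P ^ D * (m ^ 9) ^ σ))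
      ≡⟨ q4 c m ((m ^ 9) ^ 3) (m ^ D) (suc P ^ D) ((m ^ 9) ^ σ) ⟩
    c * suc P ^ D * (m * m ^ D) * ((m ^ 9) ^ 3 * (m ^ 9) ^ σ)
      ≡⟨ cong₂ (λ y z → c * y ^ D * (m * m ^ D) * z) (sym p≡) (sym (^-distribˡ-+-* (m ^ 9) 3 σ)) ⟩
    c * p ^ D * m ^ Δ * (m ^ 9) ^ ℓ ∎
    where
    q1 : ∀ x b y z w → 16896 * x * (b * y) * (z * w) ≡ 16896 * (b * z) * ((x * y) * w)
    q1 = solve-∀
    q2 : ∀ t x y z w → 16896 * (t * x) * (y * z * w) ≡ 16896 * t * (x * y) * (z * w)
    q2 = solve-∀
    q3 : ∀ k x t y → k * x * (t * y) ≡ (k * t) * (x * y)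
    q3 = solve-∀
    q4 : ∀ c m x y z w → c * (m * x * y * (z * w)) ≡ c * z * (m * y) * (x * w)
    q4 = solve-∀
    QbD : Q ^ D * b ^ D ≡ m ^ D * P ^ D
    QbD = trans (sym (*-^ Q b D)) (trans (cong (_^ D) (q m b)) (*-^ m P D))
      where
      q : ∀ m b → 2 * (m * m) * b ≡ m * (2 * (m * b))
      q = solve-∀
    pos : 1 ≤ m * (m ^ 9) ^ 3 * m ^ D * (suc P ^ D * (m ^ 9) ^ σ)
    pos = *-mono-≤ (*-mono-≤ (*-mono-≤ {1} {m} 1≤m (pos^ (m ^ 9) 3 1≤m⁹)) (pos^ m D 1≤m))
                   (*-mono-≤ (pos^ (suc P) D (s≤s z≤n)) (pos^ (m ^ 9) σ 1≤m⁹))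
      where
      1≤m⁹ : 1 ≤ m ^ 9
      1≤m⁹ = pos^ m 9 1≤m
    const< : 16896 * 2 ^ 28 * 2 ^ halvings < 2 ^ (halvings + 46)
    const< = begin-strict
      16896 * 2 ^ 28 * 2 ^ halvings <⟨ *-monoˡ-< (2 ^ halvings) {{>-nonZero (pos^ 2 halvings (s≤s z≤n))}} (<ᵇ⇒< (16896 * 2 ^ 28) (2 ^ 46) tt) ⟩
      2 ^ 46 * 2 ^ halvings         ≡⟨ *-comm (2 ^ 46) (2 ^ halvings) ⟩
      2 ^ halvings * 2 ^ 46         ≡⟨ sym (^-distribˡ-+-* 2 halvings 46) ⟩
      2 ^ (halvings + 46)                  ∎

  main : ∀ c → 2 ^ (halvings + 46) ≤ c → 2 * Y * V * Q ^ D < c * (Δ * Δ * Δ) * p ^ D * X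
  main c c≥ = *-cancelʳ-< ((m ^ 9) ^ ℓ) _ _ (begin-strict
    2 * Y * V * Q ^ D * M
      ≤⟨ *-monoˡ-≤ M (*-monoˡ-≤ (Q ^ D) (*-monoʳ-≤ (2 * Y) (cube-bound D))) ⟩
    2 * Y * (264 * K) * Q ^ D * M
      ≡⟨ cong (λ z → 2 * (32 * b ^ 3 * b ^ Δ * z ^ σ * s ^ j) * (264 * K) * Q ^ D * M) (*-identityʳ b) ⟩
    2 * (32 * b ^ 3 * b ^ Δ * b ^ σ * s ^ j) * (264 * K) * Q ^ D * M
      ≡⟨ q1 (b ^ 3) (b ^ Δ) (b ^ σ) (s ^ j) K (Q ^ D) M ⟩
    16896 * K * Q ^ D * b ^ Δ * (b ^ 3 * b ^ σ * s ^ j * M)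
      ≡⟨ cong (λ z → 16896 * K * Q ^ D * b ^ Δ * (z * s ^ j * M)) (sym (^-distribˡ-+-* b 3 σ)) ⟩
    16896 * K * Q ^ D * b ^ Δ * (b ^ ℓ * s ^ j * M)
      ≤⟨ *-monoʳ-≤ (16896 * K * Q ^ D * b ^ Δ) absorb ⟩
    16896 * K * Q ^ D * b ^ Δ * (e ^ ℓ * r ^ j * (b ^ 9) ^ ℓ)
      ≡⟨ q2 K (Q ^ D) (b ^ Δ) (e ^ ℓ) (r ^ j) ((b ^ 9) ^ ℓ) ⟩
    (K * e ^ ℓ * r ^ j) * (16896 * Q ^ D * b ^ Δ * (b ^ 9) ^ ℓ)
      <⟨ *-monoʳ-< (K * e ^ ℓ * r ^ j) {{>-nonZero (*-mono-≤ (*-mono-≤ {1} {K} 1≤K (pos^ e ℓ 1≤e)) (pos^ r j 1≤r))}} (reduced c c≥) ⟩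
    (K * e ^ ℓ * r ^ j) * (c * p ^ D * m ^ Δ * M)
      ≡⟨ cong (λ z → (K * z * r ^ j) * (c * p ^ D * m ^ Δ * M)) (^-distribˡ-+-* e 3 σ) ⟩
    (K * (e ^ 3 * e ^ σ) * r ^ j) * (c * p ^ D * m ^ Δ * M)
      ≡⟨ q3 K (e ^ 3) (e ^ σ) (r ^ j) c (p ^ D) (m ^ Δ) M ⟩
    c * (Δ * Δ * Δ) * p ^ D * X * M ∎)
    where
    K = Δ * Δ * Δ
    1≤K : 1 ≤ K
    1≤K = s≤s z≤n
    M = (m ^ 9) ^ ℓ
    q1 : ∀ x y z w K q M → 2 * (32 * x * y * z * w) * (264 * K) * q * M ≡ 16896 * K * q * y * (x * z * w * M)
    q1 = solve-∀
    q2 : ∀ K q y e r z → 16896 * K * q * y * (e * r * z) ≡ (K * e * r) * (16896 * q * y * z)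
    q2 = solve-∀
    q3 : ∀ K x y r c p m M → (K * (x * y) * r) * (c * p * m * M) ≡ c * K * p * (x * m * y * r) * M
    q3 = solve-∀

module Bias≥4 (b′ D : ℕ) (1≤D : 1 ≤ D) where

  private
    g = 1 + b′
    e = 2 + b′
    m = 3 + b′
    b = 4 + b′
    Δ = suc D
    σ = proj₁ (isqrt D)
    σ²≤D = proj₁ (proj₂ (isqrt D))
    D<σ² = proj₂ (proj₂ (isqrt D))
    ℓ = 3 + σ
    lB = 1 + σ
    a : ℕ → ℕ
    a l = 3 * ℓ + (2 + l)
    A = 4 * ℓ
    j = Δ ∸ lB

  σ≤D : σ ≤ D
  σ≤D = ≤-trans (go σ) σ²≤D
    where
    go : ∀ x → x ≤ x * x
    go zero = z≤n
    go (suc x) = m≤m*n (suc x) (suc x)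

  a≤ : ∀ l → lB ≤ l → a l ≤ 4 * (2 + l)
  a≤ l le = ≤-trans (+-monoˡ-≤ (2 + l) (*-monoʳ-≤ 3 (+-monoʳ-≤ 2 le))) (≤-reflexive (q (2 + l)))
    where
    q : ∀ x → 3 * x + x ≡ 4 * x
    q = solve-∀

  aB : 4 * (2 + lB) ≤ a lB
  aB = ≤-reflexive (q (3 + σ))
    where
    q : ∀ x → 4 * x ≡ 3 * x + x
    q = solve-∀

  a-up : ∀ l → lB ≤ l → suc l ≤ Δ → b * a (suc l) + 12 ≤ b * a l + 4 * b
  a-up l _ _ = ≤-trans (m≤m+n _ (3 * b′)) (≤-reflexive (q b′ (3 * ℓ) l))
    where
    q : ∀ x y l → (4 + x) * (y + (3 + l)) + 12 + 3 * x ≡ (4 + x) * (y + (2 + l)) + 4 * (4 + x)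
    q = solve-∀

  a-down : ∀ l → lB ≤ l → suc l ≤ Δ → b * a l ≤ b * a (suc l) + 12
  a-down l _ _ = ≤-trans (*-monoʳ-≤ b (+-monoʳ-≤ (3 * ℓ) (n≤1+n (2 + l)))) (m≤m+n _ 12)

  A≤ : ∀ l → lB ≤ l → l ≤ Δ → A ≤ a l
  A≤ l le _ = ≤-trans (≤-reflexive (q (3 + σ))) (+-monoʳ-≤ (3 * ℓ) (+-monoʳ-≤ 2 le))
    where
    q : ∀ x → 4 * x ≡ 3 * x + x
    q = solve-∀

  13≤ : 13 ≤ b * A
  13≤ = ≤-trans (m≤m+n 13 35) (*-mono-≤ {4} {b} (m≤m+n 4 b′) (*-monoʳ-≤ 4 (m≤m+n 3 σ)))

  32≤ : 32 + 16 * (Δ / 32) ≤ 3 * a Δ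
  32≤ = begin
    32 + 16 * (Δ / 32)        ≤⟨ +-monoʳ-≤ 32 (≤-trans (*-monoˡ-≤ (Δ / 32) (m≤m+n 16 16)) (≤-trans (≤-reflexive (*-comm 32 (Δ / 32))) (div-le Δ 32))) ⟩
    32 + Δ                    ≤⟨ m≤m+n _ (1 + 9 * σ + 2 * Δ) ⟩
    32 + Δ + (1 + 9 * σ + 2 * Δ) ≡⟨ q σ Δ ⟩
    3 * a Δ                   ∎
    where
    q : ∀ σ x → 32 + x + (1 + 9 * σ + 2 * x) ≡ 3 * (3 * (3 + σ) + (2 + x))
    q = solve-∀

  module L = Lower false b e Δ lB A j a (s≤s 1≤D) (s≤s (s≤s z≤n)) (s≤s z≤n) (*-identityʳ b) (s≤s z≤n)
    a≤ aB a-up a-down A≤ 13≤ (m∸n+n≡m (s≤s σ≤D)) 32≤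

  private
    s = b * A
    r = s ∸ 12

  s≡ : r + 12 ≡ s
  s≡ = m∸n+n≡m (≤-trans (m≤n+m 12 1) 13≤)

  r≤s : r ≤ s
  r≤s = m∸n≤m s 12

  -- (r/s)^ℓ ≥ 1 − 12 ℓ / s = (b − 3)/b
  one-block : g * s ^ ℓ ≤ b * r ^ ℓ
  one-block = *-cancelˡ-≤ (4 * ℓ) (+-cancelʳ-≤ (ℓ * 12 * s ^ ℓ) _ _ (begin
    4 * ℓ * (g * s ^ ℓ) + ℓ * 12 * s ^ ℓ   ≡⟨ q1 ℓ b′ (s ^ ℓ) ⟩
    s * s ^ ℓ                              ≤⟨ subst (λ z → z * z ^ ℓ ≤ z * r ^ ℓ + ℓ * 12 * z ^ ℓ) s≡ (bernoulli r 12 ℓ) ⟩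
    s * r ^ ℓ + ℓ * 12 * s ^ ℓ             ≡⟨ cong (_+ ℓ * 12 * s ^ ℓ) (q2 ℓ b (r ^ ℓ)) ⟩
    4 * ℓ * (b * r ^ ℓ) + ℓ * 12 * s ^ ℓ   ∎))
    where
    q1 : ∀ l x y → 4 * l * ((1 + x) * y) + l * 12 * y ≡ (4 + x) * (4 * l) * y
    q1 = solve-∀
    q2 : ∀ l b y → b * (4 * l) * y ≡ 4 * l * (b * y)
    q2 = solve-∀

  -- Since j ≤ Δ ≤ (σ + 1)² ≤ ℓ², ℓ blocks of length ℓ suffice.
  s^j : g ^ ℓ * s ^ j ≤ b ^ ℓ * r ^ j
  s^j = pow-shrink r s (b ^ ℓ) (g ^ ℓ) j (ℓ * ℓ) L.1≤r r≤s j≤ (begin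
    g ^ ℓ * s ^ (ℓ * ℓ)   ≡⟨ cong (g ^ ℓ *_) (sym (pow-* s ℓ ℓ)) ⟩
    g ^ ℓ * (s ^ ℓ) ^ ℓ   ≡⟨ sym (*-^ g (s ^ ℓ) ℓ) ⟩
    (g * s ^ ℓ) ^ ℓ       ≤⟨ ^-monoˡ-≤ ℓ one-block ⟩
    (b * r ^ ℓ) ^ ℓ       ≡⟨ *-^ b (r ^ ℓ) ℓ ⟩
    b ^ ℓ * (r ^ ℓ) ^ ℓ   ≡⟨ cong (b ^ ℓ *_) (pow-* r ℓ ℓ) ⟩
    b ^ ℓ * r ^ (ℓ * ℓ)   ∎)
    where
    j≤ : j ≤ ℓ * ℓ
    j≤ = ≤-trans (m∸n≤m Δ lB) (≤-trans D<σ² (*-mono-≤ (m≤n+m (suc σ) 2) (m≤n+m (suc σ) 2)))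

  -- b/(b−3) ≤ (b/(b−1))^6 and b/(b−2) ≤ (b/(b−1))^3
  six : m ^ 6 * b ≤ g * b ^ 6
  six = ≤-trans (m≤m+n _ (rest b′ * (4 + b′))) (≤-reflexive (q b′))
    where
    rest : ℕ → ℕ
    rest x = 3 * (x * x * x * x * x) + 45 * (x * x * x * x) + 260 * (x * x * x) + 705 * (x * x) + 846 * x + 295
    q : ∀ x → (3 + x) * ((3 + x) * ((3 + x) * ((3 + x) * ((3 + x) * ((3 + x) * 1))))) * (4 + x)
      + (3 * (x * x * x * x * x) + 45 * (x * x * x * x) + 260 * (x * x * x) + 705 * (x * x) + 846 * x + 295) * (4 + x)
      ≡ (1 + x) * ((4 + x) * ((4 + x) * ((4 + x) * ((4 + x) * ((4 + x) * ((4 + x) * 1))))))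
    q = solve-∀

  three : m ^ 3 * b ≤ e * b ^ 3
  three = ≤-trans (m≤m+n _ ((b′ * b′ + 5 * b′ + 5) * (4 + b′))) (≤-reflexive (q b′))
    where
    q : ∀ x → (3 + x) * ((3 + x) * ((3 + x) * 1)) * (4 + x) + (x * x + 5 * x + 5) * (4 + x)
      ≡ (2 + x) * ((4 + x) * ((4 + x) * ((4 + x) * 1)))
    q = solve-∀

  b≤2m : b ≤ 2 * m
  b≤2m = ≤-trans (m≤m+n b (2 + b′)) (≤-reflexive (q b′))
    where
    q : ∀ x → 4 + x + (2 + x) ≡ 2 * (3 + x)
    q = solve-∀

  module E = Estimate b m e g s r σ j D (s≤s z≤n) (s≤s z≤n) L.1≤r (s≤s (s≤s (s≤s z≤n))) refl b≤2m six three σ²≤D s^j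

  result : ∀ c → 2 ^ (halvings + 46) ≤ c → ∀ {n k} (G : SimpleGraph n) → (∀ u → cnt (adj? G u) ≡ Δ) → k ≤ D + D →
    c * (Δ * Δ * Δ) * (2 * (m * m) + 2 * m + 1) ^ D ≤ n * (2 * (m * m)) ^ D → ¬ MakerWinsGame G b k
  result c c≥ {n} G deg k≤ hyp =
    L.breaker G deg k≤ (finish {L.Y} {L.V} {L.X} {n} (pos^ (2 * (m * m)) D (s≤s z≤n)) (E.main c c≥) hyp)

-- The constant and the theorem.

opaque
  -- The value that the estimate for b ≥ 4 asks for; 2⁹⁰ and 2⁶⁰ would do for b = 2 and b = 3.
  constant : ℕ
  constant = 2 ^ (halvings + 46)

  constant≡ : constant ≡ 2 ^ (halvings + 46)
  constant≡ = refl

constant≥ : 2 ^ (halvings + 46) ≤ constant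
constant≥ = ≤-reflexive (sym constant≡)

44≤halvings : 44 ≤ halvings
44≤halvings = ≤-trans (≤ᵇ⇒≤ 44 (9198 * 3) tt) (≤-reflexive (sym halvings≡))

constant≥90 : 2 ^ 90 ≤ constant
constant≥90 = ≤-trans (^-monoʳ-≤ 2 {44 + 46} {halvings + 46} (+-monoˡ-≤ 46 44≤halvings)) constant≥

constant≥60 : 2 ^ 60 ≤ constant
constant≥60 = ≤-trans (^-monoʳ-≤ 2 {60} {90} (m≤m+n 60 30)) constant≥90

constant-nonZero : NonZero constant
constant-nonZero = >-nonZero (≤-trans (m^n>0 2 60) constant≥60)

lower-bound : ∀ b D → 2 ≤ b → 1 ≤ D → ∀ {n k} (G : SimpleGraph n) → (∀ u → cnt (adj? G u) ≡ suc D) →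
  BigEnough (fromℕ constant) b (suc D) n → k ≤ D + D → ¬ MakerWinsGame G b k
lower-bound 1 D (s≤s ()) _ _ _ _ _
lower-bound 2 D _ 1≤D {n} G deg big k≤ = Bias2.result D 1≤D constant constant≥90 G deg k≤
  (Exponential.exp-ℕ constant (suc D * suc D * suc D) n 1 (D * 2) (frac D 1) (Exponential.frac-halves D) big)
lower-bound 3 D _ 1≤D {n} G deg big k≤ = Bias3.result D 1≤D constant constant≥60 G deg k≤
  (Exponential.exp-ℕ constant (suc D * suc D * suc D) n 1 D (frac D 2) (Exponential.frac-unit D 1) big)
lower-bound (suc (suc (suc (suc b)))) D _ 1≤D {n} G deg big k≤ = Bias≥4.result b D 1≤D constant constant≥ G deg k≤
  (Exponential.exp-ℕ constant (suc D * suc D * suc D) n (2 + b) D (frac D (3 + b)) (Exponential.frac-unit D (2 + b)) big)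

theorem3 : Σ ℚ λ C → Positive C × (∀ (b Δ : ℕ) → 2 ≤ b → 2 ≤ Δ →
    ∀ (n : ℕ) (G : SimpleGraph n) → Regular G Δ → BigEnough C b Δ n →
    GameChromaticIndexIs G b (2 * Δ ∸ 1))
theorem3 = fromℕ constant , Exponential.fromℕ-pos constant {{constant-nonZero}} , bounds
  where
  bounds : ∀ (b Δ : ℕ) → 2 ≤ b → 2 ≤ Δ → ∀ (n : ℕ) (G : SimpleGraph n) → Regular G Δ →
    BigEnough (fromℕ constant) b Δ n → GameChromaticIndexIs G b (2 * Δ ∸ 1)
  bounds b (suc D) 2≤b (s≤s 1≤D) n G reg big =
    maker-upper G reg (s≤s z≤n) b ,
    λ k k< → lower-bound b D 2≤b 1≤D G (deg G reg (s≤s z≤n)) big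
      (≤-pred (≤-trans k< (≤-reflexive (trans (+-suc D (D + 0)) (cong (λ x → suc (D + x)) (+-identityʳ D))))))
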